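{- Let $G=\mathrm{SL}(2,\mathbf Z)$ and let $V$ be the standard $2$-dimensional $\mathbf CG$-module. There exists a $T$-indecomposable $\mathbf CG$-module $M$ having an ascending filtration $0=M_0\subseteq M_1\subseteq M_2\subseteq\cdots$ by $\mathbf CG$-submodules with $M=\bigcup_n M_n$ and $M_n/M_{n-1}\cong V$ for all $n\in\mathbf N$; and any two $T$-indecomposable $\mathbf CG$-modules having such a filtration are isomorphic.
   Context: $T=\begin{pmatrix}1&1\\0&1\end{pmatrix}$. A $\mathbf CG$-module is called $T$-indecomposable if $T$ acts indecomposably and unipotently on every $T$-invariant subspace. (The paper identifies the module in question as $M_\infty$, the space $E$ with basis $e_1,e_2,\dots$ on which $G$ acts by a representation $\tau$ with $\tau(T)$ the infinite Jordan block and filtration $E_i=\mathrm{span}(e_1,\dots,e_{2i})$.) -}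

module Defs where

open import Level using (0ℓ)
open import Algebra.Bundles using (CommutativeMonoid; CommutativeRing; Group)
open import Algebra.Module.Bundles using (LeftModule)
import Algebra.Module.Construct.DirectProduct as DirectProduct
import Algebra.Module.Construct.TensorUnit as TensorUnit
open import Algebra.Module.Morphism.Structures using (module LeftModuleMorphisms)
import Algebra.Properties.AbelianGroup as AbelianGroupProperties
import Algebra.Properties.CommutativeSemigroup as CommutativeSemigroupProperties
import Algebra.Solver.Ring.NaturalCoefficients.Default as NaturalSolver
open import Data.Integer.Base as ℤ using (ℤ; 0ℤ; 1ℤ)
import Data.Integer.Solver as ℤSolver
open import Data.Nat.Base as ℕ using (ℕ; suc)
import Data.Nat.Properties as ℕ
open import Data.Nat.GeneralisedArithmetic using (fold)
open import Data.Product.Base using (∃; _×_; _,_; proj₁; proj₂)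
open import Data.Rational.Base as ℚ using (ℚ; 0ℚ; 1ℚ; ½; ∣_∣)
open import Data.Rational.Literals using (fromℤ)
import Data.Rational.Properties as ℚ
open import Data.Rational.Solver using (module +-*-Solver)
import Data.Rational.Unnormalised.Base as ℚᵘ
import Data.Rational.Unnormalised.Properties as ℚᵘ
open import Data.Sum.Base using (_⊎_)
open import Relation.Binary.PropositionalEquality
  using (_≡_; refl; sym; trans; cong; cong₂; subst; subst₂)
import Relation.Binary.Reasoning.Setoid as SetoidReasoning
open import Relation.Unary using (Pred; _∈_; _⊆_)

-- Cauchy sequences of rationals, equal when their difference tends to 0.
-- The Σ-type in `cauchy` records a modulus of convergence; under excluded
-- middle every classical Cauchy sequence has one.

record ℝ : Set where
  no-eta-equality
  field
    seq    : ℕ → ℚ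
    cauchy : ∀ ε → 0ℚ ℚ.< ε →
             ∃ λ N → ∀ m n → N ℕ.≤ m → N ℕ.≤ n → ∣ seq m ℚ.- seq n ∣ ℚ.< ε

open ℝ public

infix 4 _≈ℝ_

record _≈ℝ_ (x y : ℝ) : Set where
  constructor mk≈ℝ
  field
    tends : ∀ ε → 0ℚ ℚ.< ε →
            ∃ λ N → ∀ n → N ℕ.≤ n → ∣ seq x n ℚ.- seq y n ∣ ℚ.< ε

open _≈ℝ_ public

private
  module Estimates where
    open +-*-Solver

    half : ∀ ε → ½ ℚ.* ε ℚ.+ ½ ℚ.* ε ≡ ε
    half = solve 1 (λ ε → con ½ :* ε :+ con ½ :* ε := ε) refl

    half-pos : ∀ {ε} → 0ℚ ℚ.< ε → 0ℚ ℚ.< ½ ℚ.* ε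
    half-pos {ε} 0<ε = ℚ.positive⁻¹ (½ ℚ.* ε) {{ℚ.pos*pos⇒pos ½ ε {{ℚ.positive 0<ε}}}}

    ∣p-p∣<ε : ∀ {p q ε} → p ≡ q → 0ℚ ℚ.< ε → ∣ p ℚ.- q ∣ ℚ.< ε
    ∣p-p∣<ε {p} refl 0<ε = subst (λ t → ∣ t ∣ ℚ.< _) (sym (ℚ.+-inverseʳ p)) 0<ε

    ∣p-q∣<⇒∣q-p∣< : ∀ p q {ε} → ∣ p ℚ.- q ∣ ℚ.< ε → ∣ q ℚ.- p ∣ ℚ.< ε
    ∣p-q∣<⇒∣q-p∣< p q = subst (ℚ._< _)
      (trans (sym (ℚ.∣-p∣≡∣p∣ (p ℚ.- q)))
             (cong ∣_∣ (solve 2 (λ p q → :- (p :- q) := q :- p) refl p q)))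

    triangle : ∀ p q r {ε} → ∣ p ℚ.- q ∣ ℚ.< ½ ℚ.* ε → ∣ q ℚ.- r ∣ ℚ.< ½ ℚ.* ε →
               ∣ p ℚ.- r ∣ ℚ.< ε
    triangle p q r {ε} h k =
      subst₂ ℚ._<_
        (cong ∣_∣ (solve 3 (λ p q r → (p :- q) :+ (q :- r) := p :- r) refl p q r))
        (half ε)
        (ℚ.≤-<-trans (ℚ.∣p+q∣≤∣p∣+∣q∣ (p ℚ.- q) (q ℚ.- r)) (ℚ.+-mono-< h k))

    near-+ : ∀ p q r s {ε} → ∣ p ℚ.- r ∣ ℚ.< ½ ℚ.* ε → ∣ q ℚ.- s ∣ ℚ.< ½ ℚ.* ε →
             ∣ (p ℚ.+ q) ℚ.- (r ℚ.+ s) ∣ ℚ.< ε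
    near-+ p q r s {ε} h k =
      subst₂ ℚ._<_
        (cong ∣_∣ (solve 4 (λ p q r s → (p :- r) :+ (q :- s) := (p :+ q) :- (r :+ s))
                     refl p q r s))
        (half ε)
        (ℚ.≤-<-trans (ℚ.∣p+q∣≤∣p∣+∣q∣ (p ℚ.- r) (q ℚ.- s)) (ℚ.+-mono-< h k))

    near-neg : ∀ p q {ε} → ∣ p ℚ.- q ∣ ℚ.< ε → ∣ ℚ.- p ℚ.- ℚ.- q ∣ ℚ.< ε
    near-neg p q = subst (ℚ._< _)
      (trans (sym (ℚ.∣-p∣≡∣p∣ (p ℚ.- q)))
             (cong ∣_∣ (solve 2 (λ p q → :- (p :- q) := :- p :- :- q) refl p q)))

    ∣p∣<∣q∣+1 : ∀ p q → ∣ p ℚ.- q ∣ ℚ.< 1ℚ → ∣ p ∣ ℚ.< ∣ q ∣ ℚ.+ 1ℚ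
    ∣p∣<∣q∣+1 p q h = subst (λ t → ∣ t ∣ ℚ.< _)
      (solve 2 (λ p q → q :+ (p :- q) := p) refl p q)
      (ℚ.≤-<-trans (ℚ.∣p+q∣≤∣p∣+∣q∣ q (p ℚ.- q)) (ℚ.+-monoʳ-< ∣ q ∣ h))

    scaled : ∀ K .{{_ : ℚ.Positive K}} → ℚ → ℚ
    scaled K ε = (ℚ.1/ K) {{ℚ.pos⇒nonZero K}} ℚ.* (½ ℚ.* ε)

    scaled-pos : ∀ K .{{_ : ℚ.Positive K}} {ε} → 0ℚ ℚ.< ε → 0ℚ ℚ.< scaled K ε
    scaled-pos K {ε} 0<ε = ℚ.positive⁻¹ (scaled K ε)
      {{ℚ.pos*pos⇒pos ((ℚ.1/ K) {{ℚ.pos⇒nonZero K}}) {{ℚ.1/pos⇒pos K}}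
                      (½ ℚ.* ε) {{ℚ.positive (half-pos 0<ε)}}}}

    scaled-* : ∀ K .{{_ : ℚ.Positive K}} ε → K ℚ.* scaled K ε ≡ ½ ℚ.* ε
    scaled-* K ε = trans (sym (ℚ.*-assoc K _ _))
      (trans (cong (ℚ._* (½ ℚ.* ε)) (ℚ.*-inverseʳ K {{ℚ.pos⇒nonZero K}}))
             (ℚ.*-identityˡ _))

    product< : ∀ K .{{_ : ℚ.Positive K}} u v {δ} → ∣ u ∣ ℚ.< K → ∣ v ∣ ℚ.< δ →
               ∣ u ℚ.* v ∣ ℚ.< K ℚ.* δ
    product< K u v h k = subst (ℚ._< _) (sym (ℚ.∣p*q∣≡∣p∣*∣q∣ u v))
      (ℚ.≤-<-trans (ℚ.*-monoʳ-≤-nonNeg ∣ v ∣ {{ℚ.∣-∣-nonNeg v}} (ℚ.<⇒≤ h))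
                   (ℚ.*-monoʳ-<-pos K k))

    near-* : ∀ K .{{_ : ℚ.Positive K}} p q r s {ε} → ∣ p ∣ ℚ.< K → ∣ s ∣ ℚ.< K →
             ∣ p ℚ.- r ∣ ℚ.< scaled K ε → ∣ q ℚ.- s ∣ ℚ.< scaled K ε →
             ∣ (p ℚ.* q) ℚ.- (r ℚ.* s) ∣ ℚ.< ε
    near-* K p q r s {ε} p<K s<K h k =
      subst₂ ℚ._<_
        (cong ∣_∣ (solve 4 (λ p q r s → p :* (q :- s) :+ s :* (p :- r)
                                          := (p :* q) :- (r :* s)) refl p q r s))
        (trans (cong₂ ℚ._+_ (scaled-* K ε) (scaled-* K ε)) (half ε))
        (ℚ.≤-<-trans (ℚ.∣p+q∣≤∣p∣+∣q∣ (p ℚ.* (q ℚ.- s)) (s ℚ.* (p ℚ.- r)))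
                     (ℚ.+-mono-< (product< K p _ p<K k) (product< K s _ s<K h)))

  open Estimates

  record CommonBound (x y : ℝ) : Set where
    field
      K      : ℚ
      K-pos  : ℚ.Positive K
      N      : ℕ
      x-below : ∀ n → N ℕ.≤ n → ∣ seq x n ∣ ℚ.< K
      y-below : ∀ n → N ℕ.≤ n → ∣ seq y n ∣ ℚ.< K

  commonBound : ∀ x y → CommonBound x y
  commonBound x y = record
    { K = Kx ℚ.+ Ky
    ; K-pos = ℚ.pos+pos⇒pos Kx {{Kx-pos}} Ky {{Ky-pos}}
    ; N = Nx ℕ.⊔ Ny
    ; x-below = λ n N≤n → ℚ.<-trans
        (∣p∣<∣q∣+1 (seq x n) _
          (proj₂ (cauchy x 1ℚ 0<1) n Nx (ℕ.m⊔n≤o⇒m≤o Nx Ny N≤n) ℕ.≤-refl))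
        (subst (ℚ._< Kx ℚ.+ Ky) (ℚ.+-identityʳ Kx)
          (ℚ.+-monoʳ-< Kx (ℚ.positive⁻¹ Ky {{Ky-pos}})))
    ; y-below = λ n N≤n → ℚ.<-trans
        (∣p∣<∣q∣+1 (seq y n) _
          (proj₂ (cauchy y 1ℚ 0<1) n Ny (ℕ.m⊔n≤o⇒n≤o Nx Ny N≤n) ℕ.≤-refl))
        (subst (ℚ._< Kx ℚ.+ Ky) (ℚ.+-identityˡ Ky)
          (ℚ.+-monoˡ-< Ky (ℚ.positive⁻¹ Kx {{Kx-pos}})))
    }
    where
    0<1 : 0ℚ ℚ.< 1ℚ
    0<1 = ℚ.positive⁻¹ 1ℚ
    Nx = proj₁ (cauchy x 1ℚ 0<1)
    Ny = proj₁ (cauchy y 1ℚ 0<1)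
    Kx = ∣ seq x Nx ∣ ℚ.+ 1ℚ
    Ky = ∣ seq y Ny ∣ ℚ.+ 1ℚ
    Kx-pos : ℚ.Positive Kx
    Kx-pos = ℚ.nonNeg+pos⇒pos ∣ seq x Nx ∣ {{ℚ.∣-∣-nonNeg (seq x Nx)}} 1ℚ
    Ky-pos : ℚ.Positive Ky
    Ky-pos = ℚ.nonNeg+pos⇒pos ∣ seq y Ny ∣ {{ℚ.∣-∣-nonNeg (seq y Ny)}} 1ℚ

infixl 6 _+ℝ_
infixl 7 _*ℝ_
infix  8 -ℝ_

_+ℝ_ : ℝ → ℝ → ℝ
seq (x +ℝ y) = λ n → seq x n ℚ.+ seq y n
cauchy (x +ℝ y) ε 0<ε =
  let (M , p) = cauchy x _ (half-pos 0<ε)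
      (N , q) = cauchy y _ (half-pos 0<ε)
  in M ℕ.⊔ N , λ m n M⊔N≤m M⊔N≤n →
     near-+ (seq x m) (seq y m) (seq x n) (seq y n)
       (p m n (ℕ.m⊔n≤o⇒m≤o M N M⊔N≤m) (ℕ.m⊔n≤o⇒m≤o M N M⊔N≤n))
       (q m n (ℕ.m⊔n≤o⇒n≤o M N M⊔N≤m) (ℕ.m⊔n≤o⇒n≤o M N M⊔N≤n))

-ℝ_ : ℝ → ℝ
seq (-ℝ x) = λ n → ℚ.- seq x n
cauchy (-ℝ x) ε 0<ε =
  let (N , p) = cauchy x ε 0<ε
  in N , λ m n N≤m N≤n → near-neg (seq x m) (seq x n) (p m n N≤m N≤n)

_*ℝ_ : ℝ → ℝ → ℝ
seq (x *ℝ y) = λ n → seq x n ℚ.* seq y n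
cauchy (x *ℝ y) ε 0<ε =
  let open CommonBound (commonBound x y) renaming (N to L)
      instance _ = K-pos
      (M , p) = cauchy x (scaled K ε) (scaled-pos K 0<ε)
      (N , q) = cauchy y (scaled K ε) (scaled-pos K 0<ε)
      L≤  = λ {k} (h : L ℕ.⊔ (M ℕ.⊔ N) ℕ.≤ k) → ℕ.m⊔n≤o⇒m≤o L (M ℕ.⊔ N) h
      MN≤ = λ {k} (h : L ℕ.⊔ (M ℕ.⊔ N) ℕ.≤ k) → ℕ.m⊔n≤o⇒n≤o L (M ℕ.⊔ N) h
  in L ℕ.⊔ (M ℕ.⊔ N) , λ m n h k →
     near-* K (seq x m) (seq y m) (seq x n) (seq y n)
       (x-below m (L≤ h)) (y-below n (L≤ k))
       (p m n (ℕ.m⊔n≤o⇒m≤o M N (MN≤ h)) (ℕ.m⊔n≤o⇒m≤o M N (MN≤ k)))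
       (q m n (ℕ.m⊔n≤o⇒n≤o M N (MN≤ h)) (ℕ.m⊔n≤o⇒n≤o M N (MN≤ k)))

fromℚ : ℚ → ℝ
seq (fromℚ q) = λ _ → q
cauchy (fromℚ q) ε 0<ε = 0 , λ _ _ _ _ → ∣p-p∣<ε {q} refl 0<ε

0ℝ 1ℝ : ℝ
0ℝ = fromℚ 0ℚ
1ℝ = fromℚ 1ℚ

pointwise⇒≈ℝ : ∀ {x y} → (∀ n → seq x n ≡ seq y n) → x ≈ℝ y
pointwise⇒≈ℝ x≗y = mk≈ℝ λ ε 0<ε → 0 , λ n _ → ∣p-p∣<ε (x≗y n) 0<ε

≈ℝ-refl : ∀ {x} → x ≈ℝ x
≈ℝ-refl = pointwise⇒≈ℝ λ _ → refl

≈ℝ-sym : ∀ {x y} → x ≈ℝ y → y ≈ℝ x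
≈ℝ-sym {x} {y} x≈y = mk≈ℝ λ ε 0<ε →
  let (N , p) = tends x≈y ε 0<ε
  in N , λ n N≤n → ∣p-q∣<⇒∣q-p∣< (seq x n) (seq y n) (p n N≤n)

≈ℝ-trans : ∀ {x y z} → x ≈ℝ y → y ≈ℝ z → x ≈ℝ z
≈ℝ-trans {x} {y} {z} x≈y y≈z = mk≈ℝ λ ε 0<ε →
  let (M , p) = tends x≈y _ (half-pos 0<ε)
      (N , q) = tends y≈z _ (half-pos 0<ε)
  in M ℕ.⊔ N , λ n h → triangle (seq x n) (seq y n) (seq z n)
       (p n (ℕ.m⊔n≤o⇒m≤o M N h)) (q n (ℕ.m⊔n≤o⇒n≤o M N h))

+ℝ-cong : ∀ {x y u v} → x ≈ℝ y → u ≈ℝ v → x +ℝ u ≈ℝ y +ℝ v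
+ℝ-cong {x} {y} {u} {v} x≈y u≈v = mk≈ℝ λ ε 0<ε →
  let (M , p) = tends x≈y _ (half-pos 0<ε)
      (N , q) = tends u≈v _ (half-pos 0<ε)
  in M ℕ.⊔ N , λ n h → near-+ (seq x n) (seq u n) (seq y n) (seq v n)
       (p n (ℕ.m⊔n≤o⇒m≤o M N h)) (q n (ℕ.m⊔n≤o⇒n≤o M N h))

-ℝ-cong : ∀ {x y} → x ≈ℝ y → -ℝ x ≈ℝ -ℝ y
-ℝ-cong {x} {y} x≈y = mk≈ℝ λ ε 0<ε →
  let (N , p) = tends x≈y ε 0<ε
  in N , λ n N≤n → near-neg (seq x n) (seq y n) (p n N≤n)

*ℝ-cong : ∀ {x y u v} → x ≈ℝ y → u ≈ℝ v → x *ℝ u ≈ℝ y *ℝ v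
*ℝ-cong {x} {y} {u} {v} x≈y u≈v = mk≈ℝ λ ε 0<ε →
  let open CommonBound (commonBound x v) renaming (N to L)
      instance _ = K-pos
      (M , p) = tends x≈y (scaled K ε) (scaled-pos K 0<ε)
      (N , q) = tends u≈v (scaled K ε) (scaled-pos K 0<ε)
  in L ℕ.⊔ (M ℕ.⊔ N) , λ n h →
     let L≤n   = ℕ.m⊔n≤o⇒m≤o L (M ℕ.⊔ N) h
         M⊔N≤n = ℕ.m⊔n≤o⇒n≤o L (M ℕ.⊔ N) h
     in near-* K (seq x n) (seq u n) (seq y n) (seq v n)
          (x-below n L≤n) (y-below n L≤n)
          (p n (ℕ.m⊔n≤o⇒m≤o M N M⊔N≤n)) (q n (ℕ.m⊔n≤o⇒n≤o M N M⊔N≤n))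

record ℂ : Set where
  constructor _+i_
  field
    re im : ℝ

open ℂ public

infix 4 _≈ℂ_ _,ᶜ_

record _≈ℂ_ (z w : ℂ) : Set where
  constructor _,ᶜ_
  field
    re≈ : re z ≈ℝ re w
    im≈ : im z ≈ℝ im w

open _≈ℂ_ public

ℂ-commutativeRing : CommutativeRing 0ℓ 0ℓ
ℂ-commutativeRing = record
  { Carrier = ℂ
  ; _≈_ = _≈ℂ_
  ; _+_ = λ z w → (re z +ℝ re w) +i (im z +ℝ im w)
  ; _*_ = λ z w → (re z *ℝ re w +ℝ -ℝ (im z *ℝ im w)) +i (re z *ℝ im w +ℝ im z *ℝ re w)
  ; -_ = λ z → (-ℝ re z) +i (-ℝ im z)
  ; 0# = 0ℝ +i 0ℝ
  ; 1# = 1ℝ +i 0ℝ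
  ; isCommutativeRing = record
    { isRing = record
      { +-isAbelianGroup = record
        { isGroup = record
          { isMonoid = record
            { isSemigroup = record
              { isMagma = record
                { isEquivalence = record
                  { refl = ≈ℝ-refl ,ᶜ ≈ℝ-refl
                  ; sym = λ (p ,ᶜ q) → ≈ℝ-sym p ,ᶜ ≈ℝ-sym q
                  ; trans = λ (p ,ᶜ q) (r ,ᶜ s) → ≈ℝ-trans p r ,ᶜ ≈ℝ-trans q s
                  }
                ; ∙-cong = λ (p ,ᶜ q) (r ,ᶜ s) → +ℝ-cong p r ,ᶜ +ℝ-cong q s
                }
              ; assoc = λ x y z → pointwise⇒≈ℝ (λ n → ℚ.+-assoc (seq (re x) n) _ _)
                                ,ᶜ pointwise⇒≈ℝ (λ n → ℚ.+-assoc (seq (im x) n) _ _)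
              }
            ; identity = (λ x → pointwise⇒≈ℝ (λ n → ℚ.+-identityˡ _)
                              ,ᶜ pointwise⇒≈ℝ (λ n → ℚ.+-identityˡ _))
                       , (λ x → pointwise⇒≈ℝ (λ n → ℚ.+-identityʳ _)
                              ,ᶜ pointwise⇒≈ℝ (λ n → ℚ.+-identityʳ _))
            }
          ; inverse = (λ x → pointwise⇒≈ℝ (λ n → ℚ.+-inverseˡ (seq (re x) n))
                           ,ᶜ pointwise⇒≈ℝ (λ n → ℚ.+-inverseˡ (seq (im x) n)))
                    , (λ x → pointwise⇒≈ℝ (λ n → ℚ.+-inverseʳ (seq (re x) n))
                           ,ᶜ pointwise⇒≈ℝ (λ n → ℚ.+-inverseʳ (seq (im x) n)))
          ; ⁻¹-cong = λ (p ,ᶜ q) → -ℝ-cong p ,ᶜ -ℝ-cong q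
          }
        ; comm = λ x y → pointwise⇒≈ℝ (λ n → ℚ.+-comm (seq (re x) n) _)
                       ,ᶜ pointwise⇒≈ℝ (λ n → ℚ.+-comm (seq (im x) n) _)
        }
      ; *-cong = λ (p ,ᶜ q) (r ,ᶜ s) →
          +ℝ-cong (*ℝ-cong p r) (-ℝ-cong (*ℝ-cong q s))
        ,ᶜ +ℝ-cong (*ℝ-cong p s) (*ℝ-cong q r)
      ; *-assoc = λ x y z →
          pointwise⇒≈ℝ (λ n → solve 6 (λ a b c d e f →
              (a :* c :+ :- (b :* d)) :* e :+ :- ((a :* d :+ b :* c) :* f)
              := a :* (c :* e :+ :- (d :* f)) :+ :- (b :* (c :* f :+ d :* e)))
            refl (seq (re x) n) (seq (im x) n) (seq (re y) n)
                 (seq (im y) n) (seq (re z) n) (seq (im z) n))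
        ,ᶜ pointwise⇒≈ℝ (λ n → solve 6 (λ a b c d e f →
              (a :* c :+ :- (b :* d)) :* f :+ (a :* d :+ b :* c) :* e
              := a :* (c :* f :+ d :* e) :+ b :* (c :* e :+ :- (d :* f)))
            refl (seq (re x) n) (seq (im x) n) (seq (re y) n)
                 (seq (im y) n) (seq (re z) n) (seq (im z) n))
      ; *-identity =
          (λ x → pointwise⇒≈ℝ (λ n → solve 2 (λ a b →
                   con 1ℚ :* a :+ :- (con 0ℚ :* b) := a)
                   refl (seq (re x) n) (seq (im x) n))
               ,ᶜ pointwise⇒≈ℝ (λ n → solve 2 (λ a b →
                   con 1ℚ :* b :+ con 0ℚ :* a := b)
                   refl (seq (re x) n) (seq (im x) n)))
        , (λ x → pointwise⇒≈ℝ (λ n → solve 2 (λ a b →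
                   a :* con 1ℚ :+ :- (b :* con 0ℚ) := a)
                   refl (seq (re x) n) (seq (im x) n))
               ,ᶜ pointwise⇒≈ℝ (λ n → solve 2 (λ a b →
                   a :* con 0ℚ :+ b :* con 1ℚ := b)
                   refl (seq (re x) n) (seq (im x) n)))
      ; distrib =
          (λ x y z →
              pointwise⇒≈ℝ (λ n → solve 6 (λ a b c d e f →
                  a :* (c :+ e) :+ :- (b :* (d :+ f))
                  := (a :* c :+ :- (b :* d)) :+ (a :* e :+ :- (b :* f)))
                refl (seq (re x) n) (seq (im x) n) (seq (re y) n)
                     (seq (im y) n) (seq (re z) n) (seq (im z) n))
            ,ᶜ pointwise⇒≈ℝ (λ n → solve 6 (λ a b c d e f →
                  a :* (d :+ f) :+ b :* (c :+ e)
                  := (a :* d :+ b :* c) :+ (a :* f :+ b :* e))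
                refl (seq (re x) n) (seq (im x) n) (seq (re y) n)
                     (seq (im y) n) (seq (re z) n) (seq (im z) n)))
        , (λ x y z →
              pointwise⇒≈ℝ (λ n → solve 6 (λ a b c d e f →
                  (c :+ e) :* a :+ :- ((d :+ f) :* b)
                  := (c :* a :+ :- (d :* b)) :+ (e :* a :+ :- (f :* b)))
                refl (seq (re x) n) (seq (im x) n) (seq (re y) n)
                     (seq (im y) n) (seq (re z) n) (seq (im z) n))
            ,ᶜ pointwise⇒≈ℝ (λ n → solve 6 (λ a b c d e f →
                  (c :+ e) :* b :+ (d :+ f) :* a
                  := (c :* b :+ d :* a) :+ (e :* b :+ f :* a))
                refl (seq (re x) n) (seq (im x) n) (seq (re y) n)
                     (seq (im y) n) (seq (re z) n) (seq (im z) n)))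
      }
    ; *-comm = λ x y →
          pointwise⇒≈ℝ (λ n → solve 4 (λ a b c d →
              a :* c :+ :- (b :* d) := c :* a :+ :- (d :* b))
            refl (seq (re x) n) (seq (im x) n) (seq (re y) n) (seq (im y) n))
        ,ᶜ pointwise⇒≈ℝ (λ n → solve 4 (λ a b c d →
              a :* d :+ b :* c := c :* b :+ d :* a)
            refl (seq (re x) n) (seq (im x) n) (seq (re y) n) (seq (im y) n))
    }
  }
  where open +-*-Solver

module ℂ-Ring = CommutativeRing ℂ-commutativeRing

fromℤℂ : ℤ → ℂ
fromℤℂ k = fromℚ (fromℤ k) +i 0ℝ

private
  fromℤ-homo-+ : ∀ a b → fromℤ (a ℤ.+ b) ≡ fromℤ a ℚ.+ fromℤ b
  fromℤ-homo-+ a b = ℚ.toℚᵘ-injective (ℚᵘ.≃-trans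
    (ℚᵘ.*≡* (solve 2 (λ a b → (a :+ b) :* con 1ℤ := (a :* con 1ℤ :+ b :* con 1ℤ) :* con 1ℤ) refl a b))
    (ℚᵘ.≃-sym (ℚ.toℚᵘ-homo-+ (fromℤ a) (fromℤ b))))
    where open ℤSolver.+-*-Solver

  fromℤ-homo-* : ∀ a b → fromℤ (a ℤ.* b) ≡ fromℤ a ℚ.* fromℤ b
  fromℤ-homo-* a b = ℚ.toℚᵘ-injective (ℚᵘ.≃-trans
    (ℚᵘ.*≡* refl)
    (ℚᵘ.≃-sym (ℚ.toℚᵘ-homo-* (fromℤ a) (fromℤ b))))

  fromℤℂ-homo-+ : ∀ a b → fromℤℂ (a ℤ.+ b) ≈ℂ fromℤℂ a ℂ-Ring.+ fromℤℂ b
  fromℤℂ-homo-+ a b = pointwise⇒≈ℝ (λ _ → fromℤ-homo-+ a b)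
                    ,ᶜ pointwise⇒≈ℝ (λ _ → refl)

  fromℤℂ-homo-* : ∀ a b → fromℤℂ (a ℤ.* b) ≈ℂ fromℤℂ a ℂ-Ring.* fromℤℂ b
  fromℤℂ-homo-* a b =
      pointwise⇒≈ℝ (λ _ → trans (fromℤ-homo-* a b)
        (solve 2 (λ p q → p :* q := p :* q :+ :- (con 0ℚ :* con 0ℚ))
          refl (fromℤ a) (fromℤ b)))
    ,ᶜ pointwise⇒≈ℝ (λ _ → solve 2 (λ p q → con 0ℚ := p :* con 0ℚ :+ con 0ℚ :* q)
        refl (fromℤ a) (fromℤ b))
    where open +-*-Solver

-- The matrix with rows (a , b) and (c , d).
record SL₂ℤ : Set where
  field
    a b c d : ℤ
    det≡1   : a ℤ.* d ℤ.- b ℤ.* c ≡ 1ℤ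

infix 4 _≈G_

record _≈G_ (g h : SL₂ℤ) : Set where
  private
    module g = SL₂ℤ g
    module h = SL₂ℤ h
  field
    a≡ : g.a ≡ h.a
    b≡ : g.b ≡ h.b
    c≡ : g.c ≡ h.c
    d≡ : g.d ≡ h.d

SL₂ℤ-group : Group 0ℓ 0ℓ
SL₂ℤ-group = record
  { Carrier = SL₂ℤ
  ; _≈_ = _≈G_
  ; _∙_ = mul
  ; ε = record { a = 1ℤ ; b = 0ℤ ; c = 0ℤ ; d = 1ℤ ; det≡1 = refl }
  ; _⁻¹ = inv
  ; isGroup = record
    { isMonoid = record
      { isSemigroup = record
        { isMagma = record
          { isEquivalence = record
            { refl = record { a≡ = refl ; b≡ = refl ; c≡ = refl ; d≡ = refl }
            ; sym = λ p → record { a≡ = sym (a≡ p) ; b≡ = sym (b≡ p)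
                                 ; c≡ = sym (c≡ p) ; d≡ = sym (d≡ p) }
            ; trans = λ p q → record { a≡ = trans (a≡ p) (a≡ q) ; b≡ = trans (b≡ p) (b≡ q)
                                     ; c≡ = trans (c≡ p) (c≡ q) ; d≡ = trans (d≡ p) (d≡ q) }
            }
          ; ∙-cong = λ p q → record
            { a≡ = cong₂ ℤ._+_ (cong₂ ℤ._*_ (a≡ p) (a≡ q)) (cong₂ ℤ._*_ (b≡ p) (c≡ q))
            ; b≡ = cong₂ ℤ._+_ (cong₂ ℤ._*_ (a≡ p) (b≡ q)) (cong₂ ℤ._*_ (b≡ p) (d≡ q))
            ; c≡ = cong₂ ℤ._+_ (cong₂ ℤ._*_ (c≡ p) (a≡ q)) (cong₂ ℤ._*_ (d≡ p) (c≡ q))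
            ; d≡ = cong₂ ℤ._+_ (cong₂ ℤ._*_ (c≡ p) (b≡ q)) (cong₂ ℤ._*_ (d≡ p) (d≡ q))
            }
          }
        ; assoc = λ g h k → record
          { a≡ = entry (a g) (b g) (a h) (b h) (c h) (d h) (a k) (c k)
          ; b≡ = entry (a g) (b g) (a h) (b h) (c h) (d h) (b k) (d k)
          ; c≡ = entry (c g) (d g) (a h) (b h) (c h) (d h) (a k) (c k)
          ; d≡ = entry (c g) (d g) (a h) (b h) (c h) (d h) (b k) (d k)
          }
        }
      ; identity =
          (λ g → record { a≡ = top (a g) (c g) ; b≡ = top (b g) (d g)
                        ; c≡ = bottom (a g) (c g) ; d≡ = bottom (b g) (d g) })
        , (λ g → record { a≡ = left (a g) (b g) ; b≡ = right (a g) (b g)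
                        ; c≡ = left (c g) (d g) ; d≡ = right (c g) (d g) })
      }
    ; inverse =
        (λ g → record
          { a≡ = trans (solve 4 (λ a b c d → d :* a :+ :- b :* c := a :* d :- b :* c)
                          refl (a g) (b g) (c g) (d g)) (det≡1 g)
          ; b≡ = solve 2 (λ b d → d :* b :+ :- b :* d := con 0ℤ) refl (b g) (d g)
          ; c≡ = solve 2 (λ a c → :- c :* a :+ a :* c := con 0ℤ) refl (a g) (c g)
          ; d≡ = trans (solve 4 (λ a b c d → :- c :* b :+ a :* d := a :* d :- b :* c)
                          refl (a g) (b g) (c g) (d g)) (det≡1 g)
          })
      , (λ g → record
          { a≡ = trans (solve 4 (λ a b c d → a :* d :+ b :* :- c := a :* d :- b :* c)
                          refl (a g) (b g) (c g) (d g)) (det≡1 g)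
          ; b≡ = solve 2 (λ a b → a :* :- b :+ b :* a := con 0ℤ) refl (a g) (b g)
          ; c≡ = solve 2 (λ c d → c :* d :+ d :* :- c := con 0ℤ) refl (c g) (d g)
          ; d≡ = trans (solve 4 (λ a b c d → c :* :- b :+ d :* a := a :* d :- b :* c)
                          refl (a g) (b g) (c g) (d g)) (det≡1 g)
          })
    ; ⁻¹-cong = λ p → record { a≡ = d≡ p ; b≡ = cong ℤ.-_ (b≡ p)
                             ; c≡ = cong ℤ.-_ (c≡ p) ; d≡ = a≡ p }
    }
  }
  where
  open ℤSolver.+-*-Solver
  open SL₂ℤ
  open _≈G_

  mul : SL₂ℤ → SL₂ℤ → SL₂ℤ
  mul g h = record
    { a = a g ℤ.* a h ℤ.+ b g ℤ.* c h ; b = a g ℤ.* b h ℤ.+ b g ℤ.* d h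
    ; c = c g ℤ.* a h ℤ.+ d g ℤ.* c h ; d = c g ℤ.* b h ℤ.+ d g ℤ.* d h
    ; det≡1 = trans
        (solve 8 (λ a b c d a′ b′ c′ d′ →
            (a :* a′ :+ b :* c′) :* (c :* b′ :+ d :* d′)
              :- (a :* b′ :+ b :* d′) :* (c :* a′ :+ d :* c′)
            := (a :* d :- b :* c) :* (a′ :* d′ :- b′ :* c′))
          refl (a g) (b g) (c g) (d g) (a h) (b h) (c h) (d h))
        (cong₂ ℤ._*_ (det≡1 g) (det≡1 h))
    }

  inv : SL₂ℤ → SL₂ℤ
  inv g = record
    { a = d g ; b = ℤ.- b g ; c = ℤ.- c g ; d = a g
    ; det≡1 = trans
        (solve 4 (λ a b c d → d :* a :- :- b :* :- c := a :* d :- b :* c)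
          refl (a g) (b g) (c g) (d g))
        (det≡1 g)
    }

  entry : ∀ x y a b c d u v →
    (x ℤ.* a ℤ.+ y ℤ.* c) ℤ.* u ℤ.+ (x ℤ.* b ℤ.+ y ℤ.* d) ℤ.* v
    ≡ x ℤ.* (a ℤ.* u ℤ.+ b ℤ.* v) ℤ.+ y ℤ.* (c ℤ.* u ℤ.+ d ℤ.* v)
  entry = solve 8 (λ x y a b c d u v →
    (x :* a :+ y :* c) :* u :+ (x :* b :+ y :* d) :* v
    := x :* (a :* u :+ b :* v) :+ y :* (c :* u :+ d :* v)) refl

  top : ∀ x y → 1ℤ ℤ.* x ℤ.+ 0ℤ ℤ.* y ≡ x
  top = solve 2 (λ x y → con 1ℤ :* x :+ con 0ℤ :* y := x) refl

  bottom : ∀ x y → 0ℤ ℤ.* x ℤ.+ 1ℤ ℤ.* y ≡ y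
  bottom = solve 2 (λ x y → con 0ℤ :* x :+ con 1ℤ :* y := y) refl

  left : ∀ x y → x ℤ.* 1ℤ ℤ.+ y ℤ.* 0ℤ ≡ x
  left = solve 2 (λ x y → x :* con 1ℤ :+ y :* con 0ℤ := x) refl

  right : ∀ x y → x ℤ.* 0ℤ ℤ.+ y ℤ.* 1ℤ ≡ y
  right = solve 2 (λ x y → x :* con 0ℤ :+ y :* con 1ℤ := y) refl

module G = Group SL₂ℤ-group

T : SL₂ℤ
T = record { a = 1ℤ ; b = 1ℤ ; c = 0ℤ ; d = 1ℤ ; det≡1 = refl }

-- A module over the group ring ℂG, given as a complex vector space with a
-- linear action of G = SL(2,ℤ).

record ℂGModule : Set₁ where
  field
    space : LeftModule ℂ-Ring.ring 0ℓ 0ℓ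

  open LeftModule space public

  infixr 7 _·_

  field
    _·_      : SL₂ℤ → Carrierᴹ → Carrierᴹ
    ·-cong   : ∀ {g h x y} → g ≈G h → x ≈ᴹ y → g · x ≈ᴹ h · y
    ·-homo-+ : ∀ g x y → g · (x +ᴹ y) ≈ᴹ g · x +ᴹ g · y
    ·-homo-* : ∀ g k x → g · (k *ₗ x) ≈ᴹ k *ₗ (g · x)
    ε-·      : ∀ x → G.ε · x ≈ᴹ x
    ∙-·      : ∀ g h x → (g G.∙ h) · x ≈ᴹ g · (h · x)

  infixl 6 _-ᴹ_

  _-ᴹ_ : Carrierᴹ → Carrierᴹ → Carrierᴹ
  x -ᴹ y = x +ᴹ (-ᴹ y)

infix 4 _≅_

record _≅_ (M N : ℂGModule) : Set where
  private
    module M = ℂGModule M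
    module N = ℂGModule N
  open LeftModuleMorphisms M.rawLeftModule N.rawLeftModule
  field
    to                     : M.Carrierᴹ → N.Carrierᴹ
    isLeftModuleIsomorphism : IsLeftModuleIsomorphism to
    ·-homo                 : ∀ g x → to (g M.· x) N.≈ᴹ g N.· to x

-- Elements are column vectors.
V : ℂGModule
V = record
  { space = DirectProduct.leftModule TensorUnit.leftModule TensorUnit.leftModule
  ; _·_ = λ g (x , y) → row (a g) (b g) x y , row (c g) (d g) x y
  ; ·-cong = λ p (q , r) → row-cong (a≡ p) (b≡ p) q r , row-cong (c≡ p) (d≡ p) q r
  ; ·-homo-+ = λ g (x , y) (x′ , y′) →
      row-+ (a g) (b g) x y x′ y′ , row-+ (c g) (d g) x y x′ y′
  ; ·-homo-* = λ g k (x , y) → row-* (a g) (b g) k x y , row-* (c g) (d g) k x y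
  ; ε-· = λ (x , y) →
      ℂ-Ring.trans (+-cong (*-identityˡ x) (zeroˡ y)) (+-identityʳ x)
    , ℂ-Ring.trans (+-cong (zeroˡ x) (*-identityˡ y)) (+-identityˡ y)
  ; ∙-· = λ g h (x , y) →
      row-∙ (a g) (b g) (a h) (b h) (c h) (d h) x y
    , row-∙ (c g) (d g) (a h) (b h) (c h) (d h) x y
  }
  where
  open ℂ-Ring using (_≈_; _+_; _*_; +-cong; *-cong; zeroˡ;
    *-identityˡ; +-identityˡ; +-identityʳ)
  open SL₂ℤ
  open _≈G_
  open NaturalSolver ℂ-Ring.commutativeSemiring

  row : ℤ → ℤ → ℂ → ℂ → ℂ
  row a b x y = fromℤℂ a * x + fromℤℂ b * y

  row-cong : ∀ {a b a′ b′ x y x′ y′} → a ≡ a′ → b ≡ b′ → x ≈ x′ → y ≈ y′ →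
             row a b x y ≈ row a′ b′ x′ y′
  row-cong {a} {b} refl refl p q =
    +-cong (*-cong (ℂ-Ring.refl {fromℤℂ a}) p) (*-cong (ℂ-Ring.refl {fromℤℂ b}) q)

  row-+ : ∀ a b x y x′ y′ → row a b (x + x′) (y + y′) ≈ row a b x y + row a b x′ y′
  row-+ a b = solve 6 (λ a b x y x′ y′ →
    a :* (x :+ x′) :+ b :* (y :+ y′) := (a :* x :+ b :* y) :+ (a :* x′ :+ b :* y′))
    ℂ-Ring.refl (fromℤℂ a) (fromℤℂ b)

  row-* : ∀ a b k x y → row a b (k * x) (k * y) ≈ k * row a b x y
  row-* a b = solve 5 (λ a b k x y →
    a :* (k :* x) :+ b :* (k :* y) := k :* (a :* x :+ b :* y))
    ℂ-Ring.refl (fromℤℂ a) (fromℤℂ b)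

  homo : ∀ p q r s →
         fromℤℂ (p ℤ.* q ℤ.+ r ℤ.* s) ≈ fromℤℂ p * fromℤℂ q + fromℤℂ r * fromℤℂ s
  homo p q r s = ℂ-Ring.trans (fromℤℂ-homo-+ (p ℤ.* q) (r ℤ.* s))
                       (+-cong (fromℤℂ-homo-* p q) (fromℤℂ-homo-* r s))

  row-∙ : ∀ p q a b c d x y →
          row (p ℤ.* a ℤ.+ q ℤ.* c) (p ℤ.* b ℤ.+ q ℤ.* d) x y
          ≈ row p q (row a b x y) (row c d x y)
  row-∙ p q a b c d x y = ℂ-Ring.trans
    (+-cong (*-cong (homo p a q c) ℂ-Ring.refl) (*-cong (homo p b q d) ℂ-Ring.refl))
    (solve 8 (λ p q a b c d x y →
        (p :* a :+ q :* c) :* x :+ (p :* b :+ q :* d) :* y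
        := p :* (a :* x :+ b :* y) :+ q :* (c :* x :+ d :* y))
      ℂ-Ring.refl (fromℤℂ p) (fromℤℂ q) (fromℤℂ a) (fromℤℂ b) (fromℤℂ c) (fromℤℂ d) x y)

record Subspace (M : ℂGModule) : Set₁ where
  open ℂGModule M
  field
    member   : Pred Carrierᴹ 0ℓ
    ≈-closed : ∀ {x y} → x ≈ᴹ y → x ∈ member → y ∈ member
    0-closed : 0ᴹ ∈ member
    +-closed : ∀ {x y} → x ∈ member → y ∈ member → (x +ᴹ y) ∈ member
    *-closed : ∀ k {x} → x ∈ member → (k *ₗ x) ∈ member

open Subspace public using (member)

record Submodule (M : ℂGModule) : Set₁ where
  open ℂGModule M
  field
    subspace : Subspace M
    ·-closed : ∀ g {x} → x ∈ member subspace → (g · x) ∈ member subspace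

open Submodule public using (subspace)

infix 4 _∈ₛ_

_∈ₛ_ : ∀ {M} → ℂGModule.Carrierᴹ M → Submodule M → Set
x ∈ₛ P = x ∈ member (subspace P)

private
  module Negation (M : ℂGModule) where
    open ℂGModule M
    open AbelianGroupProperties +ᴹ-abelianGroup
    open SetoidReasoning ≈ᴹ-setoid

    -1*x≈-x : ∀ x → (ℂ-Ring.- ℂ-Ring.1#) *ₗ x ≈ᴹ -ᴹ x
    -1*x≈-x x = inverseʳ-unique x _ (begin
      x +ᴹ (ℂ-Ring.- ℂ-Ring.1#) *ₗ x                  ≈⟨ +ᴹ-congʳ (*ₗ-identityˡ x) ⟨
      ℂ-Ring.1# *ₗ x +ᴹ (ℂ-Ring.- ℂ-Ring.1#) *ₗ x     ≈⟨ *ₗ-distribʳ x _ _ ⟨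
      (ℂ-Ring.1# ℂ-Ring.+ ℂ-Ring.- ℂ-Ring.1#) *ₗ x    ≈⟨ *ₗ-congʳ (ℂ-Ring.-‿inverseʳ _) ⟩
      ℂ-Ring.0# *ₗ x                                  ≈⟨ *ₗ-zeroˡ x ⟩
      0ᴹ                                              ∎)

    k*-x≈-k*x : ∀ k x → k *ₗ (-ᴹ x) ≈ᴹ -ᴹ (k *ₗ x)
    k*-x≈-k*x k x = inverseʳ-unique (k *ₗ x) _ (begin
      k *ₗ x +ᴹ k *ₗ (-ᴹ x)  ≈⟨ *ₗ-distribˡ k x (-ᴹ x) ⟨
      k *ₗ (x -ᴹ x)          ≈⟨ *ₗ-congˡ (-ᴹ‿inverseʳ x) ⟩
      k *ₗ 0ᴹ                ≈⟨ *ₗ-zeroʳ k ⟩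
      0ᴹ                     ∎)

    ·-homo-neg : ∀ g x → g · (-ᴹ x) ≈ᴹ -ᴹ (g · x)
    ·-homo-neg g x = begin
      g · (-ᴹ x)                            ≈⟨ ·-cong G.refl (-1*x≈-x x) ⟨
      g · ((ℂ-Ring.- ℂ-Ring.1#) *ₗ x)       ≈⟨ ·-homo-* g _ x ⟩
      (ℂ-Ring.- ℂ-Ring.1#) *ₗ (g · x)       ≈⟨ -1*x≈-x (g · x) ⟩
      -ᴹ (g · x)                            ∎

    neg-closed : (W : Subspace M) → ∀ {x} → x ∈ member W → (-ᴹ x) ∈ member W
    neg-closed W {x} x∈W = Subspace.≈-closed W (-1*x≈-x x) (Subspace.*-closed W _ x∈W)

toModule : ∀ {M} → Submodule M → ℂGModule
toModule {M} P = record
  { space = record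
    { Carrierᴹ = ∃ (_∈ₛ P)
    ; _≈ᴹ_ = λ x y → proj₁ x ≈ᴹ proj₁ y
    ; _+ᴹ_ = λ (x , x∈P) (y , y∈P) → x +ᴹ y , +-closed x∈P y∈P
    ; _*ₗ_ = λ k (x , x∈P) → k *ₗ x , *-closed k x∈P
    ; 0ᴹ = 0ᴹ , 0-closed
    ; -ᴹ_ = λ (x , x∈P) → -ᴹ x , neg-closed (subspace P) x∈P
    ; isLeftModule = record
      { isLeftSemimodule = record
        { +ᴹ-isCommutativeMonoid = record
          { isMonoid = record
            { isSemigroup = record
              { isMagma = record
                { isEquivalence = record { refl = ≈ᴹ-refl ; sym = ≈ᴹ-sym ; trans = ≈ᴹ-trans }
                ; ∙-cong = +ᴹ-cong
                }
              ; assoc = λ _ _ _ → +ᴹ-assoc _ _ _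
              }
            ; identity = (λ _ → +ᴹ-identityˡ _) , (λ _ → +ᴹ-identityʳ _)
            }
          ; comm = λ _ _ → +ᴹ-comm _ _
          }
        ; isPreleftSemimodule = record
          { *ₗ-cong = *ₗ-cong
          ; *ₗ-zeroˡ = λ _ → *ₗ-zeroˡ _
          ; *ₗ-distribʳ = λ _ _ _ → *ₗ-distribʳ _ _ _
          ; *ₗ-identityˡ = λ _ → *ₗ-identityˡ _
          ; *ₗ-assoc = λ _ _ _ → *ₗ-assoc _ _ _
          ; *ₗ-zeroʳ = λ _ → *ₗ-zeroʳ _
          ; *ₗ-distribˡ = λ _ _ _ → *ₗ-distribˡ _ _ _
          }
        }
      ; -ᴹ‿cong = -ᴹ‿cong
      ; -ᴹ‿inverse = (λ _ → -ᴹ‿inverseˡ _) , (λ _ → -ᴹ‿inverseʳ _)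
      }
    }
  ; _·_ = λ g (x , x∈P) → g · x , Submodule.·-closed P g x∈P
  ; ·-cong = ·-cong
  ; ·-homo-+ = λ g _ _ → ·-homo-+ g _ _
  ; ·-homo-* = λ g k _ → ·-homo-* g k _
  ; ε-· = λ _ → ε-· _
  ; ∙-· = λ g h _ → ∙-· g h _
  }
  where
  open ℂGModule M
  open Subspace (subspace P)
  open Negation M

-- M / P has the vectors of M as its elements, x and y being equal when
-- their difference lies in P.
infixl 6 _/_

_/_ : (M : ℂGModule) → Submodule M → ℂGModule
M / P = record
  { space = record
    { Carrierᴹ = Carrierᴹ
    ; _≈ᴹ_ = _∼_
    ; _+ᴹ_ = _+ᴹ_
    ; _*ₗ_ = _*ₗ_
    ; 0ᴹ = 0ᴹ
    ; -ᴹ_ = -ᴹ_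
    ; isLeftModule = record
      { isLeftSemimodule = record
        { +ᴹ-isCommutativeMonoid = record
          { isMonoid = record
            { isSemigroup = record
              { isMagma = record
                { isEquivalence = record
                  { refl = λ {x} → ≈⇒∼ (≈ᴹ-refl {x})
                  ; sym = λ {x} {y} → ∼-sym x y
                  ; trans = λ {x} {y} {z} → ∼-trans x y z
                  }
                ; ∙-cong = λ {x} {y} {u} {v} → ∼-+ x y u v
                }
              ; assoc = λ x y z → ≈⇒∼ (+ᴹ-assoc x y z)
              }
            ; identity = (λ x → ≈⇒∼ (+ᴹ-identityˡ x)) , (λ x → ≈⇒∼ (+ᴹ-identityʳ x))
            }
          ; comm = λ x y → ≈⇒∼ (+ᴹ-comm x y)
          }
        ; isPreleftSemimodule = record
          { *ₗ-cong = λ {k} {l} {x} {y} k≈l x∼y →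
              ∼-trans (k *ₗ x) (k *ₗ y) (l *ₗ y) (∼-* k x y x∼y) (≈⇒∼ (*ₗ-congʳ k≈l))
          ; *ₗ-zeroˡ = λ x → ≈⇒∼ (*ₗ-zeroˡ x)
          ; *ₗ-distribʳ = λ x k l → ≈⇒∼ (*ₗ-distribʳ x k l)
          ; *ₗ-identityˡ = λ x → ≈⇒∼ (*ₗ-identityˡ x)
          ; *ₗ-assoc = λ k l x → ≈⇒∼ (*ₗ-assoc k l x)
          ; *ₗ-zeroʳ = λ k → ≈⇒∼ (*ₗ-zeroʳ k)
          ; *ₗ-distribˡ = λ k x y → ≈⇒∼ (*ₗ-distribˡ k x y)
          }
        }
      ; -ᴹ‿cong = λ {x} {y} → ∼-neg x y
      ; -ᴹ‿inverse = (λ x → ≈⇒∼ (-ᴹ‿inverseˡ x)) , (λ x → ≈⇒∼ (-ᴹ‿inverseʳ x))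
      }
    }
  ; _·_ = _·_
  ; ·-cong = λ {g} {h} {x} {y} g≈h x∼y →
      ∼-trans (g · x) (g · y) (h · y) (∼-· g x y x∼y) (≈⇒∼ (·-cong g≈h ≈ᴹ-refl))
  ; ·-homo-+ = λ g x y → ≈⇒∼ (·-homo-+ g x y)
  ; ·-homo-* = λ g k x → ≈⇒∼ (·-homo-* g k x)
  ; ε-· = λ x → ≈⇒∼ (ε-· x)
  ; ∙-· = λ g h x → ≈⇒∼ (∙-· g h x)
  }
  where
  open ℂGModule M
  open Subspace (subspace P)
  open Negation M
  open AbelianGroupProperties +ᴹ-abelianGroup
  open CommutativeSemigroupProperties
    (CommutativeMonoid.commutativeSemigroup +ᴹ-commutativeMonoid) using (interchange)
  open SetoidReasoning ≈ᴹ-setoid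

  _∼_ : Carrierᴹ → Carrierᴹ → Set
  x ∼ y = (x -ᴹ y) ∈ₛ P

  ≈⇒∼ : ∀ {x y} → x ≈ᴹ y → x ∼ y
  ≈⇒∼ x≈y = ≈-closed (≈ᴹ-sym (x≈y⇒x∙y⁻¹≈ε x≈y)) 0-closed

  ∼-sym : ∀ x y → x ∼ y → y ∼ x
  ∼-sym x y x∼y = ≈-closed (⁻¹-anti-homo‿- x y) (neg-closed (subspace P) x∼y)

  ∼-trans : ∀ x y z → x ∼ y → y ∼ z → x ∼ z
  ∼-trans x y z x∼y y∼z = ≈-closed (begin
    (x -ᴹ y) +ᴹ (y -ᴹ z)      ≈⟨ +ᴹ-assoc x (-ᴹ y) (y -ᴹ z) ⟩
    x +ᴹ (-ᴹ y +ᴹ (y -ᴹ z))   ≈⟨ +ᴹ-congˡ (+ᴹ-assoc (-ᴹ y) y (-ᴹ z)) ⟨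
    x +ᴹ ((-ᴹ y +ᴹ y) -ᴹ z)   ≈⟨ +ᴹ-congˡ (+ᴹ-congʳ (-ᴹ‿inverseˡ y)) ⟩
    x +ᴹ (0ᴹ -ᴹ z)            ≈⟨ +ᴹ-congˡ (+ᴹ-identityˡ (-ᴹ z)) ⟩
    x -ᴹ z                    ∎) (+-closed x∼y y∼z)

  ∼-+ : ∀ x y u v → x ∼ y → u ∼ v → (x +ᴹ u) ∼ (y +ᴹ v)
  ∼-+ x y u v x∼y u∼v = ≈-closed (begin
    (x -ᴹ y) +ᴹ (u -ᴹ v)         ≈⟨ interchange x (-ᴹ y) u (-ᴹ v) ⟩
    (x +ᴹ u) +ᴹ (-ᴹ y +ᴹ -ᴹ v)   ≈⟨ +ᴹ-congˡ (⁻¹-∙-comm y v) ⟩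
    (x +ᴹ u) -ᴹ (y +ᴹ v)         ∎) (+-closed x∼y u∼v)

  ∼-neg : ∀ x y → x ∼ y → (-ᴹ x) ∼ (-ᴹ y)
  ∼-neg x y x∼y = ≈-closed (≈ᴹ-sym (⁻¹-∙-comm x (-ᴹ y))) (neg-closed (subspace P) x∼y)

  ∼-* : ∀ k x y → x ∼ y → (k *ₗ x) ∼ (k *ₗ y)
  ∼-* k x y x∼y = ≈-closed
    (≈ᴹ-trans (*ₗ-distribˡ k x (-ᴹ y)) (+ᴹ-congˡ (k*-x≈-k*x k y))) (*-closed k x∼y)

  ∼-· : ∀ g x y → x ∼ y → (g · x) ∼ (g · y)
  ∼-· g x y x∼y = ≈-closed
    (≈ᴹ-trans (·-homo-+ g x (-ᴹ y)) (+ᴹ-congˡ (·-homo-neg g y)))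
    (Submodule.·-closed P g x∼y)

-- P regarded as a submodule of Q, the intended case being P ⊆ Q.
_within_ : ∀ {M} → Submodule M → (Q : Submodule M) → Submodule (toModule Q)
P within Q = record
  { subspace = record
    { member = λ x → proj₁ x ∈ₛ P
    ; ≈-closed = Subspace.≈-closed (subspace P)
    ; 0-closed = Subspace.0-closed (subspace P)
    ; +-closed = Subspace.+-closed (subspace P)
    ; *-closed = λ k → Subspace.*-closed (subspace P) k
    }
  ; ·-closed = λ g → Submodule.·-closed P g
  }

record VFiltration (M : ℂGModule) : Set₁ where
  open ℂGModule M
  field
    layer      : ℕ → Submodule M
    zeroth     : ∀ x → x ∈ₛ layer 0 → x ≈ᴹ 0ᴹ
    ascending  : ∀ n → member (subspace (layer n)) ⊆ member (subspace (layer (suc n)))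
    exhaustive : ∀ x → ∃ λ n → x ∈ₛ layer n
    factor≅V   : ∀ n → (toModule (layer (suc n)) / (layer n within layer (suc n))) ≅ V

module _ (M : ℂGModule) where
  open ℂGModule M

  TInvariant : Subspace M → Set
  TInvariant W = ∀ {x} → x ∈ member W → (T · x) ∈ member W

  IsZero : Subspace M → Set
  IsZero W = ∀ x → x ∈ member W → x ≈ᴹ 0ᴹ

  record IsDirectSum (W A B : Subspace M) : Set where
    field
      A⊆W   : member A ⊆ member W
      B⊆W   : member B ⊆ member W
      A+B   : ∀ {w} → w ∈ member W →
              ∃ λ a → ∃ λ b → a ∈ member A × b ∈ member B × w ≈ᴹ a +ᴹ b
      A∩B≈0 : ∀ x → x ∈ member A → x ∈ member B → x ≈ᴹ 0ᴹ

  -- The zero subspace satisfies this, so that quantifying over all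
  -- T-invariant subspaces is the same as quantifying over the nonzero ones.
  ActsIndecomposably : Subspace M → Set₁
  ActsIndecomposably W = ∀ A B → TInvariant A → TInvariant B →
                         IsDirectSum W A B → IsZero A ⊎ IsZero B

  -- On an infinite-dimensional space unipotence means that T - 1 is
  -- locally nilpotent; an infinite Jordan block is unipotent in this
  -- sense, although no power of T - 1 vanishes.
  ActsUnipotently : Subspace M → Set
  ActsUnipotently W = ∀ x → x ∈ member W →
                      ∃ λ n → fold x (λ y → T · y -ᴹ y) n ≈ᴹ 0ᴹ

  TIndecomposable : Set₁
  TIndecomposable = ∀ W → TInvariant W → ActsIndecomposably W × ActsUnipotently W

{-# OPTIONS --safe #-}
module Submission where

-- SL₂(ℤ) is the amalgam of ⟨S⟩ ≅ ℤ/4 and ⟨U⟩ ≅ ℤ/6, U = ST, over ⟨-1⟩. Hence operators with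
-- S² = -1 and U² = U - 1 define a module, and on a module filtered by copies of V these two
-- relations hold: they do so on V, and S and U have finite order in characteristic 0.
--
-- Put Y = U - S = S(T - 1), so that ker Y consists of the T-fixed vectors. The relations
-- give YS = S(1 - Y) - Y² + Y, so the action on x and Sx is determined by Y on x. On V,
-- Y is the projection diag(0, 1). By induction on n, M_n = C ⊕ SC where C = ℂ[Y]x_n is the
-- generalised 0-eigenspace of Y and Y x_n = x_{n-1}. For the step, lift (1, 0) to v in
-- M_{n+1} and correct it by elements of SC and C until Yv = k x_n. Were k = 0, there would
-- be two independent T-fixed vectors, whose span is T-decomposable; so x_{n+1} = k⁻¹v.
-- The vectors x_n and S x_n form a basis on which S and U act by fixed formulas.
--
-- These formulas define M∞ on the finitely supported sequences in ℂ². There T - 1 is locally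
-- nilpotent with one-dimensional kernel, so all nonzero T-invariant subspaces share a vector.

open import Defs
open import Level using (0ℓ)
open import Data.Product.Base using (_×_; ∃)
open import Axiom.ExcludedMiddle using (ExcludedMiddle)
open import Algebra.Bundles using (CommutativeMonoid)
open import Algebra.Module.Bundles using (LeftModule)
import Algebra.Module.Construct.TensorUnit as TensorUnit
open import Algebra.Module.Morphism.Structures using (module LeftModuleMorphisms)
import Algebra.Properties.AbelianGroup as AbelianGroupProperties
import Algebra.Properties.CommutativeSemigroup as CommutativeSemigroupProperties
import Algebra.Solver.Ring as RingSolver
open import Algebra.Solver.Ring.AlmostCommutativeRing
  using (fromCommutativeRing; _-Raw-AlmostCommutative⟶_; Induced-equivalence)
open import Data.Bool.Base using (Bool; true; false; not)
open import Data.Fin.Base using (Fin; zero; suc)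
open import Data.Fin.Patterns using (0F; 1F; 2F)
open import Data.Integer.Base as ℤ using (ℤ; 0ℤ; 1ℤ; +_; -[1+_])
import Data.Integer.Properties as ℤ
import Data.Integer.Solver as ℤSolver
open import Data.List.Base using (List; []; _∷_; _++_)
open import Data.Maybe.Base using (map)
open import Data.Nat.Base as ℕ using (ℕ; zero; suc)
open import Data.Nat.GeneralisedArithmetic using (fold)
import Data.Nat.Properties as ℕ
open import Data.Product.Base using (_,_; proj₁; proj₂)
open import Data.Rational.Base as ℚ using (ℚ; 0ℚ; 1ℚ; ½; ∣_∣)
open import Data.Rational.Literals using (fromℤ)
import Data.Rational.Properties as ℚ
open import Data.Rational.Solver using (module +-*-Solver)
import Data.Rational.Unnormalised.Base as ℚᵘ
import Data.Rational.Unnormalised.Properties as ℚᵘ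
open import Data.Sum.Base using (_⊎_; inj₁; inj₂; [_,_])
open import Data.Vec.Base as Vec using (Vec; []; _∷_; lookup)
open import Data.Vec.N-ary using (N-ary; _$ⁿ_)
open import Function.Base using (_∘_)
open import Relation.Binary.Bundles using (Setoid)
open import Relation.Binary.Definitions using (WeaklyDecidable)
open import Relation.Binary.PropositionalEquality as ≡
  using (_≡_; refl; cong; cong₂; subst)
import Relation.Binary.Reasoning.Setoid as SetoidReasoning
open import Relation.Nullary using (¬_; Dec; yes; no; contradiction)
open import Relation.Nullary.Decidable using (dec⇒maybe; decidable-stable)
open import Relation.Unary using (_∈_)

-- Linear identities over ℂ

-- The amalgam turns existence into a finite check: two operators with one quadratic relation each
-- already give a module. This rests on both halves of the presentation. Generation is the Euclidean
-- algorithm; the absence of further relations comes from nonempty products of T and its transpose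
-- being nonnegative and never diagonal.
--
-- The obstacle in the inductive step is that Yv may have a component Sq with q in C. Modulo C, Y
-- sends Sr to S(1 - Y)r, and 1 - Y is invertible on C because Y is nilpotent there; subtracting S(1
-- - Y)⁻¹q from v therefore removes Sq. Since C = ℂx_n + YC, a further vector of C reduces what is
-- left to a multiple of x_n.
--
-- The formulas of the model are forced: if N denotes x_n ↦ x_{n-1}, the relation for YS gives Y the
-- block form (N, N - N² ; 0, 1 - N) on C ⊕ SC.
--
-- Real numbers are Cauchy sequences, so excluded middle is what decides whether a number or a
-- vector vanishes, and hence provides inverses in ℂ.

fromℤ-homo-+ : ∀ m n → fromℤ (m ℤ.+ n) ≡ fromℤ m ℚ.+ fromℤ n
fromℤ-homo-+ m n = ℚ.toℚᵘ-injective (ℚᵘ.≃-trans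
  (ℚᵘ.*≡* (cong (ℤ._* 1ℤ) (≡.sym (cong₂ ℤ._+_ (ℤ.*-identityʳ m) (ℤ.*-identityʳ n)))))
  (ℚᵘ.≃-sym (ℚ.toℚᵘ-homo-+ (fromℤ m) (fromℤ n))))

fromℤ-homo-* : ∀ m n → fromℤ (m ℤ.* n) ≡ fromℤ m ℚ.* fromℤ n
fromℤ-homo-* m n = ℚ.toℚᵘ-injective (ℚᵘ.≃-trans (ℚᵘ.*≡* refl)
  (ℚᵘ.≃-sym (ℚ.toℚᵘ-homo-* (fromℤ m) (fromℤ n))))

fromℤ-homo‿- : ∀ n → fromℤ (ℤ.- n) ≡ ℚ.- fromℤ n
fromℤ-homo‿- (+ zero)  = refl
fromℤ-homo‿- (+ suc _) = refl
fromℤ-homo‿- -[1+ _ ]  = refl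

-- Equality in ℂ cannot be decided, so the solver takes its coefficients in ℤ, where equal ones are
-- recognised.
ℤ⟶ℂ : ℤ.+-*-rawRing -Raw-AlmostCommutative⟶ fromCommutativeRing ℂ-commutativeRing
ℤ⟶ℂ = record
  { ⟦_⟧    = fromℤℂ
  ; +-homo = λ m n → pointwise⇒≈ℝ (λ _ → fromℤ-homo-+ m n) ,ᶜ pointwise⇒≈ℝ (λ _ → refl)
  ; *-homo = λ m n →
      pointwise⇒≈ℝ (λ _ → ≡.trans (fromℤ-homo-* m n)
        (solve 2 (λ p q → p :* q := p :* q :+ :- (con 0ℚ :* con 0ℚ)) refl (fromℤ m) (fromℤ n)))
      ,ᶜ pointwise⇒≈ℝ (λ _ →
        solve 2 (λ p q → con 0ℚ := p :* con 0ℚ :+ con 0ℚ :* q) refl (fromℤ m) (fromℤ n))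
  ; -‿homo = λ n → pointwise⇒≈ℝ (λ _ → fromℤ-homo‿- n) ,ᶜ pointwise⇒≈ℝ (λ _ → refl)
  ; 0-homo = ℂ-Ring.refl
  ; 1-homo = ℂ-Ring.refl
  }
  where open +-*-Solver

coefficients≟ : WeaklyDecidable (Induced-equivalence ℤ⟶ℂ)
coefficients≟ m n = map (λ { refl → ℂ-Ring.refl }) (dec⇒maybe (m ℤ.≟ n))

module ℂSolver =
  RingSolver ℤ.+-*-rawRing (fromCommutativeRing ℂ-commutativeRing) ℤ⟶ℂ coefficients≟

open ℂSolver using (Polynomial; Normal; Env; ⟦_⟧; ⟦_⟧N; normalise; correct; 0N; 1N; _+N_; _*N_; -N_)

infixl 6 _⊕_ _⊖_
infixr 7 _⊛_
infix  8 ⊝_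
infix  4 _⊜_

-- Formal combinations of m vectors with coefficients polynomial in n scalars; an identity
-- between two of them holds if the coefficients of each vector have equal normal forms.
data Linear (n m : ℕ) : Set where
  vec : Fin m → Linear n m
  𝟎   : Linear n m
  _⊕_ : Linear n m → Linear n m → Linear n m
  ⊝_  : Linear n m → Linear n m
  _⊛_ : Polynomial n → Linear n m → Linear n m

_⊖_ : ∀ {n m} → Linear n m → Linear n m → Linear n m
x ⊖ y = x ⊕ ⊝ y

_⊜_ : ∀ {n m} → Linear n m → Linear n m → Linear n m × Linear n m
_⊜_ = _,_

unit : ∀ {n m} → Fin m → Vec (Normal n) m
unit zero    = 1N ∷ Vec.replicate _ 0N
unit (suc i) = 0N ∷ unit i

coefficients : ∀ {n m} → Linear n m → Vec (Normal n) m
coefficients (vec i) = unit i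
coefficients 𝟎       = Vec.replicate _ 0N
coefficients (x ⊕ y) = Vec.zipWith _+N_ (coefficients x) (coefficients y)
coefficients (⊝ x)   = Vec.map -N_ (coefficients x)
coefficients (p ⊛ x) = Vec.map (normalise p *N_) (coefficients x)

module LinearSolver (X : LeftModule ℂ-Ring.ring 0ℓ 0ℓ) where
  open LeftModule X
  open AbelianGroupProperties +ᴹ-abelianGroup using (⁻¹-∙-comm; ε⁻¹≈ε; inverseʳ-unique)
  open CommutativeSemigroupProperties
    (CommutativeMonoid.commutativeSemigroup +ᴹ-commutativeMonoid) using (interchange)
  open SetoidReasoning ≈ᴹ-setoid

  ⟦_⟧ᴸ : ∀ {n m} → Linear n m → Env n → Vec Carrierᴹ m → Carrierᴹ
  ⟦ vec i ⟧ᴸ ρ ξ = lookup ξ i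
  ⟦ 𝟎     ⟧ᴸ ρ ξ = 0ᴹ
  ⟦ x ⊕ y ⟧ᴸ ρ ξ = ⟦ x ⟧ᴸ ρ ξ +ᴹ ⟦ y ⟧ᴸ ρ ξ
  ⟦ ⊝ x   ⟧ᴸ ρ ξ = -ᴹ ⟦ x ⟧ᴸ ρ ξ
  ⟦ p ⊛ x ⟧ᴸ ρ ξ = ⟦ p ⟧ ρ *ₗ ⟦ x ⟧ᴸ ρ ξ

  combination : ∀ {n m} → Vec (Normal n) m → Env n → Vec Carrierᴹ m → Carrierᴹ
  combination []       ρ []      = 0ᴹ
  combination (c ∷ cs) ρ (x ∷ ξ) = ⟦ c ⟧N ρ *ₗ x +ᴹ combination cs ρ ξ

  -k*x≈-[k*x] : ∀ k x → (ℂ-Ring.- k) *ₗ x ≈ᴹ -ᴹ (k *ₗ x)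
  -k*x≈-[k*x] k x = inverseʳ-unique (k *ₗ x) _ (begin
    k *ₗ x +ᴹ (ℂ-Ring.- k) *ₗ x    ≈⟨ *ₗ-distribʳ x k (ℂ-Ring.- k) ⟨
    (k ℂ-Ring.+ ℂ-Ring.- k) *ₗ x   ≈⟨ *ₗ-congʳ (ℂ-Ring.-‿inverseʳ k) ⟩
    ℂ-Ring.0# *ₗ x                 ≈⟨ *ₗ-zeroˡ x ⟩
    0ᴹ                             ∎)

  combination-0 : ∀ {n m} ρ (ξ : Vec Carrierᴹ m) →
                  combination (Vec.replicate m (0N {n})) ρ ξ ≈ᴹ 0ᴹ
  combination-0 ρ []      = ≈ᴹ-refl
  combination-0 ρ (x ∷ ξ) = begin
    ⟦ 0N ⟧N ρ *ₗ x +ᴹ combination (Vec.replicate _ 0N) ρ ξ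
      ≈⟨ +ᴹ-cong (*ₗ-congʳ (ℂSolver.0N-homo ρ)) (combination-0 ρ ξ) ⟩
    ℂ-Ring.0# *ₗ x +ᴹ 0ᴹ  ≈⟨ +ᴹ-identityʳ _ ⟩
    ℂ-Ring.0# *ₗ x        ≈⟨ *ₗ-zeroˡ x ⟩
    0ᴹ                    ∎

  combination-unit : ∀ {n m} (i : Fin m) (ρ : Env n) ξ → combination (unit i) ρ ξ ≈ᴹ lookup ξ i
  combination-unit zero ρ (x ∷ ξ) = begin
    ⟦ 1N ⟧N ρ *ₗ x +ᴹ combination (Vec.replicate _ 0N) ρ ξ
      ≈⟨ +ᴹ-cong (*ₗ-congʳ (ℂSolver.1N-homo ρ)) (combination-0 ρ ξ) ⟩
    ℂ-Ring.1# *ₗ x +ᴹ 0ᴹ  ≈⟨ +ᴹ-identityʳ _ ⟩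
    ℂ-Ring.1# *ₗ x        ≈⟨ *ₗ-identityˡ x ⟩
    x                     ∎
  combination-unit (suc i) ρ (x ∷ ξ) = begin
    ⟦ 0N ⟧N ρ *ₗ x +ᴹ combination (unit i) ρ ξ
      ≈⟨ +ᴹ-cong (*ₗ-congʳ (ℂSolver.0N-homo ρ)) (combination-unit i ρ ξ) ⟩
    ℂ-Ring.0# *ₗ x +ᴹ lookup ξ i  ≈⟨ +ᴹ-congʳ (*ₗ-zeroˡ x) ⟩
    0ᴹ +ᴹ lookup ξ i              ≈⟨ +ᴹ-identityˡ _ ⟩
    lookup ξ i                    ∎

  combination-+ : ∀ {n m} (c d : Vec (Normal n) m) ρ ξ →
    combination (Vec.zipWith _+N_ c d) ρ ξ ≈ᴹ combination c ρ ξ +ᴹ combination d ρ ξ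
  combination-+ []      []      ρ []      = ≈ᴹ-sym (+ᴹ-identityˡ 0ᴹ)
  combination-+ (c ∷ cs) (d ∷ ds) ρ (x ∷ ξ) = begin
    ⟦ c +N d ⟧N ρ *ₗ x +ᴹ combination (Vec.zipWith _+N_ cs ds) ρ ξ
      ≈⟨ +ᴹ-cong (*ₗ-congʳ (ℂSolver.+N-homo c d ρ)) (combination-+ cs ds ρ ξ) ⟩
    (⟦ c ⟧N ρ ℂ-Ring.+ ⟦ d ⟧N ρ) *ₗ x +ᴹ (combination cs ρ ξ +ᴹ combination ds ρ ξ)
      ≈⟨ +ᴹ-congʳ (*ₗ-distribʳ x _ _) ⟩
    (⟦ c ⟧N ρ *ₗ x +ᴹ ⟦ d ⟧N ρ *ₗ x) +ᴹ (combination cs ρ ξ +ᴹ combination ds ρ ξ)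
      ≈⟨ interchange _ _ _ _ ⟩
    combination (c ∷ cs) ρ (x ∷ ξ) +ᴹ combination (d ∷ ds) ρ (x ∷ ξ) ∎

  combination-neg : ∀ {n m} (c : Vec (Normal n) m) ρ ξ →
    combination (Vec.map -N_ c) ρ ξ ≈ᴹ -ᴹ combination c ρ ξ
  combination-neg []       ρ []      = ≈ᴹ-sym ε⁻¹≈ε
  combination-neg (c ∷ cs) ρ (x ∷ ξ) = begin
    ⟦ -N c ⟧N ρ *ₗ x +ᴹ combination (Vec.map -N_ cs) ρ ξ
      ≈⟨ +ᴹ-cong (*ₗ-congʳ (ℂSolver.-N‿-homo c ρ)) (combination-neg cs ρ ξ) ⟩
    (ℂ-Ring.- ⟦ c ⟧N ρ) *ₗ x +ᴹ -ᴹ combination cs ρ ξ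
      ≈⟨ +ᴹ-congʳ (-k*x≈-[k*x] _ x) ⟩
    -ᴹ (⟦ c ⟧N ρ *ₗ x) +ᴹ -ᴹ combination cs ρ ξ
      ≈⟨ ⁻¹-∙-comm _ _ ⟩
    -ᴹ combination (c ∷ cs) ρ (x ∷ ξ) ∎

  combination-* : ∀ {n m} (p : Polynomial n) (c : Vec (Normal n) m) ρ ξ →
    combination (Vec.map (normalise p *N_) c) ρ ξ ≈ᴹ ⟦ p ⟧ ρ *ₗ combination c ρ ξ
  combination-* p []       ρ []      = ≈ᴹ-sym (*ₗ-zeroʳ _)
  combination-* p (c ∷ cs) ρ (x ∷ ξ) = begin
    ⟦ normalise p *N c ⟧N ρ *ₗ x +ᴹ combination (Vec.map (normalise p *N_) cs) ρ ξ
      ≈⟨ +ᴹ-cong (*ₗ-congʳ (ℂ-Ring.trans (ℂSolver.*N-homo (normalise p) c ρ)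
                                       (ℂ-Ring.*-congʳ (correct p ρ))))
               (combination-* p cs ρ ξ) ⟩
    (⟦ p ⟧ ρ ℂ-Ring.* ⟦ c ⟧N ρ) *ₗ x +ᴹ ⟦ p ⟧ ρ *ₗ combination cs ρ ξ
      ≈⟨ +ᴹ-congʳ (*ₗ-assoc _ _ x) ⟩
    ⟦ p ⟧ ρ *ₗ (⟦ c ⟧N ρ *ₗ x) +ᴹ ⟦ p ⟧ ρ *ₗ combination cs ρ ξ
      ≈⟨ *ₗ-distribˡ _ _ _ ⟨
    ⟦ p ⟧ ρ *ₗ combination (c ∷ cs) ρ (x ∷ ξ) ∎

  coefficients-correct : ∀ {n m} (x : Linear n m) ρ ξ →
                         combination (coefficients x) ρ ξ ≈ᴹ ⟦ x ⟧ᴸ ρ ξ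
  coefficients-correct (vec i) ρ ξ = combination-unit i ρ ξ
  coefficients-correct 𝟎       ρ ξ = combination-0 ρ ξ
  coefficients-correct (x ⊕ y) ρ ξ = ≈ᴹ-trans
    (combination-+ (coefficients x) (coefficients y) ρ ξ)
    (+ᴹ-cong (coefficients-correct x ρ ξ) (coefficients-correct y ρ ξ))
  coefficients-correct (⊝ x)   ρ ξ = ≈ᴹ-trans
    (combination-neg (coefficients x) ρ ξ) (-ᴹ‿cong (coefficients-correct x ρ ξ))
  coefficients-correct (p ⊛ x) ρ ξ = ≈ᴹ-trans
    (combination-* p (coefficients x) ρ ξ) (*ₗ-congˡ (coefficients-correct x ρ ξ))

  private
    close : ∀ {n m} → N-ary n (Polynomial n) (N-ary m (Linear n m) (Linear n m × Linear n m)) →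
            Linear n m × Linear n m
    close {n} {m} f = (f $ⁿ Vec.map ℂSolver.var (Vec.allFin n)) $ⁿ Vec.map vec (Vec.allFin m)

  linear : ∀ {n m} (ρ : Env n) (ξ : Vec Carrierᴹ m) f →
           let (lhs , rhs) = close {n} {m} f in
           coefficients lhs ≡ coefficients rhs → ⟦ lhs ⟧ᴸ ρ ξ ≈ᴹ ⟦ rhs ⟧ᴸ ρ ξ
  linear ρ ξ f eq = begin
    ⟦ lhs ⟧ᴸ ρ ξ                          ≈⟨ coefficients-correct lhs ρ ξ ⟨
    combination (coefficients lhs) ρ ξ    ≡⟨ cong (λ c → combination c ρ ξ) eq ⟩
    combination (coefficients rhs) ρ ξ    ≈⟨ coefficients-correct rhs ρ ξ ⟩
    ⟦ rhs ⟧ᴸ ρ ξ                          ∎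
    where
    lhs = proj₁ (close f)
    rhs = proj₂ (close f)

-- Inverses in ℂ

-- The value 0 at 0 is a convention that makes termwise reciprocals total; only terms beyond a
-- positive lower bound matter.
recip : ℚ → ℚ
recip p with p ℚ.≟ 0ℚ
... | yes _   = 0ℚ
... | no p≢0 = (ℚ.1/ p) {{ℚ.≢-nonZero p≢0}}

*-recip : ∀ {p} → 0ℚ ℚ.< p → p ℚ.* recip p ≡ 1ℚ
*-recip {p} 0<p with p ℚ.≟ 0ℚ
... | yes p≡0 = contradiction (≡.sym p≡0) (ℚ.<⇒≢ 0<p)
... | no p≢0  = ℚ.*-inverseʳ p {{ℚ.≢-nonZero p≢0}}

private
  0<*0< : ∀ {p q} → 0ℚ ℚ.< p → 0ℚ ℚ.< q → 0ℚ ℚ.< p ℚ.* q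
  0<*0< {p} {q} 0<p 0<q =
    ℚ.positive⁻¹ (p ℚ.* q) {{ℚ.pos*pos⇒pos p {{ℚ.positive 0<p}} q {{ℚ.positive 0<q}}}}

  *-mono-≤ : ∀ {p q r s} → 0ℚ ℚ.< p → 0ℚ ℚ.< r → p ℚ.≤ q → r ℚ.≤ s → p ℚ.* r ℚ.≤ q ℚ.* s
  *-mono-≤ {p} {q} {r} 0<p 0<r p≤q r≤s = ℚ.≤-trans
    (ℚ.*-monoʳ-≤-nonNeg r {{ℚ.nonNegative (ℚ.<⇒≤ 0<r)}} p≤q)
    (ℚ.*-monoˡ-≤-nonNeg q {{ℚ.nonNegative (ℚ.<⇒≤ (ℚ.<-≤-trans 0<p p≤q))}} r≤s)

-- Multiplication by pq turns the difference of the reciprocals into -(p - q), and pq is at least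
-- η².
recip-near : ∀ {η ε p q} → 0ℚ ℚ.< η → 0ℚ ℚ.< ε → η ℚ.≤ p → η ℚ.≤ q →
             ∣ p ℚ.- q ∣ ℚ.< η ℚ.* η ℚ.* ε → ∣ recip p ℚ.- recip q ∣ ℚ.< ε
recip-near {η} {ε} {p} {q} 0<η 0<ε η≤p η≤q p-q<ηηε =
  ℚ.*-cancelˡ-<-nonNeg (p ℚ.* q) {{ℚ.nonNegative (ℚ.<⇒≤ 0<pq)}} (begin-strict
    p ℚ.* q ℚ.* ∣ recip p ℚ.- recip q ∣        ≡⟨ cong (ℚ._* ∣ recip p ℚ.- recip q ∣) (ℚ.0≤p⇒∣p∣≡p (ℚ.<⇒≤ 0<pq)) ⟨
    ∣ p ℚ.* q ∣ ℚ.* ∣ recip p ℚ.- recip q ∣    ≡⟨ ℚ.∣p*q∣≡∣p∣*∣q∣ (p ℚ.* q) _ ⟨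
    ∣ p ℚ.* q ℚ.* (recip p ℚ.- recip q) ∣      ≡⟨ cong ∣_∣ clear ⟩
    ∣ ℚ.- (p ℚ.- q) ∣                          ≡⟨ ℚ.∣-p∣≡∣p∣ (p ℚ.- q) ⟩
    ∣ p ℚ.- q ∣                                <⟨ p-q<ηηε ⟩
    η ℚ.* η ℚ.* ε                              ≤⟨ *-mono-≤ (0<*0< 0<η 0<η) 0<ε
                                                    (*-mono-≤ 0<η 0<η η≤p η≤q) ℚ.≤-refl ⟩
    p ℚ.* q ℚ.* ε                              ∎)
  where
  open ℚ.≤-Reasoning
  0<p = ℚ.<-≤-trans 0<η η≤p
  0<q = ℚ.<-≤-trans 0<η η≤q
  0<pq = 0<*0< 0<p 0<q
  clear : p ℚ.* q ℚ.* (recip p ℚ.- recip q) ≡ ℚ.- (p ℚ.- q)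
  clear = ≡.trans
    (solve 4 (λ p q r s → p :* q :* (r :- s) := q :* (p :* r) :- p :* (q :* s)) refl
      p q (recip p) (recip q))
    (≡.trans (cong₂ (λ u v → q ℚ.* u ℚ.- p ℚ.* v) (*-recip 0<p) (*-recip 0<q))
      (solve 2 (λ p q → q :* con 1ℚ :- p :* con 1ℚ := :- (p :- q)) refl p q))
    where open +-*-Solver

EventuallyAbove : ℝ → ℚ → Set
EventuallyAbove x η = ∃ λ N → ∀ n → N ℕ.≤ n → η ℚ.≤ seq x n

-- A bound from below by a positive number is enough, since the reciprocal is taken of a sum of two
-- squares.
recip-ℝ : ∀ x {η} → 0ℚ ℚ.< η → EventuallyAbove x η → ∃ λ y → x *ℝ y ≈ℝ 1ℝ
recip-ℝ x {η} 0<η (N , above) = y , mk≈ℝ λ ε 0<ε → N , λ n N≤n →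
  subst (ℚ._< ε) (cong ∣_∣ (≡.sym (≡.trans
    (cong (ℚ._- 1ℚ) (*-recip (ℚ.<-≤-trans 0<η (above n N≤n)))) (ℚ.+-inverseʳ 1ℚ)))) 0<ε
  where
  y : ℝ
  seq y n = recip (seq x n)
  cauchy y ε 0<ε =
    let (M , near) = cauchy x (η ℚ.* η ℚ.* ε) (0<*0< (0<*0< 0<η 0<η) 0<ε)
    in N ℕ.⊔ M , λ m n h k → recip-near 0<η 0<ε
         (above m (ℕ.m⊔n≤o⇒m≤o N M h)) (above n (ℕ.m⊔n≤o⇒m≤o N M k))
         (near m n (ℕ.m⊔n≤o⇒n≤o N M h) (ℕ.m⊔n≤o⇒n≤o N M k))

private
  square-above : ∀ {δ} p q → 0ℚ ℚ.< δ → δ ℚ.≤ ∣ p ∣ → δ ℚ.* δ ℚ.≤ p ℚ.* p ℚ.+ q ℚ.* q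
  square-above {δ} p q 0<δ δ≤∣p∣ = begin
    δ ℚ.* δ                 ≤⟨ *-mono-≤ 0<δ 0<δ δ≤∣p∣ δ≤∣p∣ ⟩
    ∣ p ∣ ℚ.* ∣ p ∣         ≡⟨ ∣p∣² p ⟩
    p ℚ.* p                 ≡⟨ ℚ.+-identityʳ _ ⟨
    p ℚ.* p ℚ.+ 0ℚ          ≤⟨ ℚ.+-monoʳ-≤ (p ℚ.* p) (subst (0ℚ ℚ.≤_) (∣p∣² q) 0≤∣q∣²) ⟩
    p ℚ.* p ℚ.+ q ℚ.* q     ∎
    where
    open ℚ.≤-Reasoning
    ∣p∣² : ∀ p → ∣ p ∣ ℚ.* ∣ p ∣ ≡ p ℚ.* p
    ∣p∣² p with ℚ.∣p∣≡p∨∣p∣≡-p p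
    ... | inj₁ eq rewrite eq = refl
    ... | inj₂ eq rewrite eq = solve 1 (λ p → (:- p) :* (:- p) := p :* p) refl p
      where open +-*-Solver
    0≤∣q∣² : 0ℚ ℚ.≤ ∣ q ∣ ℚ.* ∣ q ∣
    0≤∣q∣² = ℚ.nonNegative⁻¹ _ {{ℚ.nonNeg*nonNeg⇒nonNeg (∣ q ∣) {{ℚ.∣-∣-nonNeg q}} (∣ q ∣) {{ℚ.∣-∣-nonNeg q}}}}

Apart : ℝ → Set
Apart x = ∃ λ δ → 0ℚ ℚ.< δ × ∃ λ N → ∀ n → N ℕ.≤ n → δ ℚ.≤ ∣ seq x n ∣

-- If one late term had size at least ε, the Cauchy condition would keep all late terms at size at
-- least ε/2, which is apartness.
¬Apart⇒≈0 : ∀ x → ¬ Apart x → x ≈ℝ 0ℝ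
¬Apart⇒≈0 x ¬apart = mk≈ℝ λ ε 0<ε →
  let 0<½ε = 0<*0< (ℚ.positive⁻¹ ½) 0<ε
      (N , near) = cauchy x (½ ℚ.* ε) 0<½ε
  in N , λ n N≤n → close ε 0<½ε N near n N≤n (∣ seq x n ℚ.- 0ℚ ∣ ℚ.<? ε)
  where
  open +-*-Solver
  close : ∀ ε → 0ℚ ℚ.< ½ ℚ.* ε → ∀ N →
          (∀ m n → N ℕ.≤ m → N ℕ.≤ n → ∣ seq x m ℚ.- seq x n ∣ ℚ.< ½ ℚ.* ε) →
          ∀ n → N ℕ.≤ n → Dec (∣ seq x n ℚ.- 0ℚ ∣ ℚ.< ε) → ∣ seq x n ℚ.- 0ℚ ∣ ℚ.< ε
  close ε 0<½ε N near n N≤n (yes p) = p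
  close ε 0<½ε N near n N≤n (no ≮ε) = contradiction
    (½ ℚ.* ε , 0<½ε , N , λ m N≤m → ℚ.≮⇒≥ λ ∣xm∣<½ε → ≮ε (begin-strict
      ∣ seq x n ℚ.- 0ℚ ∣
        ≡⟨ cong ∣_∣ (solve 2 (λ p q → p :- con 0ℚ := (p :- q) :+ q) refl (seq x n) (seq x m)) ⟩
      ∣ (seq x n ℚ.- seq x m) ℚ.+ seq x m ∣
        ≤⟨ ℚ.∣p+q∣≤∣p∣+∣q∣ (seq x n ℚ.- seq x m) (seq x m) ⟩
      ∣ seq x n ℚ.- seq x m ∣ ℚ.+ ∣ seq x m ∣
        <⟨ ℚ.+-mono-< (near n m N≤n N≤m) ∣xm∣<½ε ⟩
      ½ ℚ.* ε ℚ.+ ½ ℚ.* ε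
        ≡⟨ solve 1 (λ ε → con ½ :* ε :+ con ½ :* ε := ε) refl ε ⟩
      ε ∎))
    ¬apart
    where open ℚ.≤-Reasoning

normSq : ℂ → ℝ
normSq z = re z *ℝ re z +ℝ im z *ℝ im z

*-conj/normSq : ∀ z {y} → normSq z *ℝ y ≈ℝ 1ℝ →
             z ℂ-Ring.* ((re z *ℝ y) +i (-ℝ (im z *ℝ y))) ≈ℂ ℂ-Ring.1#
*-conj/normSq z {y} normSq*y≈1 =
    ≈ℝ-trans (pointwise⇒≈ℝ λ n →
      solve 3 (λ a b y → a :* (a :* y) :+ :- (b :* :- (b :* y)) := (a :* a :+ b :* b) :* y)
        refl (seq (re z) n) (seq (im z) n) (seq y n)) normSq*y≈1
  ,ᶜ pointwise⇒≈ℝ (λ n →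
      solve 3 (λ a b y → a :* :- (b :* y) :+ b :* (a :* y) := con 0ℚ)
        refl (seq (re z) n) (seq (im z) n) (seq y n))
  where open +-*-Solver

1≉0 : ¬ ℂ-Ring.1# ≈ℂ ℂ-Ring.0#
1≉0 (1≈0 ,ᶜ _) = let (N , p) = tends 1≈0 1ℚ (ℚ.positive⁻¹ 1ℚ) in ℚ.<-irrefl refl (p N ℕ.≤-refl)

module Field (em : ExcludedMiddle 0ℓ) where

  -- If neither part is apart from 0, both are 0. So for z ≠ 0 one part is apart, and its square
  -- bounds the norm from below.
  normSq-above : ∀ z → ¬ z ≈ℂ ℂ-Ring.0# → ∃ λ η → 0ℚ ℚ.< η × EventuallyAbove (normSq z) η
  normSq-above z z≉0 with em {Apart (re z)} | em {Apart (im z)}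
  ... | yes (δ , 0<δ , N , p) | _ =
    δ ℚ.* δ , 0<*0< 0<δ 0<δ , N ,
    λ n N≤n → square-above (seq (re z) n) (seq (im z) n) 0<δ (p n N≤n)
  ... | no _ | yes (δ , 0<δ , N , p) =
    δ ℚ.* δ , 0<*0< 0<δ 0<δ , N ,
    λ n N≤n → subst (δ ℚ.* δ ℚ.≤_) (ℚ.+-comm (seq (im z) n ℚ.* seq (im z) n) _)
                (square-above (seq (im z) n) (seq (re z) n) 0<δ (p n N≤n))
  ... | no ¬re | no ¬im = contradiction (¬Apart⇒≈0 (re z) ¬re ,ᶜ ¬Apart⇒≈0 (im z) ¬im) z≉0

  inverse : ∀ z → ¬ z ≈ℂ ℂ-Ring.0# → ∃ λ w → z ℂ-Ring.* w ≈ℂ ℂ-Ring.1#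
  inverse z z≉0 =
    let (_ , 0<η , above) = normSq-above z z≉0
        (y , normSq*y≈1)     = recip-ℝ (normSq z) 0<η above
    in (re z *ℝ y) +i (-ℝ (im z *ℝ y)) , *-conj/normSq z normSq*y≈1

-- SL₂(ℤ) as an amalgam

S U : SL₂ℤ
S = record { a = 0ℤ ; b = ℤ.-1ℤ ; c = 1ℤ ; d = 0ℤ ; det≡1 = refl }
U = record { a = 0ℤ ; b = ℤ.-1ℤ ; c = 1ℤ ; d = 1ℤ ; det≡1 = refl }

data Generator : Set where
  s u : Generator

Word : Set
Word = List Generator

⟦_⟧ᴳ : Generator → SL₂ℤ
⟦ s ⟧ᴳ = S
⟦ u ⟧ᴳ = U

-- The amalgam ℤ/4 *_{ℤ/2} ℤ/6 acts on any set with such maps σ and υ.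
record Amalgam (X : Setoid 0ℓ 0ℓ) : Set where
  open Setoid X
  field
    σ υ    : Carrier → Carrier
    σ-cong : ∀ {x y} → x ≈ y → σ x ≈ σ y
    υ-cong : ∀ {x y} → x ≈ y → υ x ≈ υ y
    σ⁴≈id  : ∀ x → σ (σ (σ (σ x))) ≈ x
    υ³≈σ²  : ∀ x → υ (υ (υ x)) ≈ σ (σ x)

-- ± U^i W S^j, where W is a word in T = S³U and its transpose S³U².
record NormalForm : Set where
  constructor nf
  field
    negated : Bool
    i       : Fin 3
    word    : List Bool
    j       : Bool

-- Left multiplication by U and S. Signs change by U³ = S² = -1, SU = -T and SU² = -Tᵗ; conversely
-- ST = U and STᵗ = U². The letter `true` stands for T and `false` for Tᵗ.
u∙ s∙ : NormalForm → NormalForm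
u∙ (nf n 0F w j) = nf n 1F w j
u∙ (nf n 1F w j) = nf n 2F w j
u∙ (nf n 2F w j) = nf (not n) 0F w j
s∙ (nf n 0F []          false) = nf n 0F [] true
s∙ (nf n 0F []          true)  = nf (not n) 0F [] false
s∙ (nf n 0F (true ∷ w)  j)     = nf n 1F w j
s∙ (nf n 0F (false ∷ w) j)     = nf n 2F w j
s∙ (nf n 1F w           j)     = nf (not n) 0F (true ∷ w) j
s∙ (nf n 2F w           j)     = nf (not n) 0F (false ∷ w) j

ε-nf : NormalForm
ε-nf = nf false 0F [] false

normalForm : Word → NormalForm
normalForm []      = ε-nf
normalForm (s ∷ w) = s∙ (normalForm w)
normalForm (u ∷ w) = u∙ (normalForm w)

infix 9 _⁻¹ʷ
_⁻¹ʷ : Word → Word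
[]      ⁻¹ʷ = []
(s ∷ w) ⁻¹ʷ = w ⁻¹ʷ ++ s ∷ s ∷ s ∷ []
(u ∷ w) ⁻¹ʷ = w ⁻¹ʷ ++ u ∷ u ∷ u ∷ u ∷ u ∷ []

module Run {X : Setoid 0ℓ 0ℓ} (A : Amalgam X) where
  open Setoid X renaming (refl to ≈-refl; sym to ≈-sym; trans to ≈-trans)
  open Amalgam A
  open SetoidReasoning X

  run : Word → Carrier → Carrier
  run []      x = x
  run (s ∷ w) x = σ (run w x)
  run (u ∷ w) x = υ (run w x)

  run-cong : ∀ w {x y} → x ≈ y → run w x ≈ run w y
  run-cong []      x≈y = x≈y
  run-cong (s ∷ w) x≈y = σ-cong (run-cong w x≈y)
  run-cong (u ∷ w) x≈y = υ-cong (run-cong w x≈y)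

  run-++ : ∀ v w x → run (v ++ w) x ≡ run v (run w x)
  run-++ []      w x = refl
  run-++ (s ∷ v) w x = cong σ (run-++ v w x)
  run-++ (u ∷ v) w x = cong υ (run-++ v w x)

  ν : Carrier → Carrier
  ν x = σ (σ x)

  ν-cong : ∀ {x y} → x ≈ y → ν x ≈ ν y
  ν-cong = σ-cong ∘ σ-cong

  υν≈νυ : ∀ x → υ (ν x) ≈ ν (υ x)
  υν≈νυ x = ≈-trans (υ-cong (≈-sym (υ³≈σ² x))) (υ³≈σ² (υ x))

  υ⁶≈id : ∀ x → υ (υ (υ (υ (υ (υ x))))) ≈ x
  υ⁶≈id x = ≈-trans (υ³≈σ² _) (≈-trans (ν-cong (υ³≈σ² x)) (σ⁴≈id x))

  run-inverseˡ : ∀ w x → run (w ⁻¹ʷ) (run w x) ≈ x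
  run-inverseˡ []      x = ≈-refl
  run-inverseˡ (s ∷ w) x = begin
    run (w ⁻¹ʷ ++ s ∷ s ∷ s ∷ []) (σ (run w x))  ≡⟨ run-++ (w ⁻¹ʷ) _ _ ⟩
    run (w ⁻¹ʷ) (σ (σ (σ (σ (run w x)))))        ≈⟨ run-cong (w ⁻¹ʷ) (σ⁴≈id _) ⟩
    run (w ⁻¹ʷ) (run w x)                        ≈⟨ run-inverseˡ w x ⟩
    x                                            ∎
  run-inverseˡ (u ∷ w) x = begin
    run (w ⁻¹ʷ ++ u ∷ u ∷ u ∷ u ∷ u ∷ []) (υ (run w x))  ≡⟨ run-++ (w ⁻¹ʷ) _ _ ⟩
    run (w ⁻¹ʷ) (υ (υ (υ (υ (υ (υ (run w x)))))))        ≈⟨ run-cong (w ⁻¹ʷ) (υ⁶≈id _) ⟩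
    run (w ⁻¹ʷ) (run w x)                                ≈⟨ run-inverseˡ w x ⟩
    x                                                    ∎

  run-inverseʳ : ∀ w x → run w (run (w ⁻¹ʷ) x) ≈ x
  run-inverseʳ []      x = ≈-refl
  run-inverseʳ (s ∷ w) x = begin
    σ (run w (run (w ⁻¹ʷ ++ s ∷ s ∷ s ∷ []) x))  ≡⟨ cong (σ ∘ run w) (run-++ (w ⁻¹ʷ) _ x) ⟩
    σ (run w (run (w ⁻¹ʷ) (σ (σ (σ x)))))        ≈⟨ σ-cong (run-inverseʳ w _) ⟩
    σ (σ (σ (σ x)))                              ≈⟨ σ⁴≈id x ⟩
    x                                            ∎
  run-inverseʳ (u ∷ w) x = begin
    υ (run w (run (w ⁻¹ʷ ++ u ∷ u ∷ u ∷ u ∷ u ∷ []) x))  ≡⟨ cong (υ ∘ run w) (run-++ (w ⁻¹ʷ) _ x) ⟩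
    υ (run w (run (w ⁻¹ʷ) (υ (υ (υ (υ (υ x)))))))        ≈⟨ υ-cong (run-inverseʳ w _) ⟩
    υ (υ (υ (υ (υ (υ x)))))                              ≈⟨ υ⁶≈id x ⟩
    x                                                    ∎

  sign : Bool → Carrier → Carrier
  sign false x = x
  sign true  x = ν x

  υ^ : Fin 3 → Carrier → Carrier
  υ^ 0F x = x
  υ^ 1F x = υ x
  υ^ 2F x = υ (υ x)

  runPositive : List Bool → Carrier → Carrier
  runPositive []          x = x
  runPositive (true ∷ w)  x = σ (σ (σ (υ (runPositive w x))))
  runPositive (false ∷ w) x = σ (σ (σ (υ (υ (runPositive w x)))))

  σ^ : Bool → Carrier → Carrier
  σ^ false x = x
  σ^ true  x = σ x

  runNormalForm : NormalForm → Carrier → Carrier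
  runNormalForm (nf n i w j) x = sign n (υ^ i (runPositive w (σ^ j x)))

  sign-cong : ∀ n {x y} → x ≈ y → sign n x ≈ sign n y
  sign-cong false = λ x≈y → x≈y
  sign-cong true  = ν-cong

  sign-σ : ∀ n x → sign n (σ x) ≡ σ (sign n x)
  sign-σ false x = refl
  sign-σ true  x = refl

  sign-υ : ∀ n x → sign n (υ x) ≈ υ (sign n x)
  sign-υ false x = ≈-refl
  sign-υ true  x = ≈-sym (υν≈νυ x)

  sign-not-ν : ∀ n x → sign (not n) (ν x) ≈ sign n x
  sign-not-ν false x = σ⁴≈id x
  sign-not-ν true  x = ≈-refl

  run-u∙ : ∀ n x → runNormalForm (u∙ n) x ≈ υ (runNormalForm n x)
  run-u∙ (nf n 0F w j) x = sign-υ n _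
  run-u∙ (nf n 1F w j) x = sign-υ n _
  run-u∙ (nf n 2F w j) x = begin
    sign (not n) y              ≈⟨ sign-cong (not n) (σ⁴≈id y) ⟨
    sign (not n) (ν (ν y))      ≈⟨ sign-not-ν n (ν y) ⟩
    sign n (ν y)                ≈⟨ sign-cong n (υ³≈σ² y) ⟨
    sign n (υ (υ (υ y)))        ≈⟨ sign-υ n _ ⟩
    υ (sign n (υ (υ y)))        ∎
    where y = runPositive w (σ^ j x)

  run-s∙ : ∀ n x → runNormalForm (s∙ n) x ≈ σ (runNormalForm n x)
  run-s∙ (nf n 0F [] false) x = reflexive (sign-σ n x)
  run-s∙ (nf n 0F [] true)  x = begin
    sign (not n) x          ≈⟨ sign-cong (not n) (σ⁴≈id x) ⟨
    sign (not n) (ν (ν x))  ≈⟨ sign-not-ν n (ν x) ⟩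
    sign n (ν x)            ≡⟨ sign-σ n (σ x) ⟩
    σ (sign n (σ x))        ∎
  run-s∙ (nf n 0F (true ∷ w) j) x =
    ≈-trans (sign-cong n (≈-sym (σ⁴≈id _))) (reflexive (sign-σ n _))
  run-s∙ (nf n 0F (false ∷ w) j) x =
    ≈-trans (sign-cong n (≈-sym (σ⁴≈id _))) (reflexive (sign-σ n _))
  run-s∙ (nf n 1F w j) x = ≈-trans (sign-not-ν n _) (reflexive (sign-σ n _))
  run-s∙ (nf n 2F w j) x = ≈-trans (sign-not-ν n _) (reflexive (sign-σ n _))

  run-normalForm : ∀ w x → runNormalForm (normalForm w) x ≈ run w x
  run-normalForm []      x = ≈-refl
  run-normalForm (s ∷ w) x = ≈-trans (run-s∙ (normalForm w) x) (σ-cong (run-normalForm w x))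
  run-normalForm (u ∷ w) x = ≈-trans (run-u∙ (normalForm w) x) (υ-cong (run-normalForm w x))

  runPositive-cong : ∀ w {x y} → x ≈ y → runPositive w x ≈ runPositive w y
  runPositive-cong []          x≈y = x≈y
  runPositive-cong (true ∷ w)  x≈y = σ-cong (ν-cong (υ-cong (runPositive-cong w x≈y)))
  runPositive-cong (false ∷ w) x≈y = σ-cong (ν-cong (υ-cong (υ-cong (runPositive-cong w x≈y))))

  runPositive-ν : ∀ w x → runPositive w (ν x) ≈ ν (runPositive w x)
  runPositive-ν []          x = ≈-refl
  runPositive-ν (true ∷ w)  x = σ-cong (ν-cong (≈-trans (υ-cong (runPositive-ν w x)) (υν≈νυ _)))
  runPositive-ν (false ∷ w) x = σ-cong (ν-cong (≈-trans
    (υ-cong (≈-trans (υ-cong (runPositive-ν w x)) (υν≈νυ _))) (υν≈νυ _)))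

-- Faithfulness of the action of the amalgam on ℤ²

ℤ²-amalgam : Amalgam (≡.setoid (ℤ × ℤ))
ℤ²-amalgam = record
  { σ = λ (x , y) → ℤ.- y , x
  ; υ = λ (x , y) → ℤ.- y , x ℤ.+ y
  ; σ-cong = cong _
  ; υ-cong = cong _
  ; σ⁴≈id = λ (x , y) → cong₂ _,_ (ℤ.neg-involutive x) (ℤ.neg-involutive y)
  ; υ³≈σ² = λ (x , y) → cong₂ _,_
      (solve 2 (λ x y → :- (:- y :+ (x :+ y)) := :- x) refl x y)
      (solve 2 (λ x y → :- (x :+ y) :+ (:- y :+ (x :+ y)) := :- y) refl x y)
  }
  where open ℤSolver.+-*-Solver

module ℤ² = Run ℤ²-amalgam

apply : SL₂ℤ → ℤ × ℤ → ℤ × ℤ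
apply g (x , y) = a ℤ.* x ℤ.+ b ℤ.* y , c ℤ.* x ℤ.+ d ℤ.* y
  where open SL₂ℤ g

Represents : Word → SL₂ℤ → Set
Represents w g = ∀ x → ℤ².run w x ≡ apply g x

-- Words in T and its transpose acting on ℕ², so that nonnegativity of the entries is built into the
-- type.
positiveℕ : List Bool → ℕ × ℕ → ℕ × ℕ
positiveℕ []          v = v
positiveℕ (true ∷ w)  v = let (x , y) = positiveℕ w v in x ℕ.+ y , y
positiveℕ (false ∷ w) v = let (x , y) = positiveℕ w v in x , x ℕ.+ y

+²_ : ℕ × ℕ → ℤ × ℤ
+² (x , y) = + x , + y

run-T : ∀ x y → ℤ².run (s ∷ s ∷ s ∷ u ∷ []) (x , y) ≡ (x ℤ.+ y , y)
run-T x y = cong₂ _,_ (ℤ.neg-involutive (x ℤ.+ y)) (ℤ.neg-involutive y)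

run-Tᵗ : ∀ x y → ℤ².run (s ∷ s ∷ s ∷ u ∷ u ∷ []) (x , y) ≡ (x , x ℤ.+ y)
run-Tᵗ x y = cong₂ _,_
  (solve 2 (λ x y → :- :- (:- y :+ (x :+ y)) := x) refl x y) (ℤ.neg-involutive (x ℤ.+ y))
  where open ℤSolver.+-*-Solver

-- From T = S⁻¹U one gets T⁻¹ = U⁻¹S, where U⁻¹ = -U² and -1 = S².
run-T⁻¹ : ∀ x y → ℤ².run (s ∷ s ∷ u ∷ u ∷ s ∷ []) (x , y) ≡ (x ℤ.- y , y)
run-T⁻¹ x y = cong₂ _,_
  (solve 2 (λ x y → :- :- (:- y :+ x) := x :- y) refl x y)
  (solve 2 (λ x y → :- (:- x :+ (:- y :+ x)) := y) refl x y)
  where open ℤSolver.+-*-Solver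

runPositive-ℕ : ∀ w v → ℤ².runPositive w (+² v) ≡ +² positiveℕ w v
runPositive-ℕ []          v = refl
runPositive-ℕ (true ∷ w)  v rewrite runPositive-ℕ w v =
  let (x , y) = positiveℕ w v in run-T (+ x) (+ y)
runPositive-ℕ (false ∷ w) v rewrite runPositive-ℕ w v =
  let (x , y) = positiveℕ w v in run-Tᵗ (+ x) (+ y)

sum² : ℕ × ℕ → ℕ
sum² (x , y) = x ℕ.+ y

-- Each letter adds one coordinate to the other, so the sum cannot drop and nonzero vectors stay
-- nonzero.
positiveℕ-sum : ∀ w v → sum² v ℕ.≤ sum² (positiveℕ w v)
positiveℕ-sum []          v = ℕ.≤-refl
positiveℕ-sum (true ∷ w)  v = ℕ.≤-trans (positiveℕ-sum w v) (ℕ.m≤m+n _ _)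
positiveℕ-sum (false ∷ w) v = ℕ.≤-trans (positiveℕ-sum w v) (ℕ.m≤n+m _ (proj₁ (positiveℕ w v)))

private
  -+≢1 : ∀ n → ¬ ℤ.- (+ n) ≡ 1ℤ
  -+≢1 zero    ()
  -+≢1 (suc _) ()

  -+≡0⇒≡0 : ∀ {n} → ℤ.- (+ n) ≡ 0ℤ → n ≡ 0
  -+≡0⇒≡0 {zero} _ = refl

  1≤n⇒n≢0 : ∀ {n} → 1 ℕ.≤ n → ¬ n ≡ 0
  1≤n⇒n≢0 () refl

-- The outermost letter decides. If it is T, the upper right entry is the coordinate sum of the
-- image of (0 , 1) under the remaining letters, hence at least 1; if it is the transpose, the same
-- happens to the lower left entry.
positiveℕ-identity : ∀ w → proj₂ (positiveℕ w (1 , 0)) ≡ 0 → proj₁ (positiveℕ w (0 , 1)) ≡ 0 → w ≡ []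
positiveℕ-identity []          _   _   = refl
positiveℕ-identity (true ∷ w)  _   b≡0 = contradiction b≡0 (1≤n⇒n≢0 (positiveℕ-sum w (0 , 1)))
positiveℕ-identity (false ∷ w) c≡0 _   = contradiction c≡0 (1≤n⇒n≢0 (positiveℕ-sum w (1 , 0)))

-- The matrices U^{-i}S^{-j} other than ±1 have entries of both signs, so
-- they are not a product of nonnegative matrices, even up to sign.
normalForm-identity : ∀ n → ℤ².runNormalForm n (1ℤ , 0ℤ) ≡ (1ℤ , 0ℤ) →
                      ℤ².runNormalForm n (0ℤ , 1ℤ) ≡ (0ℤ , 1ℤ) → n ≡ ε-nf
normalForm-identity (nf n i w j) eq₁ eq₂ = go n i j eq₁ eq₂
  where
  e₁ = positiveℕ w (1 , 0)
  e₂ = positiveℕ w (0 , 1)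

  e₁≢0 : ¬ sum² e₁ ≡ 0
  e₁≢0 = 1≤n⇒n≢0 (positiveℕ-sum w (1 , 0))

  e₂≢0 : ¬ sum² e₂ ≡ 0
  e₂≢0 = 1≤n⇒n≢0 (positiveℕ-sum w (0 , 1))

  w-e₁ : ℤ².runPositive w (1ℤ , 0ℤ) ≡ +² e₁
  w-e₁ = runPositive-ℕ w (1 , 0)

  w-e₂ : ℤ².runPositive w (0ℤ , 1ℤ) ≡ +² e₂
  w-e₂ = runPositive-ℕ w (0 , 1)

  w--e₁ : ℤ².runPositive w (ℤ.-1ℤ , 0ℤ) ≡ ℤ².ν (+² e₁)
  w--e₁ = ≡.trans (ℤ².runPositive-ν w (1ℤ , 0ℤ)) (cong ℤ².ν w-e₁)

  go : ∀ n i j → ℤ².runNormalForm (nf n i w j) (1ℤ , 0ℤ) ≡ (1ℤ , 0ℤ) →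
       ℤ².runNormalForm (nf n i w j) (0ℤ , 1ℤ) ≡ (0ℤ , 1ℤ) → nf n i w j ≡ ε-nf
  go false 0F false p q rewrite w-e₁ | w-e₂ =
    cong (λ w → nf false 0F w false)
      (positiveℕ-identity w (ℤ.+-injective (cong proj₂ p)) (ℤ.+-injective (cong proj₁ q)))
  go true  0F false p q rewrite w-e₁ = contradiction (cong proj₁ p) (-+≢1 _)
  go false 0F true  p q rewrite w--e₁ = contradiction (cong proj₂ q) (-+≢1 _)
  go true  0F true  p q rewrite w-e₂ = contradiction (cong proj₁ p) (-+≢1 _)
  go false 1F false p q rewrite w-e₁ = contradiction (cong proj₁ p) (-+≢1 _)
  go true  1F false p q rewrite w-e₂ = contradiction (cong proj₂ q) (-+≢1 _)
  go false 1F true  p q rewrite w-e₂ = contradiction (cong proj₁ p) (-+≢1 _)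
  -- In the cases settled by `e₂≢0` or `e₁≢0`, an off-diagonal entry is up to sign a coordinate sum,
  -- so its vanishing would make a column of the positive product zero.
  go true  1F true  p q rewrite w-e₂ = contradiction (-+≡0⇒≡0 (cong proj₂ p)) e₂≢0
  go false 2F false p q rewrite w-e₁ = contradiction (cong proj₁ p) (-+≢1 _)
  go true  2F false p q rewrite w-e₂ = contradiction
    (ℤ.+-injective (≡.trans (≡.sym (ℤ.neg-involutive _)) (cong proj₁ q))) e₂≢0
  go false 2F true  p q rewrite w-e₂ = contradiction (cong proj₁ p) (-+≢1 _)
  go true  2F true  p q rewrite w--e₁ = contradiction
    (-+≡0⇒≡0 (≡.trans (ℤ.neg-distrib-+ (+ proj₁ e₁) (+ proj₂ e₁))
                      (≡.trans (≡.sym (ℤ.neg-involutive _)) (cong proj₁ q)))) e₁≢0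

-- That is, SL₂(ℤ) is no proper quotient of ℤ/4 *_{ℤ/2} ℤ/6.
run-identity : ∀ {X} (A : Amalgam X) → let open Setoid X in
               ∀ w → (∀ v → ℤ².run w v ≡ v) → ∀ x → Run.run A w x ≈ x
run-identity {X} A w w≡id x = begin
  run w x                           ≈⟨ run-normalForm w x ⟨
  runNormalForm (normalForm w) x    ≡⟨ cong (λ n → runNormalForm n x) (normalForm-identity (normalForm w)
                                         (≡.trans (ℤ².run-normalForm w _) (w≡id _))
                                         (≡.trans (ℤ².run-normalForm w _) (w≡id _))) ⟩
  x                                 ∎
  where
  open Run A
  open SetoidReasoning X

-- Apply `run-identity` to v⁻¹w. As a consequence, the operator attached to a matrix does not depend
-- on the word chosen for it.
run-agree : ∀ {X} (A : Amalgam X) → let open Setoid X in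
            ∀ v w → (∀ x → ℤ².run v x ≡ ℤ².run w x) → ∀ x → Run.run A v x ≈ Run.run A w x
run-agree {X} A v w v≗w x = begin
  run v x                       ≈⟨ run-cong v (run-identity A (v ⁻¹ʷ ++ w) v⁻¹w≗id x) ⟨
  run v (run (v ⁻¹ʷ ++ w) x)    ≡⟨ cong (run v) (run-++ (v ⁻¹ʷ) w x) ⟩
  run v (run (v ⁻¹ʷ) (run w x)) ≈⟨ run-inverseʳ v _ ⟩
  run w x                       ∎
  where
  open Run A
  open SetoidReasoning X
  v⁻¹w≗id : ∀ y → ℤ².run (v ⁻¹ʷ ++ w) y ≡ y
  v⁻¹w≗id y = ≡.trans (ℤ².run-++ (v ⁻¹ʷ) w y)
    (≡.trans (cong (ℤ².run (v ⁻¹ʷ)) (≡.sym (v≗w y))) (ℤ².run-inverseˡ v y))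

-- Generation of SL₂(ℤ) by S and U

apply-∙ : ∀ g h x → apply (g G.∙ h) x ≡ apply g (apply h x)
apply-∙ g h (x , y) = cong₂ _,_ (row (SL₂ℤ.a g) (SL₂ℤ.b g)) (row (SL₂ℤ.c g) (SL₂ℤ.d g))
  where
  open SL₂ℤ h
  row : ∀ p q → (p ℤ.* a ℤ.+ q ℤ.* c) ℤ.* x ℤ.+ (p ℤ.* b ℤ.+ q ℤ.* d) ℤ.* y
                ≡ p ℤ.* (a ℤ.* x ℤ.+ b ℤ.* y) ℤ.+ q ℤ.* (c ℤ.* x ℤ.+ d ℤ.* y)
  row p q = solve 8 (λ p q a b c d x y →
      (p :* a :+ q :* c) :* x :+ (p :* b :+ q :* d) :* y
      := p :* (a :* x :+ b :* y) :+ q :* (c :* x :+ d :* y)) refl p q a b c d x y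
    where open ℤSolver.+-*-Solver

apply-resp : ∀ {g h} → g ≈G h → ∀ x → apply g x ≡ apply h x
apply-resp g≈h (x , y) = cong₂ _,_
  (cong₂ (λ p q → p ℤ.* x ℤ.+ q ℤ.* y) a≡ b≡) (cong₂ (λ p q → p ℤ.* x ℤ.+ q ℤ.* y) c≡ d≡)
  where open _≈G_ g≈h

apply-S : ∀ x → apply S x ≡ Amalgam.σ ℤ²-amalgam x
apply-S (x , y) = cong₂ _,_
  (solve 2 (λ x y → con 0ℤ :* x :+ con ℤ.-1ℤ :* y := :- y) refl x y)
  (solve 2 (λ x y → con 1ℤ :* x :+ con 0ℤ :* y := x) refl x y)
  where open ℤSolver.+-*-Solver

apply-U : ∀ x → apply U x ≡ Amalgam.υ ℤ²-amalgam x
apply-U (x , y) = cong₂ _,_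
  (solve 2 (λ x y → con 0ℤ :* x :+ con ℤ.-1ℤ :* y := :- y) refl x y)
  (solve 2 (λ x y → con 1ℤ :* x :+ con 1ℤ :* y := x :+ y) refl x y)
  where open ℤSolver.+-*-Solver

apply-ε : ∀ x → apply G.ε x ≡ x
apply-ε (x , y) = cong₂ _,_
  (solve 2 (λ x y → con 1ℤ :* x :+ con 0ℤ :* y := x) refl x y)
  (solve 2 (λ x y → con 0ℤ :* x :+ con 1ℤ :* y := y) refl x y)
  where open ℤSolver.+-*-Solver

-- An induction principle for matrices, used both to find words and to reduce equivariance of a map
-- to S and U.
module Generation (P : SL₂ℤ → Set) (P-resp : ∀ {g h} → g ≈G h → P g → P h)
                  (P-S : ∀ {g} → P g → P (S G.∙ g)) (P-U : ∀ {g} → P g → P (U G.∙ g)) (P-ε : P G.ε) where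

  open SL₂ℤ
  open ℤSolver.+-*-Solver

  column₁ column₂ : SL₂ℤ → ℤ × ℤ
  column₁ g = a g , c g
  column₂ g = b g , d g

  infixr 5 _⋆_
  _⋆_ : Word → SL₂ℤ → SL₂ℤ
  []      ⋆ g = g
  (x ∷ w) ⋆ g = ⟦ x ⟧ᴳ G.∙ (w ⋆ g)

  P-⋆ : ∀ w {g} → P g → P (w ⋆ g)
  P-⋆ []      p = p
  P-⋆ (s ∷ w) p = P-S (P-⋆ w p)
  P-⋆ (u ∷ w) p = P-U (P-⋆ w p)

  ⋆-column₁ : ∀ w g → column₁ (w ⋆ g) ≡ ℤ².run w (column₁ g)
  ⋆-column₁ []      g = refl
  ⋆-column₁ (s ∷ w) g = ≡.trans (apply-S _) (cong (Amalgam.σ ℤ²-amalgam) (⋆-column₁ w g))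
  ⋆-column₁ (u ∷ w) g = ≡.trans (apply-U (a (w ⋆ g) , c (w ⋆ g))) (cong (Amalgam.υ ℤ²-amalgam) (⋆-column₁ w g))

  ⋆-column₂ : ∀ w g → column₂ (w ⋆ g) ≡ ℤ².run w (column₂ g)
  ⋆-column₂ []      g = refl
  ⋆-column₂ (s ∷ w) g = ≡.trans (apply-S _) (cong (Amalgam.σ ℤ²-amalgam) (⋆-column₂ w g))
  ⋆-column₂ (u ∷ w) g = ≡.trans (apply-U (b (w ⋆ g) , d (w ⋆ g))) (cong (Amalgam.υ ℤ²-amalgam) (⋆-column₂ w g))

  -- Left multiplication acts on the columns separately, so the identity h = wg is checked by
  -- running `w` on two vectors. The smaller matrix is `g`: descents invoke this lemma with the
  -- inverse of the reduction step as `w`.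
  move : ∀ w {g h} → ℤ².run w (column₁ g) ≡ column₁ h → ℤ².run w (column₂ g) ≡ column₂ h → P g → P h
  move w {g} {h} p q =
    let p′ = ≡.trans (⋆-column₁ w g) p
        q′ = ≡.trans (⋆-column₂ w g) q
    in P-resp (record { a≡ = cong proj₁ p′ ; b≡ = cong proj₁ q′ ; c≡ = cong proj₂ p′ ; d≡ = cong proj₂ q′ })
         ∘ P-⋆ w

  PEntries : ℤ → ℤ → ℤ → ℤ → Set
  PEntries a b c d = (det≡1 : a ℤ.* d ℤ.- b ℤ.* c ≡ 1ℤ) → P (record { a = a ; b = b ; c = c ; d = d ; det≡1 = det≡1 })

  det≡1-T : ∀ b → 1ℤ ℤ.* 1ℤ ℤ.- b ℤ.* 0ℤ ≡ 1ℤ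
  det≡1-T = solve 1 (λ b → con 1ℤ :* con 1ℤ :- b :* con 0ℤ := con 1ℤ) refl

  translation : ∀ b → PEntries 1ℤ b 0ℤ 1ℤ
  translation (+ zero) _ = P-resp (record { a≡ = refl ; b≡ = refl ; c≡ = refl ; d≡ = refl }) P-ε
  translation (+ suc n) _ = move (s ∷ s ∷ s ∷ u ∷ []) refl
    (≡.trans (run-T (+ n) 1ℤ) (cong (λ k → + k , 1ℤ) (ℕ.+-comm n 1))) (translation (+ n) (det≡1-T (+ n)))
  translation -[1+ zero ] _ = move (s ∷ s ∷ u ∷ u ∷ s ∷ []) refl refl (translation 0ℤ refl)
  translation -[1+ suc n ] _ = move (s ∷ s ∷ u ∷ u ∷ s ∷ []) refl
    (≡.trans (run-T⁻¹ -[1+ n ] 1ℤ) (cong (λ k → -[1+ suc k ] , 1ℤ) (ℕ.+-identityʳ n)))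
    (translation -[1+ n ] (det≡1-T -[1+ n ]))

  upper-triangular : ∀ a b d → PEntries (+ a) b 0ℤ d
  upper-triangular a b d det = go a≡1 d≡1 det
    where
    ad≡1 : + a ℤ.* d ≡ 1ℤ
    ad≡1 = ≡.trans (solve 3 (λ a b d → a :* d := a :* d :- b :* con 0ℤ) refl (+ a) b d) det
    a≡1 : a ≡ 1
    a≡1 = ℕ.m*n≡1⇒m≡1 a ℤ.∣ d ∣ (≡.trans (≡.sym (ℤ.abs-* (+ a) d)) (cong ℤ.∣_∣ ad≡1))
    d≡1 : d ≡ 1ℤ
    d≡1 = ≡.trans (≡.sym (ℤ.*-identityˡ d)) (≡.trans (cong (λ k → + k ℤ.* d) (≡.sym a≡1)) ad≡1)
    go : ∀ {a d} → a ≡ 1 → d ≡ 1ℤ → PEntries (+ a) b 0ℤ d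
    go refl refl = translation b

  -- The Euclidean algorithm on the first column.
  nonnegative : ∀ n a c → a ℕ.+ c ℕ.≤ n → ∀ b d → PEntries (+ a) b (+ c) d
  nonnegative n a zero _ b d det = upper-triangular a b d det
  -- S⁻¹ turns the first column (0 , c) into (c , 0), which ends the descent.
  nonnegative n zero c@(suc _) _ b d det = move (s ∷ []) refl (cong (_, d) (ℤ.neg-involutive b))
    (upper-triangular c d (ℤ.- b) (≡.trans
      (solve 3 (λ b c d → c :* (:- b) :- d :* con 0ℤ := con 0ℤ :* d :- b :* c) refl b (+ c) d) det))
  nonnegative (suc n) a@(suc a′) c@(suc c′) (ℕ.s≤s a+c≤n) b d det with ℕ.≤-total c a
  ... | inj₁ c≤a with ℕ.m≤n⇒∃[o]m+o≡n c≤a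
  ...   | k , refl = move (s ∷ s ∷ s ∷ u ∷ [])
    (≡.trans (run-T (+ k) (+ c)) (cong (λ m → + m , + c) (ℕ.+-comm k c)))
    (≡.trans (run-T (b ℤ.- d) d) (cong (_, d) (solve 2 (λ b d → b :- d :+ d := b) refl b d)))
    (nonnegative n k c (ℕ.≤-trans (ℕ.+-monoˡ-≤ c (ℕ.m≤n+m k c′)) a+c≤n) (b ℤ.- d) d
      (≡.trans (solve 4 (λ k b c d → k :* d :- (b :- d) :* c := (c :+ k) :* d :- b :* c) refl (+ k) b (+ c) d) det))
  nonnegative (suc n) a@(suc a′) c@(suc c′) (ℕ.s≤s a+c≤n) b d det | inj₂ a≤c with ℕ.m≤n⇒∃[o]m+o≡n a≤c
  ...   | k , refl = move (s ∷ s ∷ s ∷ u ∷ u ∷ [])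
    (run-Tᵗ (+ a) (+ k))
    (≡.trans (run-Tᵗ b (d ℤ.- b)) (cong (b ,_) (solve 2 (λ b d → b :+ (d :- b) := d) refl b d)))
    (nonnegative n a k (ℕ.≤-trans (ℕ.m≤n+m (a ℕ.+ k) a′) a+c≤n) b (d ℤ.- b)
      (≡.trans (solve 4 (λ a b k d → a :* (d :- b) :- b :* k := a :* d :- b :* (a :+ k)) refl (+ a) b (+ k) d) det))

  -- Powers of S rotate the quadrants into one another, so the first column can be made nonnegative.
  any-entries : ∀ a b c d → PEntries a b c d
  any-entries (+ a) b (+ c) d det = nonnegative (a ℕ.+ c) a c ℕ.≤-refl b d det
  any-entries (+ a) b -[1+ c ] d det = move (s ∷ s ∷ s ∷ [])
    (cong (_, -[1+ c ]) (ℤ.neg-involutive (+ a)))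
    (cong₂ _,_ (ℤ.neg-involutive b) (ℤ.neg-involutive d))
    (nonnegative _ (suc c) a ℕ.≤-refl (ℤ.- d) b (≡.trans
      (solve 4 (λ a b c d → c :* b :- (:- d) :* a := a :* d :- b :* (:- c)) refl (+ a) b (+ suc c) d) det))
  any-entries -[1+ a ] b -[1+ c ] d det = move (s ∷ s ∷ []) refl
    (cong₂ _,_ (ℤ.neg-involutive b) (ℤ.neg-involutive d))
    (nonnegative _ (suc a) (suc c) ℕ.≤-refl (ℤ.- b) (ℤ.- d) (≡.trans
      (solve 4 (λ a b c d → a :* (:- d) :- (:- b) :* c := (:- a) :* d :- b :* (:- c)) refl (+ suc a) b (+ suc c) d) det))
  any-entries -[1+ a ] b (+ c) d det = move (s ∷ []) refl
    (cong (_, d) (ℤ.neg-involutive b))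
    (nonnegative _ c (suc a) ℕ.≤-refl d (ℤ.- b) (≡.trans
      (solve 4 (λ a b c d → c :* (:- b) :- d :* a := (:- a) :* d :- b :* c) refl (+ suc a) b (+ c) d) det))

  generated : ∀ g → P g
  generated g = any-entries (a g) (b g) (c g) (d g) (det≡1 g)

wordOf : ∀ g → ∃ λ w → Represents w g
wordOf = Generation.generated (λ g → ∃ λ w → Represents w g)
  (λ g≈h (w , w≗g) → w , λ x → ≡.trans (w≗g x) (apply-resp g≈h x))
  (λ {g} (w , w≗g) → s ∷ w , λ x → ≡.trans (cong (Amalgam.σ ℤ²-amalgam) (w≗g x))
    (≡.sym (≡.trans (apply-∙ S g x) (apply-S _))))
  (λ {g} (w , w≗g) → u ∷ w , λ x → ≡.trans (cong (Amalgam.υ ℤ²-amalgam) (w≗g x))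
    (≡.sym (≡.trans (apply-∙ U g x) (apply-U (apply g x)))))
  ([] , λ x → ≡.sym (apply-ε x))

-- Modules from operators satisfying the relations of the amalgam

record LinearAmalgam (X : LeftModule ℂ-Ring.ring 0ℓ 0ℓ) : Set where
  open LeftModule X
  field
    amalgam : Amalgam ≈ᴹ-setoid
  open Amalgam amalgam public
  field
    σ-homo-+ : ∀ x y → σ (x +ᴹ y) ≈ᴹ σ x +ᴹ σ y
    σ-homo-* : ∀ k x → σ (k *ₗ x) ≈ᴹ k *ₗ σ x
    υ-homo-+ : ∀ x y → υ (x +ᴹ y) ≈ᴹ υ x +ᴹ υ y
    υ-homo-* : ∀ k x → υ (k *ₗ x) ≈ᴹ k *ₗ υ x

module FromAmalgam (X : LeftModule ℂ-Ring.ring 0ℓ 0ℓ) (A : LinearAmalgam X) where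
  open LeftModule X
  open LinearAmalgam A
  open Run amalgam

  run-homo-+ : ∀ w x y → run w (x +ᴹ y) ≈ᴹ run w x +ᴹ run w y
  run-homo-+ []      x y = ≈ᴹ-refl
  run-homo-+ (s ∷ w) x y = ≈ᴹ-trans (σ-cong (run-homo-+ w x y)) (σ-homo-+ _ _)
  run-homo-+ (u ∷ w) x y = ≈ᴹ-trans (υ-cong (run-homo-+ w x y)) (υ-homo-+ _ _)

  run-homo-* : ∀ w k x → run w (k *ₗ x) ≈ᴹ k *ₗ run w x
  run-homo-* []      k x = ≈ᴹ-refl
  run-homo-* (s ∷ w) k x = ≈ᴹ-trans (σ-cong (run-homo-* w k x)) (σ-homo-* _ _)
  run-homo-* (u ∷ w) k x = ≈ᴹ-trans (υ-cong (run-homo-* w k x)) (υ-homo-* _ _)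

  word : SL₂ℤ → Word
  word g = proj₁ (wordOf g)

  run-word : ∀ g v → (∀ x → apply g x ≡ ℤ².run v x) → ∀ x → run (word g) x ≈ᴹ run v x
  run-word g v g≗v = run-agree amalgam (word g) v λ x → ≡.trans (proj₂ (wordOf g) x) (g≗v x)

  -- Each matrix acts through the word chosen by `wordOf`; the laws of an action hold because words
  -- representing the same matrix act alike.
  ℂG-module : ℂGModule
  ℂG-module = record
    { space = X
    ; _·_ = λ g → run (word g)
    ; ·-cong = λ {g} {h} {x} {y} g≈h x≈y → ≈ᴹ-trans
        (run-word g (word h) (λ z → ≡.trans (apply-resp g≈h z) (≡.sym (proj₂ (wordOf h) z))) x)
        (run-cong (word h) x≈y)
    ; ·-homo-+ = λ g → run-homo-+ (word g)
    ; ·-homo-* = λ g → run-homo-* (word g)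
    ; ε-· = run-word G.ε [] apply-ε
    ; ∙-· = λ g h x → ≈ᴹ-trans
        (run-word (g G.∙ h) (word g ++ word h) (λ z → ≡.sym (≡.trans (ℤ².run-++ (word g) (word h) z)
          (≡.trans (cong (ℤ².run (word g)) (proj₂ (wordOf h) z))
            (≡.trans (proj₂ (wordOf g) _) (≡.sym (apply-∙ g h z)))))) x)
        (≈ᴹ-reflexive (run-++ (word g) (word h) x))
    }

  S-· : ∀ x → ℂGModule._·_ ℂG-module S x ≈ᴹ σ x
  S-· = run-word S (s ∷ []) apply-S

  U-· : ∀ x → ℂGModule._·_ ℂG-module U x ≈ᴹ υ x
  U-· = run-word U (u ∷ []) apply-U

-- The module M∞

module ℂV = ℂGModule V

pointwise : (I : Set) → LeftModule ℂ-Ring.ring 0ℓ 0ℓ → LeftModule ℂ-Ring.ring 0ℓ 0ℓ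
pointwise I X = record
  { Carrierᴹ = I → Carrierᴹ
  ; _≈ᴹ_ = λ f g → ∀ i → f i ≈ᴹ g i
  ; _+ᴹ_ = λ f g i → f i +ᴹ g i
  ; _*ₗ_ = λ k f i → k *ₗ f i
  ; 0ᴹ = λ _ → 0ᴹ
  ; -ᴹ_ = λ f i → -ᴹ f i
  ; isLeftModule = record
    { isLeftSemimodule = record
      { +ᴹ-isCommutativeMonoid = record
        { isMonoid = record
          { isSemigroup = record
            { isMagma = record
              { isEquivalence = record
                { refl = λ _ → ≈ᴹ-refl
                ; sym = λ p i → ≈ᴹ-sym (p i)
                ; trans = λ p q i → ≈ᴹ-trans (p i) (q i)
                }
              ; ∙-cong = λ p q i → +ᴹ-cong (p i) (q i)
              }
            ; assoc = λ f g h i → +ᴹ-assoc (f i) (g i) (h i)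
            }
          ; identity = (λ f i → +ᴹ-identityˡ (f i)) , (λ f i → +ᴹ-identityʳ (f i))
          }
        ; comm = λ f g i → +ᴹ-comm (f i) (g i)
        }
      ; isPreleftSemimodule = record
        { *ₗ-cong = λ k≈l p i → *ₗ-cong k≈l (p i)
        ; *ₗ-zeroˡ = λ f i → *ₗ-zeroˡ (f i)
        ; *ₗ-distribʳ = λ f k l i → *ₗ-distribʳ (f i) k l
        ; *ₗ-identityˡ = λ f i → *ₗ-identityˡ (f i)
        ; *ₗ-assoc = λ k l f i → *ₗ-assoc k l (f i)
        ; *ₗ-zeroʳ = λ k i → *ₗ-zeroʳ k
        ; *ₗ-distribˡ = λ k f g i → *ₗ-distribˡ k (f i) (g i)
        }
      }
    ; -ᴹ‿cong = λ p i → -ᴹ‿cong (p i)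
    ; -ᴹ‿inverse = (λ f i → -ᴹ‿inverseˡ (f i)) , (λ f i → -ᴹ‿inverseʳ (f i))
    }
  }
  where open LeftModule X

·-congʳ : (M : ℂGModule) → let open ℂGModule M in ∀ g {x y} → x ≈ᴹ y → g · x ≈ᴹ g · y
·-congʳ M g = ℂGModule.·-cong M {g} {g} (G.refl {g})

module _ (M N : ℂGModule) where
  private
    module M = ℂGModule M
    module N = ℂGModule N

  -- The matrices with which `φ` commutes meet the conditions of `Generation`.
  equivariant : (φ : M.Carrierᴹ → N.Carrierᴹ) → (∀ {x y} → x M.≈ᴹ y → φ x N.≈ᴹ φ y) →
                (∀ x → φ (S M.· x) N.≈ᴹ S N.· φ x) → (∀ x → φ (U M.· x) N.≈ᴹ U N.· φ x) →
                ∀ g x → φ (g M.· x) N.≈ᴹ g N.· φ x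
  equivariant φ φ-cong φ-S φ-U = Generation.generated
    (λ g → ∀ x → φ (g M.· x) N.≈ᴹ g N.· φ x)
    (λ {g} {h} g≈h p x → N.≈ᴹ-trans (φ-cong (M.·-cong {h} {g} (G.sym {g} {h} g≈h) M.≈ᴹ-refl))
                   (N.≈ᴹ-trans (p x) (N.·-cong {g} {h} g≈h N.≈ᴹ-refl)))
    (λ {g} → step S g φ-S) (λ {g} → step U g φ-U)
    (λ x → N.≈ᴹ-trans (φ-cong (M.ε-· x)) (N.≈ᴹ-sym (N.ε-· (φ x))))
    where
    step : ∀ h g → (∀ x → φ (h M.· x) N.≈ᴹ h N.· φ x) → (∀ x → φ (g M.· x) N.≈ᴹ g N.· φ x) →
           ∀ x → φ ((h G.∙ g) M.· x) N.≈ᴹ (h G.∙ g) N.· φ x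
    step h g φ-h φ-g x = begin
      φ ((h G.∙ g) M.· x)    ≈⟨ φ-cong (M.∙-· h g x) ⟩
      φ (h M.· (g M.· x))    ≈⟨ φ-h (g M.· x) ⟩
      h N.· φ (g M.· x)      ≈⟨ ·-congʳ N h (φ-g x) ⟩
      h N.· (g N.· φ x)      ≈⟨ N.∙-· h g (φ x) ⟨
      (h G.∙ g) N.· φ x      ∎
      where open SetoidReasoning N.≈ᴹ-setoid

  module _ {φ : M.Carrierᴹ → N.Carrierᴹ} where
    open AbelianGroupProperties N.+ᴹ-abelianGroup using (inverseʳ-unique; identityʳ-unique)

    mk≅ : (∀ {x y} → x M.≈ᴹ y → φ x N.≈ᴹ φ y) → (∀ x y → φ (x M.+ᴹ y) N.≈ᴹ φ x N.+ᴹ φ y) →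
          (∀ k x → φ (k M.*ₗ x) N.≈ᴹ k N.*ₗ φ x) → (∀ {x y} → φ x N.≈ᴹ φ y → x M.≈ᴹ y) →
          (∀ y → ∃ λ x → φ x N.≈ᴹ y) →
          (∀ x → φ (S M.· x) N.≈ᴹ S N.· φ x) → (∀ x → φ (U M.· x) N.≈ᴹ U N.· φ x) → M ≅ N
    mk≅ φ-cong φ-+ φ-* injective surjective φ-S φ-U = record
      { to = φ
      ; isLeftModuleIsomorphism = record
        { isLeftModuleMonomorphism = record
          { isLeftModuleHomomorphism = record
            { +ᴹ-isGroupHomomorphism = record
              { isMonoidHomomorphism = record
                { isMagmaHomomorphism = record
                  { isRelHomomorphism = record { cong = φ-cong }
                  ; homo = φ-+
                  }
                ; ε-homo = φ-0
                }
              ; ⁻¹-homo = λ x → inverseʳ-unique (φ x) (φ (M.-ᴹ x))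
                  (N.≈ᴹ-trans (N.≈ᴹ-sym (φ-+ x (M.-ᴹ x)))
                    (N.≈ᴹ-trans (φ-cong (M.-ᴹ‿inverseʳ x)) φ-0))
              }
            ; *ₗ-homo = φ-*
            }
          ; injective = injective
          }
        ; surjective = λ y → let (x , φx≈y) = surjective y in
            x , λ z≈x → N.≈ᴹ-trans (φ-cong z≈x) φx≈y
        }
      ; ·-homo = equivariant φ φ-cong φ-S φ-U
      }
      where
      φ-0 : φ M.0ᴹ N.≈ᴹ N.0ᴹ
      φ-0 = identityʳ-unique (φ M.0ᴹ) (φ M.0ᴹ)
        (N.≈ᴹ-trans (N.≈ᴹ-sym (φ-+ M.0ᴹ M.0ᴹ)) (φ-cong (M.+ᴹ-identityˡ M.0ᴹ)))

U≈ST : U ≈G S G.∙ T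
U≈ST = record { a≡ = refl ; b≡ = refl ; c≡ = refl ; d≡ = refl }

module TAction (M : ℂGModule) where
  open ℂGModule M

  factor-· : ∀ f g h → f ≈G g G.∙ h → ∀ x → f · x ≈ᴹ g · h · x
  factor-· f g h f≈gh x = ≈ᴹ-trans (·-cong {f} {g G.∙ h} f≈gh ≈ᴹ-refl) (∙-· g h x)

  U-·≈S-T-· : ∀ x → U · x ≈ᴹ S · T · x
  U-·≈S-T-· = factor-· U S T U≈ST

  T-1 : Carrierᴹ → Carrierᴹ
  T-1 x = T · x -ᴹ x

  -- `fold` adds new applications on the outside, whereas the inductions below peel off the first
  -- one.
  fold-T-1 : ∀ n x → fold (T-1 x) T-1 n ≡ T-1 (fold x T-1 n)
  fold-T-1 zero    x = refl
  fold-T-1 (suc n) x = cong T-1 (fold-T-1 n x)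

  fold-suc⇒fold : ∀ n x → fold x T-1 (suc n) ≈ᴹ 0ᴹ → fold (T-1 x) T-1 n ≈ᴹ 0ᴹ
  fold-suc⇒fold n x = subst (_≈ᴹ 0ᴹ) (≡.sym (fold-T-1 n x))

  fold⇒fold-suc : ∀ n x → fold (T-1 x) T-1 n ≈ᴹ 0ᴹ → fold x T-1 (suc n) ≈ᴹ 0ᴹ
  fold⇒fold-suc n x = subst (_≈ᴹ 0ᴹ) (fold-T-1 n x)

-- Linear identities for the operators of the model

module Identities (X : LeftModule ℂ-Ring.ring 0ℓ 0ℓ) where
  open LeftModule X renaming (_+ᴹ_ to _+_; -ᴹ_ to -_; _≈ᴹ_ to _≈_)
  open LinearSolver X

  υ²-first : ∀ x₀ x₁ x₂ x₃ y₀ y₁ y₂ y₃ y₄ →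
    - (x₀ + y₀ + - y₁) + ((- y₁ + (x₂ + y₂ + - y₃)) + (x₁ + y₁ + - y₂) + - (x₂ + y₂ + - y₃))
    ≈ (- y₀ + (x₁ + y₁ + - y₂)) + - x₀
  υ²-first x₀ x₁ x₂ x₃ y₀ y₁ y₂ y₃ y₄ =
    linear [] (x₀ ∷ x₁ ∷ x₂ ∷ x₃ ∷ y₀ ∷ y₁ ∷ y₂ ∷ y₃ ∷ y₄ ∷ [])
      (λ x₀ x₁ x₂ x₃ y₀ y₁ y₂ y₃ y₄ →
        ⊝ (x₀ ⊕ y₀ ⊕ ⊝ y₁)
          ⊕ ((⊝ y₁ ⊕ (x₂ ⊕ y₂ ⊕ ⊝ y₃)) ⊕ (x₁ ⊕ y₁ ⊕ ⊝ y₂) ⊕ ⊝ (x₂ ⊕ y₂ ⊕ ⊝ y₃))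
        ⊜ (⊝ y₀ ⊕ (x₁ ⊕ y₁ ⊕ ⊝ y₂)) ⊕ ⊝ x₀) refl

  υ²-second : ∀ x₀ x₁ y₀ y₁ y₂ y₃ →
    (- y₀ + (x₁ + y₁ + - y₂)) + (x₀ + y₀ + - y₁) + - (x₁ + y₁ + - y₂) ≈ (x₀ + y₀ + - y₁) + - y₀
  υ²-second x₀ x₁ y₀ y₁ y₂ y₃ =
    linear [] (x₀ ∷ x₁ ∷ y₀ ∷ y₁ ∷ y₂ ∷ y₃ ∷ []) (λ x₀ x₁ y₀ y₁ y₂ y₃ →
      (⊝ y₀ ⊕ (x₁ ⊕ y₁ ⊕ ⊝ y₂)) ⊕ (x₀ ⊕ y₀ ⊕ ⊝ y₁) ⊕ ⊝ (x₁ ⊕ y₁ ⊕ ⊝ y₂)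
      ⊜ (x₀ ⊕ y₀ ⊕ ⊝ y₁) ⊕ ⊝ y₀) refl

  υ-homo-+-first : ∀ x′ y y′ y″ z′ w w′ w″ →
    - (y + w) + ((x′ + z′) + (y′ + w′) + - (y″ + w″))
    ≈ (- y + (x′ + y′ + - y″)) + (- w + (z′ + w′ + - w″))
  υ-homo-+-first x′ y y′ y″ z′ w w′ w″ =
    linear [] (x′ ∷ y ∷ y′ ∷ y″ ∷ z′ ∷ w ∷ w′ ∷ w″ ∷ []) (λ x′ y y′ y″ z′ w w′ w″ →
      ⊝ (y ⊕ w) ⊕ ((x′ ⊕ z′) ⊕ (y′ ⊕ w′) ⊕ ⊝ (y″ ⊕ w″))
      ⊜ (⊝ y ⊕ (x′ ⊕ y′ ⊕ ⊝ y″)) ⊕ (⊝ w ⊕ (z′ ⊕ w′ ⊕ ⊝ w″))) refl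

  υ-homo-+-second : ∀ x y y′ z w w′ →
    (x + z) + (y + w) + - (y′ + w′) ≈ (x + y + - y′) + (z + w + - w′)
  υ-homo-+-second x y y′ z w w′ =
    linear [] (x ∷ y ∷ y′ ∷ z ∷ w ∷ w′ ∷ []) (λ x y y′ z w w′ →
      (x ⊕ z) ⊕ (y ⊕ w) ⊕ ⊝ (y′ ⊕ w′) ⊜ (x ⊕ y ⊕ ⊝ y′) ⊕ (z ⊕ w ⊕ ⊝ w′)) refl

  υ-homo-*-first : ∀ k x′ y y′ y″ →
    - (k *ₗ y) + (k *ₗ x′ + k *ₗ y′ + - (k *ₗ y″)) ≈ k *ₗ (- y + (x′ + y′ + - y″))
  υ-homo-*-first k x′ y y′ y″ =
    linear (k ∷ []) (x′ ∷ y ∷ y′ ∷ y″ ∷ []) (λ k x′ y y′ y″ →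
      ⊝ (k ⊛ y) ⊕ (k ⊛ x′ ⊕ k ⊛ y′ ⊕ ⊝ (k ⊛ y″)) ⊜ k ⊛ (⊝ y ⊕ (x′ ⊕ y′ ⊕ ⊝ y″))) refl

  υ-homo-*-second : ∀ k x y y′ → k *ₗ x + k *ₗ y + - (k *ₗ y′) ≈ k *ₗ (x + y + - y′)
  υ-homo-*-second k x y y′ =
    linear (k ∷ []) (x ∷ y ∷ y′ ∷ []) (λ k x y y′ →
      k ⊛ x ⊕ k ⊛ y ⊕ ⊝ (k ⊛ y′) ⊜ k ⊛ (x ⊕ y ⊕ ⊝ y′)) refl

  neg-homo-+ : ∀ x y → - (x + y) ≈ - x + - y
  neg-homo-+ x y = linear [] (x ∷ y ∷ []) (λ x y → ⊝ (x ⊕ y) ⊜ ⊝ x ⊕ ⊝ y) refl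

  neg-homo-* : ∀ k x → - (k *ₗ x) ≈ k *ₗ - x
  neg-homo-* k x = linear (k ∷ []) (x ∷ []) (λ k x → ⊝ (k ⊛ x) ⊜ k ⊛ (⊝ x)) refl

  neg-involutive : ∀ x → - (- x) ≈ x
  neg-involutive x = linear [] (x ∷ []) (λ x → ⊝ ⊝ x ⊜ x) refl

  [x-y]-x≈-y : ∀ x y → x + - y + - x ≈ - y
  [x-y]-x≈-y x y = linear [] (x ∷ y ∷ []) (λ x y → x ⊕ ⊝ y ⊕ ⊝ x ⊜ ⊝ y) refl

  S-row₁ : ∀ x y → fromℤℂ 0ℤ *ₗ x + fromℤℂ ℤ.-1ℤ *ₗ y ≈ - y
  S-row₁ x y = linear [] (x ∷ y ∷ []) (λ x y →
    ℂSolver.con 0ℤ ⊛ x ⊕ ℂSolver.con ℤ.-1ℤ ⊛ y ⊜ ⊝ y) refl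

  S-row₂ : ∀ x y → fromℤℂ 1ℤ *ₗ x + fromℤℂ 0ℤ *ₗ y ≈ x
  S-row₂ x y = linear [] (x ∷ y ∷ []) (λ x y →
    ℂSolver.con 1ℤ ⊛ x ⊕ ℂSolver.con 0ℤ ⊛ y ⊜ x) refl

  U-row₂ : ∀ x y → fromℤℂ 1ℤ *ₗ x + fromℤℂ 1ℤ *ₗ y ≈ x + y
  U-row₂ x y = linear [] (x ∷ y ∷ []) (λ x y →
    ℂSolver.con 1ℤ ⊛ x ⊕ ℂSolver.con 1ℤ ⊛ y ⊜ x ⊕ y) refl

  υ-zero-first : - 0ᴹ + (0ᴹ + 0ᴹ + - 0ᴹ) ≈ 0ᴹ
  υ-zero-first = linear [] [] (⊝ 𝟎 ⊕ (𝟎 ⊕ 𝟎 ⊕ ⊝ 𝟎) ⊜ 𝟎) refl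

  υ-zero-second : 0ᴹ + 0ᴹ + - 0ᴹ ≈ 0ᴹ
  υ-zero-second = linear [] [] (𝟎 ⊕ 𝟎 ⊕ ⊝ 𝟎 ⊜ 𝟎) refl

  υ-top-first : ∀ y → - y + (0ᴹ + 0ᴹ + - 0ᴹ) ≈ - y
  υ-top-first y = linear [] (y ∷ []) (λ y → ⊝ y ⊕ (𝟎 ⊕ 𝟎 ⊕ ⊝ 𝟎) ⊜ ⊝ y) refl

  υ-top-second : ∀ x y → x + y + - 0ᴹ ≈ x + y
  υ-top-second x y = linear [] (x ∷ y ∷ []) (λ x y → x ⊕ y ⊕ ⊝ 𝟎 ⊜ x ⊕ y) refl

  T-1-first : ∀ x y y′ → (x + y + - y′) + - x ≈ y + - y′
  T-1-first x y y′ = linear [] (x ∷ y ∷ y′ ∷ []) (λ x y y′ →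
    (x ⊕ y ⊕ ⊝ y′) ⊕ ⊝ x ⊜ y ⊕ ⊝ y′) refl

  T-1-second : ∀ x′ y y′ y″ → - (- y + (x′ + y′ + - y″)) + - y ≈ y″ + - (x′ + y′)
  T-1-second x′ y y′ y″ = linear [] (x′ ∷ y ∷ y′ ∷ y″ ∷ []) (λ x′ y y′ y″ →
    ⊝ (⊝ y ⊕ (x′ ⊕ y′ ⊕ ⊝ y″)) ⊕ ⊝ y ⊜ y″ ⊕ ⊝ (x′ ⊕ y′)) refl

module Model where
  open Identities TensorUnit.leftModule

  open ℂ-Ring using (_+_; -_; +-cong; -‿cong)

  Sequence : Set
  Sequence = ℕ → ℂ × ℂ

  module Seq = LeftModule (pointwise ℕ ℂV.space)

  σ₀ : ℂ × ℂ → ℂ × ℂ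
  σ₀ (x , y) = - y , x

  υ₀ : ℂ × ℂ → ℂ × ℂ → ℂ × ℂ → ℂ × ℂ
  υ₀ (x , y) (x′ , y′) (x″ , y″) = - y + (x′ + y′ + - y″) , x + y + - y′

  -- With N the left shift, which acts locally nilpotently on finitely supported
  -- sequences, S = (0 -1 ; 1 0) and U = S + (N  N - N² ; 0  1 - N).
  -- For N = 0 this is V, and T + T⁻¹ = 2 + N² - N.
  σ υ : Sequence → Sequence
  σ h k = σ₀ (h k)
  υ h k = υ₀ (h k) (h (suc k)) (h (suc (suc k)))

  -- This is U² = U - 1; it yields U³ = U² - U = -1 = S², the relation that the amalgam asks for.
  υ²≈υ- : ∀ h → υ (υ h) Seq.≈ᴹ υ h Seq.+ᴹ (Seq.-ᴹ h)
  υ²≈υ- h k = let (x₀ , y₀) = h k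
                  (x₁ , y₁) = h (suc k)
                  (x₂ , y₂) = h (suc (suc k))
                  (x₃ , y₃) = h (suc (suc (suc k)))
                  (x₄ , y₄) = h (suc (suc (suc (suc k))))
    in υ²-first x₀ x₁ x₂ x₃ y₀ y₁ y₂ y₃ y₄ , υ²-second x₀ x₁ y₀ y₁ y₂ y₃

  σ-cong : ∀ {h h′} → h Seq.≈ᴹ h′ → σ h Seq.≈ᴹ σ h′
  σ-cong p k = ℂ-Ring.-‿cong (proj₂ (p k)) , proj₁ (p k)

  υ₀-cong : ∀ {v v′ v″ w w′ w″} → v ℂV.≈ᴹ w → v′ ℂV.≈ᴹ w′ → v″ ℂV.≈ᴹ w″ →
            υ₀ v v′ v″ ℂV.≈ᴹ υ₀ w w′ w″
  υ₀-cong (p , q) (p′ , q′) (p″ , q″) =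
      +-cong (-‿cong q) (+-cong (+-cong p′ q′) (-‿cong q″))
    , +-cong (+-cong p q) (-‿cong q′)

  υ-cong : ∀ {h h′} → h Seq.≈ᴹ h′ → υ h Seq.≈ᴹ υ h′
  υ-cong p k = υ₀-cong (p k) (p (suc k)) (p (suc (suc k)))

  amalgam : Amalgam Seq.≈ᴹ-setoid
  amalgam = record
    { σ = σ
    ; υ = υ
    ; σ-cong = σ-cong
    ; υ-cong = υ-cong
    ; σ⁴≈id = λ h k → neg-involutive _ , neg-involutive _
    ; υ³≈σ² = λ h → Seq.≈ᴹ-trans (υ²≈υ- (υ h)) (Seq.≈ᴹ-trans (Seq.+ᴹ-congʳ (υ²≈υ- h))
        (Identities.[x-y]-x≈-y (pointwise ℕ ℂV.space) (υ h) h))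
    }

  linearAmalgam : LinearAmalgam (pointwise ℕ ℂV.space)
  linearAmalgam = record
    { amalgam = amalgam
    ; σ-homo-+ = λ h h′ k → neg-homo-+ _ _ , ℂ-Ring.refl
    ; σ-homo-* = λ c h k → neg-homo-* _ _ , ℂ-Ring.refl
    ; υ-homo-+ = λ h h′ k →
          υ-homo-+-first (proj₁ (h (suc k))) (proj₂ (h k)) (proj₂ (h (suc k)))
            (proj₂ (h (suc (suc k)))) _ _ _ _
        , υ-homo-+-second (proj₁ (h k)) (proj₂ (h k)) (proj₂ (h (suc k))) _ _ _
    ; υ-homo-* = λ c h k →
          υ-homo-*-first c (proj₁ (h (suc k))) (proj₂ (h k)) (proj₂ (h (suc k)))
            (proj₂ (h (suc (suc k))))
        , υ-homo-*-second c (proj₁ (h k)) (proj₂ (h k)) (proj₂ (h (suc k)))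
    }

  -- The action is built on all sequences, where no supports have to be tracked; the finitely
  -- supported ones are then a submodule and inherit all laws.
  module All = FromAmalgam (pointwise ℕ ℂV.space) linearAmalgam

  open Run amalgam using (run)

  VanishesFrom : ℕ → Sequence → Set
  VanishesFrom n h = ∀ k → n ℕ.≤ k → h k ℂV.≈ᴹ ℂV.0ᴹ

  vanishes-weaken : ∀ {m n h} → m ℕ.≤ n → VanishesFrom m h → VanishesFrom n h
  vanishes-weaken m≤n p k n≤k = p k (ℕ.≤-trans m≤n n≤k)

  -- Entry k of the result depends only on entries k, k + 1 and k + 2, so a bound on the support is
  -- preserved.
  vanishes-run : ∀ {n} w {h} → VanishesFrom n h → VanishesFrom n (run w h)
  vanishes-run []      p = p
  vanishes-run (s ∷ w) p k n≤k =
    let (x≈0 , y≈0) = vanishes-run w p k n≤k in ℂ-Ring.trans (-‿cong y≈0) (neg-zero) , x≈0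
    where
    neg-zero = LinearSolver.linear TensorUnit.leftModule [] [] (⊝ 𝟎 ⊜ 𝟎) refl
  vanishes-run (u ∷ w) {h} p k n≤k = ℂV.≈ᴹ-trans
    (υ₀-cong (q k n≤k) (q (suc k) (ℕ.m≤n⇒m≤1+n n≤k)) (q (suc (suc k)) (ℕ.m≤n⇒m≤1+n (ℕ.m≤n⇒m≤1+n n≤k))))
    (υ-zero-first , υ-zero-second)
    where q = vanishes-run w p

  vanishes-+ : ∀ {n h h′} → VanishesFrom n h → VanishesFrom n h′ → VanishesFrom n (h Seq.+ᴹ h′)
  vanishes-+ p q k n≤k = ℂV.≈ᴹ-trans (ℂV.+ᴹ-cong (p k n≤k) (q k n≤k)) (ℂV.+ᴹ-identityˡ ℂV.0ᴹ)

  vanishes-* : ∀ {n h} c → VanishesFrom n h → VanishesFrom n (c Seq.*ₗ h)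
  vanishes-* c p k n≤k = ℂV.≈ᴹ-trans (ℂV.*ₗ-congˡ (p k n≤k)) (ℂV.*ₗ-zeroʳ c)

  truncated : ℕ → Submodule All.ℂG-module
  truncated n = record
    { subspace = record
      { member = VanishesFrom n
      ; ≈-closed = λ h≈h′ p k n≤k → ℂV.≈ᴹ-trans (ℂV.≈ᴹ-sym (h≈h′ k)) (p k n≤k)
      ; 0-closed = λ _ _ → ℂV.≈ᴹ-refl
      ; +-closed = vanishes-+
      ; *-closed = λ c → vanishes-* c
      }
    ; ·-closed = λ g → vanishes-run (All.word g)
    }

  finitelySupported : Submodule All.ℂG-module
  finitelySupported = record
    { subspace = record
      { member = λ h → ∃ λ n → VanishesFrom n h
      ; ≈-closed = λ h≈h′ (n , p) → n , Subspace.≈-closed (subspace (truncated n)) h≈h′ p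
      ; 0-closed = 0 , λ _ _ → ℂV.≈ᴹ-refl
      ; +-closed = λ (m , p) (n , q) → m ℕ.⊔ n ,
          vanishes-+ (vanishes-weaken (ℕ.m≤m⊔n m n) p) (vanishes-weaken (ℕ.m≤n⊔m m n) q)
      ; *-closed = λ c (n , p) → n , vanishes-* c p
      }
    ; ·-closed = λ g (n , p) → n , vanishes-run (All.word g) p
    }

  M∞ : ℂGModule
  M∞ = toModule finitelySupported

  open ℂGModule M∞

  layer : ℕ → Submodule M∞
  layer n = truncated n within finitelySupported

  single : ℕ → ℂ × ℂ → Sequence
  single zero    v zero    = v
  single zero    v (suc _) = ℂV.0ᴹ
  single (suc n) v zero    = ℂV.0ᴹ
  single (suc n) v (suc k) = single n v k

  single-vanishes : ∀ n v → VanishesFrom (suc n) (single n v)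
  single-vanishes zero    v (suc k) _           = ℂV.≈ᴹ-refl
  single-vanishes (suc n) v (suc k) (ℕ.s≤s n<k) = single-vanishes n v k n<k

  single-diagonal : ∀ n v → single n v n ≡ v
  single-diagonal zero    v = refl
  single-diagonal (suc n) v = single-diagonal n v

  V-S : ∀ v → S ℂV.· v ℂV.≈ᴹ σ₀ v
  V-S (x , y) = S-row₁ x y , S-row₂ x y

  V-U : ∀ ((x , y) : ℂ × ℂ) → U ℂV.· (x , y) ℂV.≈ᴹ (- y , x + y)
  V-U (x , y) = S-row₁ x y , U-row₂ x y

  -- The class of a sequence in layer n + 1 is its entry n. All later entries vanish there, so `υ₀`
  -- loses its shift terms and becomes U on V.
  factor : ∀ n → (toModule (layer (suc n)) / (layer n within layer (suc n))) ≅ V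
  factor n = mk≅ (toModule (layer (suc n)) / (layer n within layer (suc n))) V
    {λ ((h , _) , _) → h n}
    (λ p → x∙y⁻¹≈ε⇒x≈y _ _ (p n ℕ.≤-refl))
    (λ _ _ → ℂV.≈ᴹ-refl)
    (λ _ _ → ℂV.≈ᴹ-refl)
    (λ { {_ , p} {_ , q} hn≈h′n k n≤k → x≈y⇒x∙y⁻¹≈ε (agree p q hn≈h′n n≤k (ℕ.m≤n⇒m<n∨m≡n n≤k)) })
    (λ v → ((single n v , suc n , single-vanishes n v) , single-vanishes n v) , ℂV.≈ᴹ-reflexive (single-diagonal n v))
    (λ ((h , _) , _) → ℂV.≈ᴹ-trans (All.S-· h n) (ℂV.≈ᴹ-sym (V-S (h n))))
    (λ ((h , _) , p) → ℂV.≈ᴹ-trans (All.U-· h n) (ℂV.≈ᴹ-trans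
      (υ₀-cong (ℂV.≈ᴹ-refl {h n}) (p (suc n) ℕ.≤-refl) (p (suc (suc n)) (ℕ.n≤1+n _)))
      (ℂV.≈ᴹ-trans (υ-top-first _ , υ-top-second _ _) (ℂV.≈ᴹ-sym (V-U (h n))))))
    where
    open AbelianGroupProperties ℂV.+ᴹ-abelianGroup using (x∙y⁻¹≈ε⇒x≈y; x≈y⇒x∙y⁻¹≈ε)
    agree : ∀ {h h′ : Sequence} {k} → VanishesFrom (suc n) h → VanishesFrom (suc n) h′ →
            h n ℂV.≈ᴹ h′ n → n ℕ.≤ k → n ℕ.< k ⊎ n ≡ k → h k ℂV.≈ᴹ h′ k
    agree p q hn≈h′n n≤k (inj₁ n<k)  = ℂV.≈ᴹ-trans (p _ n<k) (ℂV.≈ᴹ-sym (q _ n<k))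
    agree p q hn≈h′n n≤k (inj₂ refl) = hn≈h′n

  filtration : VFiltration M∞
  filtration = record
    { layer = layer
    ; zeroth = λ _ p k → p k ℕ.z≤n
    ; ascending = λ n p → vanishes-weaken (ℕ.n≤1+n n) p
    ; exhaustive = λ (_ , n , p) → n , p
    ; factor≅V = factor
    }

  open TAction M∞

  seq∞ : Carrierᴹ → Sequence
  seq∞ = proj₁

  -- T is not one of the defining operators; since S(Tx) = Ux, its coordinates come from undoing `σ`
  -- on Ux. In block form, T - 1 = (0, 1 - N ; -N, N² - N).
  T-1-seq : ∀ x k → let h = seq∞ x in
    seq∞ (T-1 x) k ℂV.≈ᴹ (proj₂ (h k) + - proj₂ (h (suc k))
                        , proj₂ (h (suc (suc k))) + - (proj₁ (h (suc k)) + proj₂ (h (suc k))))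
  T-1-seq x k =
      ℂ-Ring.trans (+-cong (proj₂ σt≈υh) ℂ-Ring.refl) (T-1-first _ _ _)
    , ℂ-Ring.trans (+-cong (ℂ-Ring.trans (ℂ-Ring.sym (neg-involutive _)) (-‿cong (proj₁ σt≈υh))) ℂ-Ring.refl)
        (T-1-second (proj₁ (seq∞ x (suc k))) (proj₂ (seq∞ x k)) (proj₂ (seq∞ x (suc k))) _)
    where
    σt≈υh : σ (seq∞ (T · x)) k ℂV.≈ᴹ υ (seq∞ x) k
    σt≈υh = ℂV.≈ᴹ-trans (ℂV.≈ᴹ-sym (All.S-· (seq∞ (T · x)) k))
              (ℂV.≈ᴹ-trans (ℂV.≈ᴹ-sym (U-·≈S-T-· x k)) (All.U-· (seq∞ x) k))

-- A criterion for T-indecomposability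

module _ (em : ExcludedMiddle 0ℓ) (M : ℂGModule) where
  open ℂGModule M
  open TAction M

  -- Among the iterates of T - 1 on x, the last nonzero one is T-fixed, and invariance keeps it in
  -- `W`.
  fixed-in : ∀ (W : Subspace M) → TInvariant M W → ∀ n x → x ∈ member W → ¬ x ≈ᴹ 0ᴹ → fold x T-1 n ≈ᴹ 0ᴹ →
             ∃ λ y → y ∈ member W × (¬ y ≈ᴹ 0ᴹ) × T-1 y ≈ᴹ 0ᴹ
  fixed-in W inv zero    x x∈W x≉0 x≈0 = contradiction x≈0 x≉0
  fixed-in W inv (suc n) x x∈W x≉0 eq with em {T-1 x ≈ᴹ 0ᴹ}
  ... | yes Dx≈0 = x , x∈W , x≉0 , Dx≈0
  ... | no Dx≉0  = fixed-in W inv n (T-1 x)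
    (+-closed (inv x∈W) (≈-closed (≈ᴹ-sym -x≈-1*x) (*-closed (fromℤℂ ℤ.-1ℤ) x∈W)))
    Dx≉0 (fold-suc⇒fold n x eq)
    where
    open Subspace W
    -x≈-1*x : -ᴹ x ≈ᴹ fromℤℂ ℤ.-1ℤ *ₗ x
    -x≈-1*x = LinearSolver.linear space [] (x ∷ []) (λ x → ⊝ x ⊜ ℂSolver.con ℤ.-1ℤ ⊛ x) refl

  zero? : ∀ (W : Subspace M) → IsZero M W ⊎ ∃ λ x → x ∈ member W × ¬ x ≈ᴹ 0ᴹ
  zero? W with em {∃ λ x → x ∈ member W × ¬ x ≈ᴹ 0ᴹ}
  ... | yes nonzero = inj₂ nonzero
  ... | no ¬nonzero = inj₁ λ x x∈W → decidable-stable em λ x≉0 → ¬nonzero (x , x∈W , x≉0)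

  multiple∈⇒∈ : ∀ (W : Subspace M) {c} x y → ¬ y ≈ᴹ 0ᴹ → y ≈ᴹ c *ₗ x → y ∈ member W → x ∈ member W
  multiple∈⇒∈ W {c} x y y≉0 y≈cx y∈W =
    let (c⁻¹ , cc⁻¹≈1) = Field.inverse em c λ c≈0 →
          y≉0 (≈ᴹ-trans y≈cx (≈ᴹ-trans (*ₗ-congʳ c≈0) (*ₗ-zeroˡ x)))
    in ≈-closed (begin
         c⁻¹ *ₗ y                   ≈⟨ *ₗ-congˡ y≈cx ⟩
         c⁻¹ *ₗ (c *ₗ x)            ≈⟨ *ₗ-assoc c⁻¹ c x ⟨
         (c⁻¹ ℂ-Ring.* c) *ₗ x      ≈⟨ *ₗ-congʳ (ℂ-Ring.trans (ℂ-Ring.*-comm c⁻¹ c) cc⁻¹≈1) ⟩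
         ℂ-Ring.1# *ₗ x             ≈⟨ *ₗ-identityˡ x ⟩
         x                          ∎) (*-closed c⁻¹ y∈W)
    where
    open Subspace W
    open SetoidReasoning ≈ᴹ-setoid

  common-vector⇒TIndecomposable : ∀ e → ¬ e ≈ᴹ 0ᴹ → (∀ x → ∃ λ n → fold x T-1 n ≈ᴹ 0ᴹ) →
    (∀ W → TInvariant M W → ∀ x → x ∈ member W → ¬ x ≈ᴹ 0ᴹ → e ∈ member W) → TIndecomposable M
  common-vector⇒TIndecomposable e e≉0 nilpotent e∈ W _ = indecomposable , λ x _ → nilpotent x
    where
    indecomposable : ActsIndecomposably M W
    indecomposable A B invA invB W=A⊕B with zero? A | zero? B
    ... | inj₁ A≈0 | _ = inj₁ A≈0
    ... | inj₂ _ | inj₁ B≈0 = inj₂ B≈0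
    ... | inj₂ (x , x∈A , x≉0) | inj₂ (y , y∈B , y≉0) = contradiction
      (IsDirectSum.A∩B≈0 W=A⊕B e (e∈ A invA x x∈A x≉0) (e∈ B invB y y∈B y≉0)) e≉0

-- T-indecomposability of the model

module ModelIndecomposable where
  open Model
  open ℂGModule M∞
  open TAction M∞
  open Identities TensorUnit.leftModule
  open ℂ-Ring using (_+_; -_; 0#; 1#; _≈_; +-cong; -‿cong)

  -- The two components get separate bounds because T - 1 lowers them alternately: (n + 1, n + 1),
  -- (n + 1, n), (n, n). The corresponding spaces form a flag whose dimension drops by one each
  -- time, as for a Jordan block.
  record Support (m n : ℕ) (h : Sequence) : Set where
    constructor support
    field
      first  : ∀ k → m ℕ.≤ k → proj₁ (h k) ≈ 0#
      second : ∀ k → n ℕ.≤ k → proj₂ (h k) ≈ 0#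

  x-y≈0 : ∀ {x y} → x ≈ 0# → y ≈ 0# → x + - y ≈ 0#
  x-y≈0 x≈0 y≈0 = ℂ-Ring.trans (+-cong x≈0 (-‿cong y≈0)) (ℂ-Ring.-‿inverseʳ 0#)

  T-1-lowers-second : ∀ n x → Support (suc n) (suc n) (seq∞ x) → Support (suc n) n (seq∞ (T-1 x))
  T-1-lowers-second n x (support p q) = support
    (λ k n<k → ℂ-Ring.trans (proj₁ (T-1-seq x k)) (x-y≈0 (q k n<k) (q (suc k) (ℕ.m≤n⇒m≤1+n n<k))))
    (λ k n≤k → ℂ-Ring.trans (proj₂ (T-1-seq x k)) (x-y≈0 (q (suc (suc k)) (ℕ.s≤s (ℕ.m≤n⇒m≤1+n n≤k)))
      (ℂ-Ring.trans (+-cong (p (suc k) (ℕ.s≤s n≤k)) (q (suc k) (ℕ.s≤s n≤k))) (ℂ-Ring.+-identityˡ 0#))))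

  T-1-lowers-first : ∀ n x → Support (suc n) n (seq∞ x) → Support n n (seq∞ (T-1 x))
  T-1-lowers-first n x (support p q) = support
    (λ k n≤k → ℂ-Ring.trans (proj₁ (T-1-seq x k)) (x-y≈0 (q k n≤k) (q (suc k) (ℕ.m≤n⇒m≤1+n n≤k))))
    (λ k n≤k → ℂ-Ring.trans (proj₂ (T-1-seq x k)) (x-y≈0 (q (suc (suc k)) (ℕ.m≤n⇒m≤1+n (ℕ.m≤n⇒m≤1+n n≤k)))
      (ℂ-Ring.trans (+-cong (p (suc k) (ℕ.s≤s n≤k)) (q (suc k) (ℕ.m≤n⇒m≤1+n n≤k))) (ℂ-Ring.+-identityˡ 0#))))

  T-1-nilpotent : ∀ n x → Support n n (seq∞ x) → ∃ λ k → fold x T-1 k ≈ᴹ 0ᴹ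
  T-1-nilpotent zero    x (support p q) = 0 , λ k → p k ℕ.z≤n , q k ℕ.z≤n
  T-1-nilpotent (suc n) x p =
    let (k , eq) = T-1-nilpotent n (T-1 (T-1 x)) (T-1-lowers-first n (T-1 x) (T-1-lowers-second n x p))
    in suc (suc k) , fold⇒fold-suc (suc k) x (fold⇒fold-suc k (T-1 x) eq)

  T-1-locallyNilpotent : ∀ x → ∃ λ k → fold x T-1 k ≈ᴹ 0ᴹ
  T-1-locallyNilpotent x@(h , n , p) =
    T-1-nilpotent n x (support (λ k n≤k → proj₁ (p k n≤k)) (λ k n≤k → proj₂ (p k n≤k)))

  e : Carrierᴹ
  e = single 0 (1# , 0#) , 1 , single-vanishes 0 (1# , 0#)

  constant-vanishes : ∀ n (y : ℕ → ℂ) → (∀ k → y k ≈ y (suc k)) → (∀ k → n ℕ.≤ k → y k ≈ 0#) → ∀ k → y k ≈ 0#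
  constant-vanishes n y constant y≈0 k = ℂ-Ring.trans (shift n) (y≈0 (n ℕ.+ k) (ℕ.m≤m+n n k))
    where
    shift : ∀ n → y k ≈ y (n ℕ.+ k)
    shift zero    = ℂ-Ring.refl
    shift (suc n) = ℂ-Ring.trans (shift n) (constant (n ℕ.+ k))

  -- The first coordinate of (T - 1)x = 0 makes the second components constant, hence zero by finite
  -- support. The second coordinate then kills every first component except that of entry 0.
  T-1-kernel : ∀ x → T-1 x ≈ᴹ 0ᴹ → x ≈ᴹ proj₁ (seq∞ x 0) *ₗ e
  T-1-kernel x@(h , n , p) Dx≈0 = eq
    where
    open AbelianGroupProperties ℂ-Ring.+-abelianGroup using (x∙y⁻¹≈ε⇒x≈y)
    y≈0 : ∀ k → proj₂ (h k) ≈ 0#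
    y≈0 = constant-vanishes n (λ k → proj₂ (h k))
      (λ k → x∙y⁻¹≈ε⇒x≈y _ _ (ℂ-Ring.trans (ℂ-Ring.sym (proj₁ (T-1-seq x k))) (proj₁ (Dx≈0 k))))
      (λ k n≤k → proj₂ (p k n≤k))
    x≈0 : ∀ k → proj₁ (h (suc k)) ≈ 0#
    x≈0 k = begin
      proj₁ (h (suc k))
        ≈⟨ ℂ-Ring.+-identityʳ _ ⟨
      proj₁ (h (suc k)) + 0#
        ≈⟨ ℂ-Ring.+-congˡ (y≈0 (suc k)) ⟨
      proj₁ (h (suc k)) + proj₂ (h (suc k))
        ≈⟨ x∙y⁻¹≈ε⇒x≈y _ _ (ℂ-Ring.trans (ℂ-Ring.sym (proj₂ (T-1-seq x k))) (proj₂ (Dx≈0 k))) ⟨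
      proj₂ (h (suc (suc k)))
        ≈⟨ y≈0 (suc (suc k)) ⟩
      0# ∎
      where open SetoidReasoning ℂ-Ring.setoid
    eq : ∀ k → h k ℂV.≈ᴹ proj₁ (h 0) ℂV.*ₗ single 0 (1# , 0#) k
    eq zero    = ℂ-Ring.sym (ℂ-Ring.*-identityʳ _) , ℂ-Ring.trans (y≈0 0) (ℂ-Ring.sym (ℂ-Ring.zeroʳ _))
    eq (suc k) = ℂ-Ring.trans (x≈0 k) (ℂ-Ring.sym (ℂ-Ring.zeroʳ _))
               , ℂ-Ring.trans (y≈0 (suc k)) (ℂ-Ring.sym (ℂ-Ring.zeroʳ _))

  module _ (em : ExcludedMiddle 0ℓ) where
    e∈nonzero : ∀ (W : Subspace M∞) → TInvariant M∞ W → ∀ x → x ∈ member W → ¬ x ≈ᴹ 0ᴹ → e ∈ member W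
    e∈nonzero W inv x x∈W x≉0 =
      let (k , eq)               = T-1-locallyNilpotent x
          (y , y∈W , y≉0 , Dy≈0) = fixed-in em M∞ W inv k x x∈W x≉0 eq
      in multiple∈⇒∈ em M∞ W e y y≉0 (T-1-kernel y Dy≈0) y∈W

    tIndecomposable : TIndecomposable M∞
    tIndecomposable = common-vector⇒TIndecomposable em M∞ e (λ e≈0 → 1≉0 (proj₁ (e≈0 0)))
      T-1-locallyNilpotent e∈nonzero

-- Uniqueness

module ≅-Properties {M N : ℂGModule} (M≅N : M ≅ N) where
  private
    module M = ℂGModule M
    module N = ℂGModule N
  open _≅_ M≅N public
  open LeftModuleMorphisms M.rawLeftModule N.rawLeftModule using (module IsLeftModuleIsomorphism)
  open IsLeftModuleIsomorphism isLeftModuleIsomorphism public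
    using (⟦⟧-cong; +ᴹ-homo; *ₗ-homo; 0ᴹ-homo; injective; surjective)

  preimage : ∀ y → ∃ λ x → to x N.≈ᴹ y
  preimage y = let (x , p) = surjective y in x , p M.≈ᴹ-refl

J U² : SL₂ℤ
J  = record { a = ℤ.-1ℤ ; b = 0ℤ ; c = 0ℤ ; d = ℤ.-1ℤ ; det≡1 = refl }
U² = record { a = ℤ.-1ℤ ; b = ℤ.-1ℤ ; c = 1ℤ ; d = 0ℤ ; det≡1 = refl }

J≈SS : J ≈G S G.∙ S
J≈SS = record { a≡ = refl ; b≡ = refl ; c≡ = refl ; d≡ = refl }

ε≈JJ : G.ε ≈G J G.∙ J
ε≈JJ = record { a≡ = refl ; b≡ = refl ; c≡ = refl ; d≡ = refl }

U²≈UU : U² ≈G U G.∙ U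
U²≈UU = record { a≡ = refl ; b≡ = refl ; c≡ = refl ; d≡ = refl }

J≈UU² : J ≈G U G.∙ U²
J≈UU² = record { a≡ = refl ; b≡ = refl ; c≡ = refl ; d≡ = refl }

fromℚℂ : ℚ → ℂ
fromℚℂ q = fromℚ q +i 0ℝ

⅓ : ℚ
⅓ = + 1 ℚ./ 3

½+½≈1 : fromℚℂ ½ ℂ-Ring.+ fromℚℂ ½ ≈ℂ ℂ-Ring.1#
½+½≈1 = pointwise⇒≈ℝ (λ _ → refl) ,ᶜ pointwise⇒≈ℝ (λ _ → refl)

⅓+⅓+⅓≈1 : fromℚℂ ⅓ ℂ-Ring.+ fromℚℂ ⅓ ℂ-Ring.+ fromℚℂ ⅓ ≈ℂ ℂ-Ring.1#
⅓+⅓+⅓≈1 = pointwise⇒≈ℝ (λ _ → refl) ,ᶜ pointwise⇒≈ℝ (λ _ → refl)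

module ModuleProperties (M : ℂGModule) where
  open ℂGModule M
  open LinearSolver space public
  open ℂSolver using (_:+_; con)
  open SetoidReasoning ≈ᴹ-setoid

  -1*≈- : ∀ x → fromℤℂ ℤ.-1ℤ *ₗ x ≈ᴹ -ᴹ x
  -1*≈- x = linear [] (x ∷ []) (λ x → con ℤ.-1ℤ ⊛ x ⊜ ⊝ x) refl

  x+x≈0⇒x≈0 : ∀ {x} → x +ᴹ x ≈ᴹ 0ᴹ → x ≈ᴹ 0ᴹ
  x+x≈0⇒x≈0 {x} x+x≈0 = begin
    x                    ≈⟨ *ₗ-identityˡ x ⟨
    ℂ-Ring.1# *ₗ x       ≈⟨ *ₗ-congʳ ½+½≈1 ⟨
    (h ℂ-Ring.+ h) *ₗ x  ≈⟨ linear (h ∷ []) (x ∷ []) (λ h x → (h :+ h) ⊛ x ⊜ h ⊛ (x ⊕ x)) refl ⟩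
    h *ₗ (x +ᴹ x)        ≈⟨ *ₗ-congˡ x+x≈0 ⟩
    h *ₗ 0ᴹ              ≈⟨ *ₗ-zeroʳ h ⟩
    0ᴹ                   ∎
    where h = fromℚℂ ½

  x+x+x≈0⇒x≈0 : ∀ {x} → x +ᴹ x +ᴹ x ≈ᴹ 0ᴹ → x ≈ᴹ 0ᴹ
  x+x+x≈0⇒x≈0 {x} x+x+x≈0 = begin
    x                                ≈⟨ *ₗ-identityˡ x ⟨
    ℂ-Ring.1# *ₗ x                   ≈⟨ *ₗ-congʳ ⅓+⅓+⅓≈1 ⟨
    (t ℂ-Ring.+ t ℂ-Ring.+ t) *ₗ x
      ≈⟨ linear (t ∷ []) (x ∷ []) (λ t x → (t :+ t :+ t) ⊛ x ⊜ t ⊛ (x ⊕ x ⊕ x)) refl ⟩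
    t *ₗ (x +ᴹ x +ᴹ x)               ≈⟨ *ₗ-congˡ x+x+x≈0 ⟩
    t *ₗ 0ᴹ                          ≈⟨ *ₗ-zeroʳ t ⟩
    0ᴹ                               ∎
    where t = fromℚℂ ⅓

  sub-cong : ∀ {x y x′ y′} → x ≈ᴹ x′ → y ≈ᴹ y′ → x -ᴹ y ≈ᴹ x′ -ᴹ y′
  sub-cong p q = +ᴹ-cong p (-ᴹ‿cong q)

  module _ (W : Subspace M) where
    open Subspace W

    sub-closed : ∀ {x y} → x ∈ member W → y ∈ member W → x -ᴹ y ∈ member W
    sub-closed x∈W y∈W = +-closed x∈W (≈-closed (-1*≈- _) (*-closed (fromℤℂ ℤ.-1ℤ) y∈W))

  record IsLinear (f : Carrierᴹ → Carrierᴹ) : Set where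
    field
      f-cong : ∀ {x y} → x ≈ᴹ y → f x ≈ᴹ f y
      f-+    : ∀ x y → f (x +ᴹ y) ≈ᴹ f x +ᴹ f y
      f-*    : ∀ k x → f (k *ₗ x) ≈ᴹ k *ₗ f x

    f-neg : ∀ x → f (-ᴹ x) ≈ᴹ -ᴹ f x
    f-neg x = begin
      f (-ᴹ x)                     ≈⟨ f-cong (-1*≈- x) ⟨
      f (fromℤℂ ℤ.-1ℤ *ₗ x)        ≈⟨ f-* (fromℤℂ ℤ.-1ℤ) x ⟩
      fromℤℂ ℤ.-1ℤ *ₗ f x          ≈⟨ -1*≈- (f x) ⟩
      -ᴹ f x                       ∎

    f-sub : ∀ x y → f (x -ᴹ y) ≈ᴹ f x -ᴹ f y
    f-sub x y = ≈ᴹ-trans (f-+ x (-ᴹ y)) (+ᴹ-congˡ (f-neg y))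

    f-0 : f 0ᴹ ≈ᴹ 0ᴹ
    f-0 = begin
      f 0ᴹ                    ≈⟨ f-cong (*ₗ-zeroˡ 0ᴹ) ⟨
      f (ℂ-Ring.0# *ₗ 0ᴹ)     ≈⟨ f-* ℂ-Ring.0# 0ᴹ ⟩
      ℂ-Ring.0# *ₗ f 0ᴹ       ≈⟨ *ₗ-zeroˡ (f 0ᴹ) ⟩
      0ᴹ                      ∎

    f-linear : ∀ k x y → f (k *ₗ x +ᴹ y) ≈ᴹ k *ₗ f x +ᴹ f y
    f-linear k x y = ≈ᴹ-trans (f-+ (k *ₗ x) y) (+ᴹ-congʳ (f-* k x))

  ·-isLinear : ∀ g → IsLinear (g ·_)
  ·-isLinear g = record { f-cong = ·-congʳ M g ; f-+ = ·-homo-+ g ; f-* = ·-homo-* g }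

  module S· = IsLinear (·-isLinear S)
  module U· = IsLinear (·-isLinear U)

  -- Y = S(T - 1), because U = ST.
  Y : Carrierᴹ → Carrierᴹ
  Y x = U · x -ᴹ S · x

  Y-isLinear : IsLinear Y
  Y-isLinear = record
    { f-cong = λ p → sub-cong (U·.f-cong p) (S·.f-cong p)
    ; f-+ = λ x y → ≈ᴹ-trans (sub-cong (U·.f-+ x y) (S·.f-+ x y))
        (linear [] (U · x ∷ U · y ∷ S · x ∷ S · y ∷ [])
          (λ a b c d → (a ⊕ b) ⊖ (c ⊕ d) ⊜ (a ⊖ c) ⊕ (b ⊖ d)) refl)
    ; f-* = λ k x → ≈ᴹ-trans (sub-cong (U·.f-* k x) (S·.f-* k x))
        (linear (k ∷ []) (U · x ∷ S · x ∷ []) (λ k a b → k ⊛ a ⊖ k ⊛ b ⊜ k ⊛ (a ⊖ b)) refl)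
    }

  module Y′ = IsLinear Y-isLinear

  open TAction M using (factor-·)

  J-·≈S-S-· : ∀ x → J · x ≈ᴹ S · S · x
  J-·≈S-S-· = factor-· J S S J≈SS

  J-J-·≈id : ∀ x → J · J · x ≈ᴹ x
  J-J-·≈id x = ≈ᴹ-trans (≈ᴹ-sym (factor-· G.ε J J ε≈JJ x)) (ε-· x)

  J-·≈U-U-U-· : ∀ x → J · x ≈ᴹ U · U · U · x
  J-·≈U-U-U-· x = ≈ᴹ-trans (factor-· J U U² J≈UU² x) (U·.f-cong (factor-· U² U U U²≈UU x))

-- Classes in the factors of a filtration by copies of V

module Filtered (M : ℂGModule) (F : VFiltration M) where
  open ℂGModule M
  open ModuleProperties M
  open VFiltration F
  open ℂSolver using (con)
  open Model using (σ₀; V-S; V-U)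

  private
    module Factor n = ≅-Properties (factor≅V n)
    module L n = Subspace (subspace (layer n))

  υ₀ : ℂ × ℂ → ℂ × ℂ
  υ₀ (x , y) = ℂ-Ring.- y , x ℂ-Ring.+ y

  -- x lies in the layer n + 1, and v is its class in the factor ≅ V.
  record Symbol (n : ℕ) (x : Carrierᴹ) (v : ℂ × ℂ) : Set where
    constructor symbol
    field
      in-layer : x ∈ₛ layer (suc n)
      value    : Factor.to n (x , in-layer) ℂV.≈ᴹ v
  open Symbol

  symbol-0⇒∈ : ∀ {n x} → Symbol n x ℂV.0ᴹ → x ∈ₛ layer n
  symbol-0⇒∈ {n} {x} (symbol x∈ v) = L.≈-closed n
    (linear [] (x ∷ []) (λ x → x ⊖ 𝟎 ⊜ x) refl)
    (Factor.injective n {x , x∈} {0ᴹ , L.0-closed (suc n)} (ℂV.≈ᴹ-trans v (ℂV.≈ᴹ-sym (Factor.0ᴹ-homo n))))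

  ∈⇒symbol-0 : ∀ {n x} → x ∈ₛ layer n → Symbol n x ℂV.0ᴹ
  ∈⇒symbol-0 {n} {x} x∈ = symbol (ascending n x∈) (ℂV.≈ᴹ-trans
    (Factor.⟦⟧-cong n {x , ascending n x∈} {0ᴹ , L.0-closed (suc n)} (L.≈-closed n
      (linear [] (x ∷ []) (λ x → x ⊜ x ⊖ 𝟎) refl) x∈))
    (Factor.0ᴹ-homo n))

  symbol-resp : ∀ {n x y v w} → x ≈ᴹ y → v ℂV.≈ᴹ w → Symbol n x v → Symbol n y w
  symbol-resp {n} {x} {y} x≈y v≈w (symbol x∈ p) = symbol (L.≈-closed (suc n) x≈y x∈)
    (ℂV.≈ᴹ-trans (Factor.⟦⟧-cong n (L.≈-closed n (≈ᴹ-sym y-x≈0) (L.0-closed n))) (ℂV.≈ᴹ-trans p v≈w))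
    where
    y-x≈0 : y -ᴹ x ≈ᴹ 0ᴹ
    y-x≈0 = ≈ᴹ-trans (+ᴹ-congʳ (≈ᴹ-sym x≈y)) (-ᴹ‿inverseʳ x)

  -- The isomorphism takes a membership proof as part of its argument; equality in the factor
  -- ignores it, so the class depends on the vector alone.
  symbol-unique : ∀ {n x v w} → Symbol n x v → Symbol n x w → v ℂV.≈ᴹ w
  symbol-unique {n} {x} (symbol x∈ p) (symbol x∈′ q) = ℂV.≈ᴹ-trans (ℂV.≈ᴹ-sym p) (ℂV.≈ᴹ-trans
    (Factor.⟦⟧-cong n (L.≈-closed n (≈ᴹ-sym (-ᴹ‿inverseʳ x)) (L.0-closed n))) q)

  symbol-+ : ∀ {n x y v w} → Symbol n x v → Symbol n y w → Symbol n (x +ᴹ y) (v ℂV.+ᴹ w)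
  symbol-+ {n} (symbol x∈ p) (symbol y∈ q) = symbol (L.+-closed (suc n) x∈ y∈)
    (ℂV.≈ᴹ-trans (Factor.+ᴹ-homo n _ _) (ℂV.+ᴹ-cong p q))

  symbol-* : ∀ {n x v} k → Symbol n x v → Symbol n (k *ₗ x) (k ℂV.*ₗ v)
  symbol-* {n} k (symbol x∈ p) = symbol (L.*-closed (suc n) k x∈)
    (ℂV.≈ᴹ-trans (Factor.*ₗ-homo n k _) (ℂV.*ₗ-congˡ p))

  symbol-sub : ∀ {n x y v w} → Symbol n x v → Symbol n y w → Symbol n (x -ᴹ y) (v ℂV.-ᴹ w)
  symbol-sub p q = symbol-+ p (symbol-resp (-1*≈- _)
    (LinearSolver.linear ℂV.space [] (_ ∷ []) (λ v → con ℤ.-1ℤ ⊛ v ⊜ ⊝ v) refl)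
    (symbol-* (fromℤℂ ℤ.-1ℤ) q))

  symbol-· : ∀ {n x v} g → Symbol n x v → Symbol n (g · x) (g ℂV.· v)
  symbol-· {n} g (symbol x∈ p) = symbol (Submodule.·-closed (layer (suc n)) g x∈)
    (ℂV.≈ᴹ-trans (Factor.·-homo n g _) (·-congʳ V g p))

  symbol-S : ∀ {n x v} → Symbol n x v → Symbol n (S · x) (σ₀ v)
  symbol-S {v = v} p = symbol-resp ≈ᴹ-refl (V-S v) (symbol-· S p)

  symbol-U : ∀ {n x v} → Symbol n x v → Symbol n (U · x) (υ₀ v)
  symbol-U {v = v} p = symbol-resp ≈ᴹ-refl (V-U v) (symbol-· U p)

  symbol-Y : ∀ {n x v} → Symbol n x v → Symbol n (Y x) (υ₀ v ℂV.-ᴹ σ₀ v)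
  symbol-Y p = symbol-sub (symbol-U p) (symbol-S p)

  lift : ∀ n v → ∃ λ x → Symbol n x v
  lift n v = let ((x , x∈) , p) = Factor.preimage n v in x , symbol x∈ p

-- The quadratic relations on a filtered module

module Relations (M : ℂGModule) (F : VFiltration M) where
  open ℂGModule M
  open ModuleProperties M
  open VFiltration F
  open Filtered M F
  open AbelianGroupProperties +ᴹ-abelianGroup using (inverseˡ-unique; x∙y⁻¹≈ε⇒x≈y)
  open SetoidReasoning ≈ᴹ-setoid

  private module C = LinearSolver TensorUnit.leftModule

  layer-0 : ∀ {x y} → x ∈ₛ layer 0 → y ∈ₛ layer 0 → x ≈ᴹ y
  layer-0 x∈ y∈ = ≈ᴹ-trans (zeroth _ x∈) (≈ᴹ-sym (zeroth _ y∈))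

  symbolOf : ∀ {n x} → x ∈ₛ layer (suc n) → ∃ λ v → Symbol n x v
  symbolOf x∈ = _ , symbol x∈ ℂV.≈ᴹ-refl

  -- SS + 1 lowers the filtration while (SS + 1)² = 2(SS + 1), because S⁴ = 1.
  SS≈-layer : ∀ n {x} → x ∈ₛ layer n → S · S · x ≈ᴹ -ᴹ x
  SS≈-layer zero {x} x∈ = layer-0
    (Submodule.·-closed (layer 0) S (Submodule.·-closed (layer 0) S x∈))
    (Subspace.≈-closed (subspace (layer 0)) (-1*≈- x)
      (Subspace.*-closed (subspace (layer 0)) (fromℤℂ ℤ.-1ℤ) x∈))
  SS≈-layer (suc n) {x} x∈ = inverseˡ-unique (S · S · x) x (x+x≈0⇒x≈0 (begin
    z +ᴹ z      ≈⟨ +ᴹ-congʳ SSz≈z ⟨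
    S · S · z +ᴹ z  ≈⟨ +ᴹ-congʳ (SS≈-layer n (symbol-0⇒∈ z-symbol)) ⟩
    -ᴹ z +ᴹ z   ≈⟨ -ᴹ‿inverseˡ z ⟩
    0ᴹ          ∎))
    where
    z = S · S · x +ᴹ x
    SSz≈z : S · S · z ≈ᴹ z
    SSz≈z = begin
      S · S · z                        ≈⟨ S·.f-cong (S·.f-+ (S · S · x) x) ⟩
      S · (S · S · S · x +ᴹ S · x)     ≈⟨ S·.f-+ (S · S · S · x) (S · x) ⟩
      S · S · S · S · x +ᴹ S · S · x   ≈⟨ +ᴹ-congʳ (J-·≈S-S-· (S · S · x)) ⟨
      J · S · S · x +ᴹ S · S · x       ≈⟨ +ᴹ-congʳ (·-congʳ M J (J-·≈S-S-· x)) ⟨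
      J · J · x +ᴹ S · S · x           ≈⟨ +ᴹ-congʳ (J-J-·≈id x) ⟩
      x +ᴹ S · S · x                   ≈⟨ +ᴹ-comm x (S · S · x) ⟩
      z                                ∎
    z-symbol : Symbol n z ℂV.0ᴹ
    z-symbol = let (v , p) = symbolOf x∈ in
      symbol-resp ≈ᴹ-refl (ℂV.-ᴹ‿inverseˡ v) (symbol-+ (symbol-S (symbol-S p)) p)

  SS≈- : ∀ x → S · S · x ≈ᴹ -ᴹ x
  SS≈- x = SS≈-layer _ (proj₂ (exhaustive x))

  UUU≈- : ∀ x → U · U · U · x ≈ᴹ -ᴹ x
  UUU≈- x = ≈ᴹ-trans (≈ᴹ-sym (J-·≈U-U-U-· x)) (≈ᴹ-trans (J-·≈S-S-· x) (SS≈- x))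

  -- UU - U + 1 lowers the filtration, and U acts as -1 on its image, because U³ = -1;
  -- hence its square is 3 times itself.
  UU≈U-1-layer : ∀ n {x} → x ∈ₛ layer n → U · U · x ≈ᴹ U · x -ᴹ x
  UU≈U-1-layer zero {x} x∈ = layer-0 (closed (closed x∈)) (sub-closed (subspace (layer 0)) (closed x∈) x∈)
    where
    closed : ∀ {x} → x ∈ₛ layer 0 → (U · x) ∈ₛ layer 0
    closed = Submodule.·-closed (layer 0) U
  UU≈U-1-layer (suc n) {x} x∈ = x∙y⁻¹≈ε⇒x≈y _ _ (x+x+x≈0⇒x≈0 (begin
    z +ᴹ z +ᴹ z           ≈⟨ +ᴹ-congʳ (+ᴹ-congʳ z≈-z-z) ⟩
    -ᴹ z -ᴹ z +ᴹ z +ᴹ z   ≈⟨ linear [] (z ∷ []) (λ z → ⊝ z ⊖ z ⊕ z ⊕ z ⊜ 𝟎) refl ⟩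
    0ᴹ                    ∎))
    where
    z = U · U · x -ᴹ (U · x -ᴹ x)
    Uz≈-z : U · z ≈ᴹ -ᴹ z
    Uz≈-z = begin
      U · z                                        ≈⟨ U·.f-sub _ _ ⟩
      U · U · U · x -ᴹ U · (U · x -ᴹ x)            ≈⟨ sub-cong (UUU≈- x) (U·.f-sub _ _) ⟩
      -ᴹ x -ᴹ (U · U · x -ᴹ U · x)
        ≈⟨ linear [] (x ∷ U · x ∷ U · U · x ∷ []) (λ x a b → ⊝ x ⊖ (b ⊖ a) ⊜ ⊝ (b ⊖ (a ⊖ x))) refl ⟩
      -ᴹ z                                         ∎
    z-symbol : Symbol n z ℂV.0ᴹ
    z-symbol = let ((a , b) , p) = symbolOf x∈ in symbol-resp ≈ᴹ-refl
      ( C.linear [] (a ∷ b ∷ []) (λ a b → ⊝ (a ⊕ b) ⊖ (⊝ b ⊖ a) ⊜ 𝟎) refl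
      , C.linear [] (a ∷ b ∷ []) (λ a b → (⊝ b ⊕ (a ⊕ b)) ⊖ ((a ⊕ b) ⊖ b) ⊜ 𝟎) refl )
      (symbol-sub (symbol-U (symbol-U p)) (symbol-sub (symbol-U p) p))
    z≈-z-z : z ≈ᴹ -ᴹ z -ᴹ z
    z≈-z-z = begin
      z                ≈⟨ linear [] (z ∷ []) (λ z → z ⊜ ⊝ ⊝ z) refl ⟩
      -ᴹ -ᴹ z          ≈⟨ -ᴹ‿cong Uz≈-z ⟨
      -ᴹ (U · z)       ≈⟨ U·.f-neg z ⟨
      U · (-ᴹ z)       ≈⟨ U·.f-cong Uz≈-z ⟨
      U · U · z        ≈⟨ UU≈U-1-layer n (symbol-0⇒∈ z-symbol) ⟩
      U · z -ᴹ z       ≈⟨ +ᴹ-congʳ Uz≈-z ⟩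
      -ᴹ z -ᴹ z        ∎

  UU≈U-1 : ∀ x → U · U · x ≈ᴹ U · x -ᴹ x
  UU≈U-1 x = UU≈U-1-layer _ (proj₂ (exhaustive x))

  -- With Y = U - S, the right side expands to US - U² + U and the left side to US - S². They agree
  -- because U - U² and -S² are both 1.
  YS≈ : ∀ x → Y (S · x) ≈ᴹ S · (x -ᴹ Y x) -ᴹ Y (Y x) +ᴹ Y x
  YS≈ x = begin
    U · S · x -ᴹ S · S · x
      ≈⟨ linear [] (S · x ∷ U · x ∷ S · U · x ∷ S · S · x ∷ U · S · x ∷ x ∷ [])
           (λ Sx Ux SUx SSx USx x → USx ⊖ SSx
             ⊜ (Sx ⊖ (SUx ⊖ SSx)) ⊖ (((Ux ⊖ x) ⊖ USx) ⊖ (SUx ⊖ SSx)) ⊕ (Ux ⊖ Sx) ⊖ (SSx ⊕ x)) refl ⟩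
    (S · x -ᴹ (S · U · x -ᴹ S · S · x))
      -ᴹ (((U · x -ᴹ x) -ᴹ U · S · x) -ᴹ (S · U · x -ᴹ S · S · x)) +ᴹ Y x -ᴹ (S · S · x +ᴹ x)
      ≈⟨ +ᴹ-cong (+ᴹ-congʳ (sub-cong expand₁ expand₂))
           (-ᴹ‿cong (≈ᴹ-trans (+ᴹ-congʳ (SS≈- x)) (-ᴹ‿inverseˡ x))) ⟩
    S · (x -ᴹ Y x) -ᴹ Y (Y x) +ᴹ Y x -ᴹ 0ᴹ
      ≈⟨ linear [] (S · (x -ᴹ Y x) -ᴹ Y (Y x) +ᴹ Y x ∷ []) (λ x → x ⊖ 𝟎 ⊜ x) refl ⟩
    S · (x -ᴹ Y x) -ᴹ Y (Y x) +ᴹ Y x ∎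
    where
    expand₁ : S · x -ᴹ (S · U · x -ᴹ S · S · x) ≈ᴹ S · (x -ᴹ Y x)
    expand₁ = ≈ᴹ-sym (≈ᴹ-trans (S·.f-sub x (Y x)) (sub-cong ≈ᴹ-refl (S·.f-sub (U · x) (S · x))))
    expand₂ : ((U · x -ᴹ x) -ᴹ U · S · x) -ᴹ (S · U · x -ᴹ S · S · x) ≈ᴹ Y (Y x)
    expand₂ = ≈ᴹ-sym (sub-cong
      (≈ᴹ-trans (U·.f-sub (U · x) (S · x)) (+ᴹ-congʳ (UU≈U-1 x)))
      (S·.f-sub (U · x) (S · x)))

  Y≈0⇒T-fixed : ∀ {x} → Y x ≈ᴹ 0ᴹ → T · x ≈ᴹ x
  Y≈0⇒T-fixed {x} Yx≈0 = begin
    T · x              ≈⟨ linear [] (T · x ∷ []) (λ x → x ⊜ ⊝ ⊝ x) refl ⟩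
    -ᴹ -ᴹ (T · x)      ≈⟨ -ᴹ‿cong (SS≈- (T · x)) ⟨
    -ᴹ (S · S · T · x) ≈⟨ -ᴹ‿cong (S·.f-cong (TAction.U-·≈S-T-· M x)) ⟨
    -ᴹ (S · U · x)     ≈⟨ -ᴹ‿cong (S·.f-cong (x∙y⁻¹≈ε⇒x≈y _ _ Yx≈0)) ⟩
    -ᴹ (S · S · x)     ≈⟨ -ᴹ‿cong (SS≈- x) ⟩
    -ᴹ -ᴹ x            ≈⟨ linear [] (x ∷ []) (λ x → ⊝ ⊝ x ⊜ x) refl ⟩
    x                  ∎

-- The freedom to rescale is spent on Y x_{n+1} = x_n, so leading coefficients are merely nonzero
-- rather than 1. The vector `x n` lies in layer n + 1.
record Ladder (M : ℂGModule) (F : VFiltration M) : Set where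
  open ℂGModule M
  open ModuleProperties M using (Y)
  open Filtered M F using (Symbol)
  field
    x        : ℕ → Carrierᴹ
    lead     : ℕ → ℂ
    lead≉0   : ∀ n → ¬ lead n ≈ℂ ℂ-Ring.0#
    x-symbol : ∀ n → Symbol n (x n) (lead n , ℂ-Ring.0#)
    Yx₀≈0    : Y (x 0) ≈ᴹ 0ᴹ
    Yxₙ₊₁≈xₙ : ∀ n → Y (x (suc n)) ≈ᴹ x n

-- Inductive construction of the vectors x_n

module Chain (em : ExcludedMiddle 0ℓ) (M : ℂGModule) (indecomposable : TIndecomposable M) (F : VFiltration M) where
  open ℂGModule M
  open ModuleProperties M
  open VFiltration F
  open Filtered M F
  open Relations M F
  open Field em using (inverse)
  open ℂSolver using (_:+_; _:*_)
  open ℂ-Ring using (0#; 1#; _≈_; _*_)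
  open SetoidReasoning ≈ᴹ-setoid
  private
    module ℂL = LinearSolver TensorUnit.leftModule
    module L n = Subspace (subspace (layer n))

  span : Carrierᴹ → Subspace M
  span x = record
    { member = λ y → ∃ λ k → y ≈ᴹ k *ₗ x
    ; ≈-closed = λ y≈z (k , p) → k , ≈ᴹ-trans (≈ᴹ-sym y≈z) p
    ; 0-closed = 0# , ≈ᴹ-sym (*ₗ-zeroˡ x)
    ; +-closed = λ (k , p) (l , q) → k ℂ-Ring.+ l , ≈ᴹ-trans (+ᴹ-cong p q) (≈ᴹ-sym (*ₗ-distribʳ x k l))
    ; *-closed = λ k (l , p) → k * l , ≈ᴹ-trans (*ₗ-congˡ p) (≈ᴹ-sym (*ₗ-assoc k l x))
    }

  infixr 5 _∷+_
  _∷+_ : Carrierᴹ → Subspace M → Subspace M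
  x ∷+ C = record
    { member = λ y → ∃ λ k → ∃ λ p → p ∈ member C × y ≈ᴹ k *ₗ x +ᴹ p
    ; ≈-closed = λ y≈z (k , p , p∈ , eq) → k , p , p∈ , ≈ᴹ-trans (≈ᴹ-sym y≈z) eq
    ; 0-closed = 0# , 0ᴹ , Subspace.0-closed C , ≈ᴹ-sym (≈ᴹ-trans (+ᴹ-congʳ (*ₗ-zeroˡ x)) (+ᴹ-identityˡ 0ᴹ))
    ; +-closed = λ (k , p , p∈ , eq) (l , q , q∈ , eq′) → k ℂ-Ring.+ l , p +ᴹ q , Subspace.+-closed C p∈ q∈ ,
        ≈ᴹ-trans (+ᴹ-cong eq eq′) (linear (k ∷ l ∷ []) (x ∷ p ∷ q ∷ [])
          (λ k l x p q → (k ⊛ x ⊕ p) ⊕ (l ⊛ x ⊕ q) ⊜ (k :+ l) ⊛ x ⊕ (p ⊕ q)) refl)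
    ; *-closed = λ k (l , p , p∈ , eq) → k * l , k *ₗ p , Subspace.*-closed C k p∈ ,
        ≈ᴹ-trans (*ₗ-congˡ eq) (linear (k ∷ l ∷ []) (x ∷ p ∷ [])
          (λ k l x p → k ⊛ (l ⊛ x ⊕ p) ⊜ (k :* l) ⊛ x ⊕ k ⊛ p) refl)
    }

  span-TInvariant : ∀ {x} → Y x ≈ᴹ 0ᴹ → TInvariant M (span x)
  span-TInvariant Yx≈0 (k , p) = k , ≈ᴹ-trans (·-congʳ M T p)
    (≈ᴹ-trans (·-homo-* T k _) (*ₗ-congˡ (Y≈0⇒T-fixed Yx≈0)))

  layer-mono : ∀ {m n x} → m ℕ.≤′ n → x ∈ₛ layer m → x ∈ₛ layer n
  layer-mono (ℕ.≤′-reflexive refl) x∈ = x∈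
  layer-mono (ℕ.≤′-step m≤n)       x∈ = ascending _ (layer-mono m≤n x∈)

  e₁-symbol⇒∉ : ∀ {n x} → Symbol n x (1# , 0#) → ¬ x ∈ₛ layer n
  e₁-symbol⇒∉ p x∈ = 1≉0 (proj₁ (symbol-unique p (∈⇒symbol-0 x∈)))

  Y-lowers : ∀ {n v} → Symbol n v (1# , 0#) → Y v ∈ₛ layer n
  Y-lowers v-symbol = symbol-0⇒∈ (symbol-resp ≈ᴹ-refl
    (ℂL.linear [] [] (⊝ 𝟎 ⊖ ⊝ 𝟎 ⊜ 𝟎) refl , ℂL.linear [] (1# ∷ []) (λ x → (x ⊕ 𝟎) ⊖ x ⊜ 𝟎) refl)
    (symbol-Y v-symbol))

  -- Otherwise v and a T-fixed vector of the first layer would span a decomposable space.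
  kernel-Y : ∀ n {v} → Symbol (suc n) v (1# , 0#) → ¬ Y v ≈ᴹ 0ᴹ
  kernel-Y n {v} v-symbol Yv≈0 with lift 0 (1# , 0#)
  ... | w , w-symbol = [ w≉0 , v≉0 ]
    (proj₁ (indecomposable (w ∷+ span v) invariant) (span w) (span v)
      (span-TInvariant Yw≈0) (span-TInvariant Yv≈0) directSum)
    where
    Yw≈0 : Y w ≈ᴹ 0ᴹ
    Yw≈0 = zeroth _ (Y-lowers w-symbol)

    w≉0 : ¬ IsZero M (span w)
    w≉0 w≈0 = e₁-symbol⇒∉ w-symbol
      (L.≈-closed 0 (≈ᴹ-sym (w≈0 w (1# , ≈ᴹ-sym (*ₗ-identityˡ w)))) (L.0-closed 0))

    v≉0 : ¬ IsZero M (span v)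
    v≉0 v≈0 = e₁-symbol⇒∉ v-symbol
      (L.≈-closed (suc n) (≈ᴹ-sym (v≈0 v (1# , ≈ᴹ-sym (*ₗ-identityˡ v)))) (L.0-closed (suc n)))

    w∈ : w ∈ₛ layer (suc n)
    w∈ = layer-mono (ℕ.≤⇒≤′ (ℕ.s≤s ℕ.z≤n)) (Symbol.in-layer w-symbol)

    invariant : TInvariant M (w ∷+ span v)
    invariant {x} (k , p , p∈ , eq) = k , T · p , span-TInvariant Yv≈0 p∈ , (begin
      T · x                       ≈⟨ ·-congʳ M T eq ⟩
      T · (k *ₗ w +ᴹ p)           ≈⟨ IsLinear.f-linear (·-isLinear T) k w p ⟩
      k *ₗ (T · w) +ᴹ T · p       ≈⟨ +ᴹ-congʳ (*ₗ-congˡ (Y≈0⇒T-fixed Yw≈0)) ⟩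
      k *ₗ w +ᴹ T · p             ∎)

    directSum : IsDirectSum M (w ∷+ span v) (span w) (span v)
    directSum = record
      { A⊆W = λ (k , p) → k , 0ᴹ , Subspace.0-closed (span v) , ≈ᴹ-trans p (≈ᴹ-sym (+ᴹ-identityʳ _))
      ; B⊆W = λ {x} x∈ → 0# , x , x∈ , ≈ᴹ-sym (≈ᴹ-trans (+ᴹ-congʳ (*ₗ-zeroˡ w)) (+ᴹ-identityˡ x))
      ; A+B = λ (k , p , p∈ , eq) → k *ₗ w , p , (k , ≈ᴹ-refl) , p∈ , eq
      -- `w` lies in layer n + 1, so its class in the next factor is 0, whereas `v` has class (1 ,
      -- 0). Comparing classes in kw = lv gives l = 0.
      ; A∩B≈0 = λ x (k , x≈kw) (l , x≈lv) →
          let l≈0 : l * 1# ≈ 0#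
              l≈0 = proj₁ (symbol-unique (symbol-* l v-symbol)
                (∈⇒symbol-0 (L.≈-closed (suc n) (≈ᴹ-trans (≈ᴹ-sym x≈kw) x≈lv) (L.*-closed (suc n) k w∈))))
          in ≈ᴹ-trans x≈lv (≈ᴹ-trans (*ₗ-congʳ (ℂ-Ring.trans (ℂ-Ring.sym (ℂ-Ring.*-identityʳ l)) l≈0)) (*ₗ-zeroˡ v))
      }

  -- C = ℂ[Y]x is the part of layer n on which Y is nilpotent.
  record Stage (n : ℕ) : Set₁ where
    field
      x         : Carrierᴹ
      C         : Subspace M
      x∈C       : x ∈ member C
      C⊆layer   : ∀ {p} → p ∈ member C → p ∈ₛ layer n
      Y-closed  : ∀ {p} → p ∈ member C → Y p ∈ member C
      C⊆ℂx+YC   : ∀ {p} → p ∈ member C → ∃ λ k → ∃ λ r → r ∈ member C × p ≈ᴹ k *ₗ x +ᴹ Y r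
      layer⊆C+SC : ∀ {y} → y ∈ₛ layer n → ∃ λ p → ∃ λ q → p ∈ member C × q ∈ member C × y ≈ᴹ p +ᴹ S · q
      -- Solving r = q + Yr inverts 1 - Y; nilpotency of Y on `C` is recorded in this form, which
      -- passes directly to the next stage.
      1-Y-onto  : ∀ {q} → q ∈ member C → ∃ λ r → r ∈ member C × r ≈ᴹ q +ᴹ Y r

  record Successor {n} (stage : Stage n) : Set where
    open Stage stage
    field
      x′     : Carrierᴹ
      lead   : ℂ
      lead≉0 : ¬ lead ≈ 0#
      x′-symbol : Symbol n x′ (lead , 0#)
      Yx′≈x  : Y x′ ≈ᴹ x

  -- Starting from x = 0 makes Y x_0 = 0 an instance of the general condition that Y sends the
  -- successor to `x`.
  stage₀ : Stage 0
  stage₀ = record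
    { x = 0ᴹ
    ; C = subspace (layer 0)
    ; x∈C = L.0-closed 0
    ; C⊆layer = λ p∈ → p∈
    ; Y-closed = λ p∈ → sub-closed (subspace (layer 0)) (·-closed U p∈) (·-closed S p∈)
    ; C⊆ℂx+YC = λ p∈ → 0# , 0ᴹ , L.0-closed 0 , layer-0 p∈
        (L.+-closed 0 (L.*-closed 0 0# (L.0-closed 0)) (sub-closed (subspace (layer 0))
          (·-closed U (L.0-closed 0)) (·-closed S (L.0-closed 0))))
    ; layer⊆C+SC = λ y∈ → 0ᴹ , 0ᴹ , L.0-closed 0 , L.0-closed 0 ,
        layer-0 y∈ (L.+-closed 0 (L.0-closed 0) (·-closed S (L.0-closed 0)))
    ; 1-Y-onto = λ q∈ → 0ᴹ , L.0-closed 0 , layer-0 (L.0-closed 0)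
        (L.+-closed 0 q∈ (sub-closed (subspace (layer 0)) (·-closed U (L.0-closed 0)) (·-closed S (L.0-closed 0))))
    }
    where open Submodule (layer 0) using (·-closed)

  module _ {n} (stage : Stage n) where
    open Stage stage
    private module C = Subspace C

    record AlmostSuccessor : Set where
      field
        v        : Carrierᴹ
        k        : ℂ
        v-symbol : Symbol n v (1# , 0#)
        Yv≈kx    : Y v ≈ᴹ k *ₗ x

    -- By `YS≈`, subtracting Sr with (1 - Y)r = q removes Sq and adds Y²r - Yr, which is in `C`.
    -- Subtracting t then removes the part Yt of the component in `C`. Both corrections lie in layer
    -- n, so the class of v is unchanged.
    mkAlmostSuccessor : ∀ {v p q r k t} → Symbol n v (1# , 0#) → Y v ≈ᴹ p +ᴹ S · q →
      r ∈ member C → r ≈ᴹ q +ᴹ Y r → t ∈ member C → p +ᴹ (Y (Y r) -ᴹ Y r) ≈ᴹ k *ₗ x +ᴹ Y t →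
      AlmostSuccessor
    mkAlmostSuccessor {v} {p} {q} {r} {k} {t} v-symbol Yv≈p+Sq r∈ r≈q+Yr t∈ p′≈kx+Yt = record
      { v = v -ᴹ S · r -ᴹ t
      ; k = k
      ; v-symbol = symbol-resp ≈ᴹ-refl
          ( ℂL.linear [] (1# ∷ []) (λ x → x ⊖ 𝟎 ⊖ 𝟎 ⊜ x) refl
          , ℂL.linear [] [] (𝟎 ⊖ 𝟎 ⊖ 𝟎 ⊜ 𝟎) refl )
          (symbol-sub (symbol-sub v-symbol (∈⇒symbol-0 (Submodule.·-closed (layer n) S (C⊆layer r∈))))
            (∈⇒symbol-0 (C⊆layer t∈)))
      ; Yv≈kx = begin
          Y (v -ᴹ S · r -ᴹ t)
            ≈⟨ Y′.f-sub (v -ᴹ S · r) t ⟩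
          Y (v -ᴹ S · r) -ᴹ Y t
            ≈⟨ +ᴹ-congʳ (Y′.f-sub v (S · r)) ⟩
          Y v -ᴹ Y (S · r) -ᴹ Y t
            ≈⟨ +ᴹ-congʳ (sub-cong Yv≈p+Sq (YS≈ r)) ⟩
          p +ᴹ S · q -ᴹ (S · (r -ᴹ Y r) -ᴹ Y (Y r) +ᴹ Y r) -ᴹ Y t
            ≈⟨ +ᴹ-congʳ (sub-cong ≈ᴹ-refl (+ᴹ-congʳ (+ᴹ-congʳ (S·.f-cong r-Yr≈q)))) ⟩
          p +ᴹ S · q -ᴹ (S · q -ᴹ Y (Y r) +ᴹ Y r) -ᴹ Y t
            ≈⟨ linear [] (p ∷ S · q ∷ Y (Y r) ∷ Y r ∷ Y t ∷ [])
                 (λ p Sq YYr Yr Yt → p ⊕ Sq ⊖ (Sq ⊖ YYr ⊕ Yr) ⊖ Yt ⊜ (p ⊕ (YYr ⊖ Yr)) ⊖ Yt) refl ⟩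
          (p +ᴹ (Y (Y r) -ᴹ Y r)) -ᴹ Y t
            ≈⟨ +ᴹ-congʳ p′≈kx+Yt ⟩
          (k *ₗ x +ᴹ Y t) -ᴹ Y t
            ≈⟨ linear [] (k *ₗ x ∷ Y t ∷ []) (λ a b → (a ⊕ b) ⊖ b ⊜ a) refl ⟩
          k *ₗ x ∎
      }
      where
      r-Yr≈q : r -ᴹ Y r ≈ᴹ q
      r-Yr≈q = ≈ᴹ-trans (+ᴹ-congʳ r≈q+Yr)
        (linear [] (q ∷ Y r ∷ []) (λ a b → (a ⊕ b) ⊖ b ⊜ a) refl)

    almostSuccessor : AlmostSuccessor
    almostSuccessor = fromLift (lift n (1# , 0#))
      where
      fromDecomposition : ∀ {v p q r} → Symbol n v (1# , 0#) → Y v ≈ᴹ p +ᴹ S · q →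
        r ∈ member C → r ≈ᴹ q +ᴹ Y r →
        (∃ λ k → ∃ λ t → t ∈ member C × p +ᴹ (Y (Y r) -ᴹ Y r) ≈ᴹ k *ₗ x +ᴹ Y t) → AlmostSuccessor
      fromDecomposition v-symbol eq r∈ eq′ (k , t , t∈ , eq″) = mkAlmostSuccessor v-symbol eq r∈ eq′ t∈ eq″

      fromInverse : ∀ {v p q} → Symbol n v (1# , 0#) → Y v ≈ᴹ p +ᴹ S · q → p ∈ member C →
        (∃ λ r → r ∈ member C × r ≈ᴹ q +ᴹ Y r) → AlmostSuccessor
      fromInverse v-symbol eq p∈ (r , r∈ , eq′) = fromDecomposition v-symbol eq r∈ eq′
        (C⊆ℂx+YC (C.+-closed p∈ (sub-closed C (Y-closed (Y-closed r∈)) (Y-closed r∈))))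

      fromSplitting : ∀ {v} → Symbol n v (1# , 0#) →
        (∃ λ p → ∃ λ q → p ∈ member C × q ∈ member C × Y v ≈ᴹ p +ᴹ S · q) → AlmostSuccessor
      fromSplitting v-symbol (p , q , p∈ , q∈ , eq) = fromInverse v-symbol eq p∈ (1-Y-onto q∈)

      fromLift : (∃ λ v → Symbol n v (1# , 0#)) → AlmostSuccessor
      fromLift (v , v-symbol) = fromSplitting v-symbol (layer⊆C+SC (Y-lowers v-symbol))

    module _ (succ : Successor stage) where
      open Successor succ

      private
        C′ = x′ ∷+ C
        lead⁻¹ = proj₁ (inverse lead lead≉0)

        C⊆C′ : ∀ {p} → p ∈ member C → p ∈ member C′
        C⊆C′ {p} p∈ = 0# , p , p∈ , ≈ᴹ-sym (≈ᴹ-trans (+ᴹ-congʳ (*ₗ-zeroˡ x′)) (+ᴹ-identityˡ p))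

        k/lead : ∀ k → k * lead⁻¹ * lead ≈ k
        k/lead k = ℂ-Ring.trans (ℂ-Ring.*-assoc k lead⁻¹ lead) (ℂ-Ring.trans
          (ℂ-Ring.*-congˡ (ℂ-Ring.trans (ℂ-Ring.*-comm lead⁻¹ lead) (proj₂ (inverse lead lead≉0))))
          (ℂ-Ring.*-identityʳ k))

        remainder : Carrierᴹ → ℂ → ℂ → Carrierᴹ
        remainder y a b = y -ᴹ a *ₗ x′ -ᴹ b *ₗ (S · x′)

        -- The classes of x′ and Sx′ are (lead , 0) and (0 , lead), a basis of V, so suitable
        -- multiples cancel any class.
        remainder∈layer : ∀ {y α β} → Symbol n y (α , β) → remainder y (α * lead⁻¹) (β * lead⁻¹) ∈ₛ layer n
        remainder∈layer {y} {α} {β} y-symbol = symbol-0⇒∈ (symbol-resp ≈ᴹ-refl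
          ( ℂ-Ring.trans (ℂ-Ring.+-congʳ (ℂ-Ring.+-congˡ (ℂ-Ring.-‿cong (k/lead α))))
              (ℂL.linear (β * lead⁻¹ ∷ []) (α ∷ []) (λ b α → (α ⊖ α) ⊖ b ⊛ (⊝ 𝟎) ⊜ 𝟎) refl)
          , ℂ-Ring.trans (ℂ-Ring.+-congˡ (ℂ-Ring.-‿cong (k/lead β)))
              (ℂL.linear (α * lead⁻¹ ∷ []) (β ∷ []) (λ a β → (β ⊖ a ⊛ 𝟎) ⊖ β ⊜ 𝟎) refl) )
          (symbol-sub (symbol-sub y-symbol (symbol-* (α * lead⁻¹) x′-symbol))
            (symbol-* (β * lead⁻¹) (symbol-S x′-symbol))))

        Splits : Subspace M → Carrierᴹ → Set
        Splits C y = ∃ λ p → ∃ λ q → p ∈ member C × q ∈ member C × y ≈ᴹ p +ᴹ S · q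

        remainder-splits : ∀ y a b → Splits C (remainder y a b) → Splits C′ y
        remainder-splits y a b (p , q , p∈ , q∈ , eq) =
          a *ₗ x′ +ᴹ p , b *ₗ x′ +ᴹ q , (a , p , p∈ , ≈ᴹ-refl) , (b , q , q∈ , ≈ᴹ-refl) , (begin
            y
              ≈⟨ linear (a ∷ b ∷ []) (y ∷ x′ ∷ S · x′ ∷ [])
                   (λ a b y x Sx → y ⊜ ((y ⊖ a ⊛ x) ⊖ b ⊛ Sx) ⊕ (a ⊛ x ⊕ b ⊛ Sx)) refl ⟩
            remainder y a b +ᴹ (a *ₗ x′ +ᴹ b *ₗ (S · x′))
              ≈⟨ +ᴹ-congʳ eq ⟩
            (p +ᴹ S · q) +ᴹ (a *ₗ x′ +ᴹ b *ₗ (S · x′))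
              ≈⟨ linear (a ∷ b ∷ []) (x′ ∷ S · x′ ∷ p ∷ S · q ∷ [])
                   (λ a b x Sx p Sq → (p ⊕ Sq) ⊕ (a ⊛ x ⊕ b ⊛ Sx) ⊜ (a ⊛ x ⊕ p) ⊕ (b ⊛ Sx ⊕ Sq)) refl ⟩
            (a *ₗ x′ +ᴹ p) +ᴹ (b *ₗ (S · x′) +ᴹ S · q)
              ≈⟨ +ᴹ-congˡ (S·.f-linear b x′ q) ⟨
            (a *ₗ x′ +ᴹ p) +ᴹ S · (b *ₗ x′ +ᴹ q) ∎)

        symbol-splits : ∀ {y} → (∃ λ v → Symbol n y v) → Splits C′ y
        symbol-splits {y} ((α , β) , y-symbol) =
          remainder-splits y (α * lead⁻¹) (β * lead⁻¹) (layer⊆C+SC (remainder∈layer y-symbol))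

        Y[kx′+p]≈kx+Yp : ∀ k p → Y (k *ₗ x′ +ᴹ p) ≈ᴹ k *ₗ x +ᴹ Y p
        Y[kx′+p]≈kx+Yp k p = ≈ᴹ-trans (Y′.f-linear k x′ p) (+ᴹ-congʳ (*ₗ-congˡ Yx′≈x))

        -- Since Yx′ = x, the element lx + Yr of `C` is Y(lx′ + r); thus all of `C` is absorbed into
        -- the image of Y on `C′`.
        C′⊆ℂx′+YC′ : ∀ {y k p} → y ≈ᴹ k *ₗ x′ +ᴹ p → (∃ λ l → ∃ λ r → r ∈ member C × p ≈ᴹ l *ₗ x +ᴹ Y r) →
                     ∃ λ k → ∃ λ r → r ∈ member C′ × y ≈ᴹ k *ₗ x′ +ᴹ Y r
        C′⊆ℂx′+YC′ {k = k} eq (l , r , r∈ , p≈lx+Yr) = k , l *ₗ x′ +ᴹ r , (l , r , r∈ , ≈ᴹ-refl) ,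
          ≈ᴹ-trans eq (+ᴹ-congˡ (≈ᴹ-trans p≈lx+Yr (≈ᴹ-sym (Y[kx′+p]≈kx+Yp l r))))

        -- As (1 - Y)(kx′ + r) = kx′ - kx + (1 - Y)r, it remains to solve (1 - Y)r = p + kx inside
        -- `C`.
        1-Y-onto′ : ∀ {y k p} → y ≈ᴹ k *ₗ x′ +ᴹ p → (∃ λ r → r ∈ member C × r ≈ᴹ (p +ᴹ k *ₗ x) +ᴹ Y r) →
                    ∃ λ r → r ∈ member C′ × r ≈ᴹ y +ᴹ Y r
        1-Y-onto′ {y} {k} {p} eq (r , r∈ , r≈) = k *ₗ x′ +ᴹ r , (k , r , r∈ , ≈ᴹ-refl) , (begin
          k *ₗ x′ +ᴹ r
            ≈⟨ +ᴹ-congˡ r≈ ⟩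
          k *ₗ x′ +ᴹ (p +ᴹ k *ₗ x +ᴹ Y r)
            ≈⟨ linear (k ∷ []) (x′ ∷ p ∷ x ∷ Y r ∷ [])
                 (λ k x′ p x Yr → k ⊛ x′ ⊕ (p ⊕ k ⊛ x ⊕ Yr) ⊜ (k ⊛ x′ ⊕ p) ⊕ (k ⊛ x ⊕ Yr)) refl ⟩
          (k *ₗ x′ +ᴹ p) +ᴹ (k *ₗ x +ᴹ Y r)
            ≈⟨ +ᴹ-cong eq (Y[kx′+p]≈kx+Yp k r) ⟨
          y +ᴹ Y (k *ₗ x′ +ᴹ r) ∎)

      nextStage : Stage (suc n)
      nextStage = record
        { x = x′
        ; C = C′
        ; x∈C = 1# , 0ᴹ , C.0-closed , ≈ᴹ-sym (≈ᴹ-trans (+ᴹ-identityʳ _) (*ₗ-identityˡ x′))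
        ; C⊆layer = λ (k , p , p∈ , eq) → L.≈-closed (suc n) (≈ᴹ-sym eq) (L.+-closed (suc n)
            (L.*-closed (suc n) k (Symbol.in-layer x′-symbol)) (ascending n (C⊆layer p∈)))
        ; Y-closed = λ (k , p , p∈ , eq) → C⊆C′ (C.≈-closed
            (≈ᴹ-sym (≈ᴹ-trans (Y′.f-cong eq) (Y[kx′+p]≈kx+Yp k p)))
            (C.+-closed (C.*-closed k x∈C) (Y-closed p∈)))
        ; C⊆ℂx+YC = λ (k , p , p∈ , eq) → C′⊆ℂx′+YC′ eq (C⊆ℂx+YC p∈)
        ; layer⊆C+SC = λ y∈ → symbol-splits (symbolOf y∈)
        ; 1-Y-onto = λ (k , p , p∈ , eq) → 1-Y-onto′ eq (1-Y-onto (C.+-closed p∈ (C.*-closed k x∈C)))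
        }

  -- At n = 0 the target `x` is itself zero, so v serves unscaled. For later stages k = 0 would put
  -- v in the kernel of Y, against `kernel-Y`.
  kernel-successor : ∀ n (stage : Stage n) (almost : AlmostSuccessor stage) →
                     AlmostSuccessor.k almost ≈ 0# → Successor stage
  kernel-successor zero stage almost _ = record
    { x′ = v ; lead = 1# ; lead≉0 = 1≉0 ; x′-symbol = v-symbol
    ; Yx′≈x = ≈ᴹ-trans Yv≈kx (layer-0 (L.*-closed 0 k (C⊆layer x∈C)) (C⊆layer x∈C))
    }
    where
    open AlmostSuccessor almost
    open Stage stage
  kernel-successor (suc n) stage almost k≈0 = contradiction
    (≈ᴹ-trans Yv≈kx (≈ᴹ-trans (*ₗ-congʳ k≈0) (*ₗ-zeroˡ _))) (kernel-Y n v-symbol)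
    where open AlmostSuccessor almost

  scaled-successor : ∀ {n} (stage : Stage n) (almost : AlmostSuccessor stage) {k⁻¹} →
                     AlmostSuccessor.k almost * k⁻¹ ≈ 1# → Successor stage
  scaled-successor stage almost {k⁻¹} kk⁻¹≈1 = record
    { x′ = k⁻¹ *ₗ v
    ; lead = k⁻¹
    ; lead≉0 = λ k⁻¹≈0 → 1≉0 (ℂ-Ring.trans (ℂ-Ring.sym kk⁻¹≈1)
        (ℂ-Ring.trans (ℂ-Ring.*-congˡ k⁻¹≈0) (ℂ-Ring.zeroʳ k)))
    ; x′-symbol = symbol-resp ≈ᴹ-refl (ℂ-Ring.*-identityʳ k⁻¹ , ℂ-Ring.zeroʳ k⁻¹) (symbol-* k⁻¹ v-symbol)
    ; Yx′≈x = begin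
        Y (k⁻¹ *ₗ v)        ≈⟨ Y′.f-* k⁻¹ v ⟩
        k⁻¹ *ₗ Y v          ≈⟨ *ₗ-congˡ Yv≈kx ⟩
        k⁻¹ *ₗ (k *ₗ x)     ≈⟨ *ₗ-assoc k⁻¹ k x ⟨
        (k⁻¹ * k) *ₗ x      ≈⟨ *ₗ-congʳ (ℂ-Ring.trans (ℂ-Ring.*-comm k⁻¹ k) kk⁻¹≈1) ⟩
        1# *ₗ x             ≈⟨ *ₗ-identityˡ x ⟩
        x                   ∎
    }
    where
    open AlmostSuccessor almost
    open Stage stage

  -- Abstract because unfolding it in later types makes conversion checking intractable.
  abstract
    successor : ∀ {n} (stage : Stage n) → Successor stage
    successor {n} stage = decide (almostSuccessor stage) em
      where
      decide : ∀ (almost : AlmostSuccessor stage) → Dec (AlmostSuccessor.k almost ≈ 0#) → Successor stage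
      decide almost (yes k≈0) = kernel-successor n stage almost k≈0
      decide almost (no k≉0)  = scaled-successor stage almost (proj₂ (inverse _ k≉0))

  stage : ∀ n → Stage n
  stage zero    = stage₀
  stage (suc n) = nextStage (stage n) (successor (stage n))

  ladder : Ladder M F
  ladder = record
    { x = λ n → x′ (successor (stage n))
    ; lead = λ n → lead (successor (stage n))
    ; lead≉0 = λ n → lead≉0 (successor (stage n))
    ; x-symbol = λ n → x′-symbol (successor (stage n))
    ; Yx₀≈0 = Yx′≈x (successor stage₀)
    ; Yxₙ₊₁≈xₙ = λ n → Yx′≈x (successor (stage (suc n)))
    }
    where open Successor

module _ (M N : ℂGModule) where
  private
    module M = ℂGModule M
    module N = ℂGModule N

  trivial-kernel⇒injective : {φ : M.Carrierᴹ → N.Carrierᴹ} → (∀ {x y} → x M.≈ᴹ y → φ x N.≈ᴹ φ y) →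
    (∀ x y → φ (x M.+ᴹ y) N.≈ᴹ φ x N.+ᴹ φ y) → (∀ k x → φ (k M.*ₗ x) N.≈ᴹ k N.*ₗ φ x) →
    (∀ x → φ x N.≈ᴹ N.0ᴹ → x M.≈ᴹ M.0ᴹ) → ∀ {x y} → φ x N.≈ᴹ φ y → x M.≈ᴹ y
  trivial-kernel⇒injective {φ} φ-cong φ-+ φ-* kernel {x} {y} φx≈φy =
    x∙y⁻¹≈ε⇒x≈y x y (kernel (x M.-ᴹ y) (begin
      φ (x M.-ᴹ y)                               ≈⟨ φ-+ x (M.-ᴹ y) ⟩
      φ x N.+ᴹ φ (M.-ᴹ y)                        ≈⟨ N.+ᴹ-congˡ (φ-cong (ModuleProperties.-1*≈- M y)) ⟨
      φ x N.+ᴹ φ (fromℤℂ ℤ.-1ℤ M.*ₗ y)           ≈⟨ N.+ᴹ-cong φx≈φy (φ-* (fromℤℂ ℤ.-1ℤ) y) ⟩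
      φ y N.+ᴹ fromℤℂ ℤ.-1ℤ N.*ₗ φ y             ≈⟨ N.+ᴹ-congˡ (ModuleProperties.-1*≈- N (φ y)) ⟩
      φ y N.-ᴹ φ y                               ≈⟨ N.-ᴹ‿inverseʳ (φ y) ⟩
      N.0ᴹ                                       ∎))
    where
    open AbelianGroupProperties M.+ᴹ-abelianGroup using (x∙y⁻¹≈ε⇒x≈y)
    open SetoidReasoning N.≈ᴹ-setoid

module _ {L M N : ℂGModule} where
  private
    module L = ℂGModule L
    module M = ℂGModule M
    module N = ℂGModule N

  -- Symmetry and transitivity in one step, for comparing two modules through the model. The chosen
  -- preimages respect equality and the operations because the map L → M is injective.
  ≅-cospan : L ≅ M → L ≅ N → M ≅ N
  ≅-cospan L≅M L≅N = mk≅ M N {λ y → g.to (section y)}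
    (λ y≈z → g.⟦⟧-cong (section-unique (M.≈ᴹ-trans (f-section _) y≈z)))
    (λ y z → N.≈ᴹ-trans
      (g.⟦⟧-cong (L.≈ᴹ-sym (section-unique (M.≈ᴹ-trans (f.+ᴹ-homo _ _) (M.+ᴹ-cong (f-section y) (f-section z))))))
      (g.+ᴹ-homo _ _))
    (λ k y → N.≈ᴹ-trans
      (g.⟦⟧-cong (L.≈ᴹ-sym (section-unique (M.≈ᴹ-trans (f.*ₗ-homo k _) (M.*ₗ-congˡ (f-section y))))))
      (g.*ₗ-homo k _))
    (λ {y} {z} gy≈gz → M.≈ᴹ-trans (M.≈ᴹ-sym (f-section y))
      (M.≈ᴹ-trans (f.⟦⟧-cong (g.injective gy≈gz)) (f-section z)))
    (λ w → f.to (proj₁ (g.preimage w)) , N.≈ᴹ-trans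
      (g.⟦⟧-cong (L.≈ᴹ-sym (section-unique M.≈ᴹ-refl))) (proj₂ (g.preimage w)))
    (equivariant-section S)
    (equivariant-section U)
    where
    module f = ≅-Properties L≅M
    module g = ≅-Properties L≅N

    section : M.Carrierᴹ → L.Carrierᴹ
    section y = proj₁ (f.preimage y)

    f-section : ∀ y → f.to (section y) M.≈ᴹ y
    f-section y = proj₂ (f.preimage y)

    section-unique : ∀ {x y} → f.to x M.≈ᴹ y → x L.≈ᴹ section y
    section-unique {x} {y} fx≈y = f.injective (M.≈ᴹ-trans fx≈y (M.≈ᴹ-sym (f-section y)))

    equivariant-section : ∀ h y → g.to (section (h M.· y)) N.≈ᴹ h N.· g.to (section y)
    equivariant-section h y = N.≈ᴹ-trans
      (g.⟦⟧-cong (L.≈ᴹ-sym (section-unique (M.≈ᴹ-trans (f.·-homo h _) (·-congʳ M h (f-section y))))))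
      (g.·-homo h _)

-- The isomorphism from the model given by a ladder

module FromLadder (em : ExcludedMiddle 0ℓ) (M : ℂGModule) (F : VFiltration M) (ladder : Ladder M F) where

  open ℂGModule M
  open Ladder ladder
  open ModuleProperties M
  open VFiltration F
  open Filtered M F
  open Relations M F
  open Model using (M∞; VanishesFrom; vanishes-weaken; single; single-vanishes; single-diagonal; σ; υ)
  open Field em using (inverse)
  open ℂSolver using (_:+_; _:*_)
  open ℂ-Ring using (0#; _≈_; _+_; _*_; -_)
  open SetoidReasoning ≈ᴹ-setoid
  private
    module ℂL = LinearSolver TensorUnit.leftModule
    module L n = Subspace (subspace (layer n))

  partialSum : (ℕ → ℂ) → ℕ → Carrierᴹ
  partialSum f zero    = 0ᴹ
  partialSum f (suc n) = partialSum f n +ᴹ f n *ₗ x n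

  partialSum-cong : ∀ {f g} n → (∀ k → k ℕ.< n → f k ≈ g k) → partialSum f n ≈ᴹ partialSum g n
  partialSum-cong zero    f≈g = ≈ᴹ-refl
  partialSum-cong (suc n) f≈g = +ᴹ-cong
    (partialSum-cong n λ k k<n → f≈g k (ℕ.m≤n⇒m≤1+n k<n)) (*ₗ-congʳ (f≈g n ℕ.≤-refl))

  partialSum-0 : ∀ n → partialSum (λ _ → 0#) n ≈ᴹ 0ᴹ
  partialSum-0 zero    = ≈ᴹ-refl
  partialSum-0 (suc n) = ≈ᴹ-trans (+ᴹ-cong (partialSum-0 n) (*ₗ-zeroˡ (x n))) (+ᴹ-identityˡ 0ᴹ)

  partialSum-+ : ∀ f g n → partialSum (λ k → f k + g k) n ≈ᴹ partialSum f n +ᴹ partialSum g n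
  partialSum-+ f g zero    = ≈ᴹ-sym (+ᴹ-identityˡ 0ᴹ)
  partialSum-+ f g (suc n) = ≈ᴹ-trans (+ᴹ-congʳ (partialSum-+ f g n))
    (linear (f n ∷ g n ∷ []) (partialSum f n ∷ partialSum g n ∷ x n ∷ [])
      (λ a b p q x → (p ⊕ q) ⊕ (a :+ b) ⊛ x ⊜ (p ⊕ a ⊛ x) ⊕ (q ⊕ b ⊛ x)) refl)

  partialSum-* : ∀ c f n → partialSum (λ k → c * f k) n ≈ᴹ c *ₗ partialSum f n
  partialSum-* c f zero    = ≈ᴹ-sym (*ₗ-zeroʳ c)
  partialSum-* c f (suc n) = ≈ᴹ-trans (+ᴹ-congʳ (partialSum-* c f n))
    (linear (c ∷ f n ∷ []) (partialSum f n ∷ x n ∷ [])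
      (λ c a p x → c ⊛ p ⊕ (c :* a) ⊛ x ⊜ c ⊛ (p ⊕ a ⊛ x)) refl)

  partialSum-neg : ∀ f n → partialSum (λ k → - f k) n ≈ᴹ -ᴹ partialSum f n
  partialSum-neg f zero    = linear [] [] (𝟎 ⊜ ⊝ 𝟎) refl
  partialSum-neg f (suc n) = ≈ᴹ-trans (+ᴹ-congʳ (partialSum-neg f n))
    (linear (f n ∷ []) (partialSum f n ∷ x n ∷ [])
      (λ a p x → ⊝ p ⊕ (ℂSolver.:- a) ⊛ x ⊜ ⊝ (p ⊕ a ⊛ x)) refl)

  partialSum-stable : ∀ f {m n} → m ℕ.≤′ n → (∀ k → m ℕ.≤ k → f k ≈ 0#) → partialSum f n ≈ᴹ partialSum f m
  partialSum-stable f     (ℕ.≤′-reflexive refl) f≈0 = ≈ᴹ-refl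
  partialSum-stable f {m} (ℕ.≤′-step {n} m≤n)   f≈0 = begin
    partialSum f n +ᴹ f n *ₗ x n  ≈⟨ +ᴹ-cong (partialSum-stable f m≤n f≈0) (*ₗ-congʳ (f≈0 n (ℕ.≤′⇒≤ m≤n))) ⟩
    partialSum f m +ᴹ 0# *ₗ x n   ≈⟨ +ᴹ-congˡ (*ₗ-zeroˡ (x n)) ⟩
    partialSum f m +ᴹ 0ᴹ          ≈⟨ +ᴹ-identityʳ _ ⟩
    partialSum f m                ∎

  -- Y lowers the index of each x_k, so on coefficients it is the left shift N of the model.
  Y-partialSum-suc : ∀ f n → Y (partialSum f (suc n)) ≈ᴹ partialSum (f ∘ suc) n
  Y-partialSum-suc f zero = begin
    Y (0ᴹ +ᴹ f 0 *ₗ x 0)        ≈⟨ Y′.f-+ 0ᴹ (f 0 *ₗ x 0) ⟩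
    Y 0ᴹ +ᴹ Y (f 0 *ₗ x 0)      ≈⟨ +ᴹ-cong Y′.f-0 (Y′.f-* (f 0) (x 0)) ⟩
    0ᴹ +ᴹ f 0 *ₗ Y (x 0)        ≈⟨ +ᴹ-identityˡ _ ⟩
    f 0 *ₗ Y (x 0)              ≈⟨ *ₗ-congˡ Yx₀≈0 ⟩
    f 0 *ₗ 0ᴹ                   ≈⟨ *ₗ-zeroʳ (f 0) ⟩
    0ᴹ                          ∎
  Y-partialSum-suc f (suc n) = ≈ᴹ-trans (Y′.f-+ _ _) (+ᴹ-cong (Y-partialSum-suc f n)
    (≈ᴹ-trans (Y′.f-* (f (suc n)) (x (suc n))) (*ₗ-congˡ (Yxₙ₊₁≈xₙ n))))

  Y-partialSum : ∀ f n → (∀ k → n ℕ.≤ k → f k ≈ 0#) → Y (partialSum f n) ≈ᴹ partialSum (f ∘ suc) n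
  Y-partialSum f n f≈0 = ≈ᴹ-trans
    (Y′.f-cong (≈ᴹ-sym (partialSum-stable f (ℕ.≤′-step ℕ.≤′-refl) f≈0))) (Y-partialSum-suc f n)

  -- First components are coefficients of x_k and second ones of Sx_k. The bound is an argument
  -- because a sequence does not reveal where its support ends.
  combine : ℕ → (ℕ → ℂ × ℂ) → Carrierᴹ
  combine n h = partialSum (proj₁ ∘ h) n +ᴹ S · partialSum (proj₂ ∘ h) n

  combine-cong : ∀ {h h′} n → (∀ k → k ℕ.< n → h k ℂV.≈ᴹ h′ k) → combine n h ≈ᴹ combine n h′
  combine-cong n h≈h′ = +ᴹ-cong (partialSum-cong n λ k k<n → proj₁ (h≈h′ k k<n))
    (S·.f-cong (partialSum-cong n λ k k<n → proj₂ (h≈h′ k k<n)))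

  combine-+ : ∀ h h′ n → combine n (λ k → h k ℂV.+ᴹ h′ k) ≈ᴹ combine n h +ᴹ combine n h′
  combine-+ h h′ n = ≈ᴹ-trans
    (+ᴹ-cong (partialSum-+ _ _ n) (≈ᴹ-trans (S·.f-cong (partialSum-+ _ _ n)) (S·.f-+ _ _)))
    (linear [] (partialSum (proj₁ ∘ h) n ∷ partialSum (proj₁ ∘ h′) n
                ∷ S · partialSum (proj₂ ∘ h) n ∷ S · partialSum (proj₂ ∘ h′) n ∷ [])
      (λ a b c d → (a ⊕ b) ⊕ (c ⊕ d) ⊜ (a ⊕ c) ⊕ (b ⊕ d)) refl)

  combine-* : ∀ c h n → combine n (λ k → c ℂV.*ₗ h k) ≈ᴹ c *ₗ combine n h
  combine-* c h n = ≈ᴹ-trans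
    (+ᴹ-cong (partialSum-* c _ n) (≈ᴹ-trans (S·.f-cong (partialSum-* c _ n)) (S·.f-* c _)))
    (≈ᴹ-sym (*ₗ-distribˡ c _ _))

  combine-stable : ∀ {m n h} → m ℕ.≤ n → VanishesFrom m h → combine n h ≈ᴹ combine m h
  combine-stable m≤n h≈0 = +ᴹ-cong
    (partialSum-stable _ (ℕ.≤⇒≤′ m≤n) λ k m≤k → proj₁ (h≈0 k m≤k))
    (S·.f-cong (partialSum-stable _ (ℕ.≤⇒≤′ m≤n) λ k m≤k → proj₂ (h≈0 k m≤k)))

  combine-σ : ∀ h n → combine n (σ h) ≈ᴹ S · combine n h
  combine-σ h n = begin
    partialSum (λ k → - proj₂ (h k)) n +ᴹ S · p
      ≈⟨ +ᴹ-congʳ (partialSum-neg (proj₂ ∘ h) n) ⟩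
    -ᴹ q +ᴹ S · p           ≈⟨ +ᴹ-congʳ (SS≈- q) ⟨
    S · S · q +ᴹ S · p      ≈⟨ +ᴹ-comm _ _ ⟩
    S · p +ᴹ S · S · q      ≈⟨ S·.f-+ p (S · q) ⟨
    S · (p +ᴹ S · q)        ∎
    where
    p = partialSum (proj₁ ∘ h) n
    q = partialSum (proj₂ ∘ h) n

  -- Write U = Y + S. On the x_k, Y is the shift; on the Sx_k, `YS≈` expresses it by shifts.
  -- Collecting terms gives the two components of `υ`.
  combine-υ : ∀ h n → VanishesFrom n h → combine n (υ h) ≈ᴹ U · combine n h
  combine-υ h n h≈0 = begin
    combine n (υ h)
      ≈⟨ +ᴹ-cong first (S·.f-cong second) ⟩
    (-ᴹ q +ᴹ (p₁ +ᴹ q₁ -ᴹ q₂)) +ᴹ S · (p +ᴹ q -ᴹ q₁)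
      ≈⟨ +ᴹ-congˡ (≈ᴹ-trans (S·.f-sub (p +ᴹ q) q₁) (+ᴹ-congʳ (S·.f-+ p q))) ⟩
    (-ᴹ q +ᴹ (p₁ +ᴹ q₁ -ᴹ q₂)) +ᴹ (S · p +ᴹ S · q -ᴹ S · q₁)
      ≈⟨ linear [] (q ∷ p₁ ∷ q₁ ∷ q₂ ∷ S · p ∷ S · q ∷ S · q₁ ∷ [])
           (λ q p₁ q₁ q₂ Sp Sq Sq₁ →
             (⊝ q ⊕ (p₁ ⊕ q₁ ⊖ q₂)) ⊕ (Sp ⊕ Sq ⊖ Sq₁)
             ⊜ (p₁ ⊕ ((Sq ⊖ Sq₁) ⊖ q₂ ⊕ q₁)) ⊕ (Sp ⊖ q)) refl ⟩
    (p₁ +ᴹ ((S · q -ᴹ S · q₁) -ᴹ q₂ +ᴹ q₁)) +ᴹ (S · p -ᴹ q)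
      ≈⟨ +ᴹ-cong (+ᴹ-cong Yp≈p₁ YSq≈) (+ᴹ-congˡ (SS≈- q)) ⟨
    (Y p +ᴹ Y (S · q)) +ᴹ (S · p +ᴹ S · S · q)
      ≈⟨ +ᴹ-cong (Y′.f-+ p (S · q)) (S·.f-+ p (S · q)) ⟨
    Y (p +ᴹ S · q) +ᴹ S · (p +ᴹ S · q)
      ≈⟨ linear [] (U · (p +ᴹ S · q) ∷ S · (p +ᴹ S · q) ∷ []) (λ a b → (a ⊖ b) ⊕ b ⊜ a) refl ⟩
    U · (p +ᴹ S · q) ∎
    where
    f g : ℕ → ℂ
    f k = proj₁ (h k)
    g k = proj₂ (h k)
    p  = partialSum f n
    q  = partialSum g n
    p₁ = partialSum (f ∘ suc) n
    q₁ = partialSum (g ∘ suc) n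
    q₂ = partialSum (λ k → g (suc (suc k))) n

    Yp≈p₁ : Y p ≈ᴹ p₁
    Yp≈p₁ = Y-partialSum f n λ k n≤k → proj₁ (h≈0 k n≤k)

    Yq≈q₁ : Y q ≈ᴹ q₁
    Yq≈q₁ = Y-partialSum g n λ k n≤k → proj₂ (h≈0 k n≤k)

    Yq₁≈q₂ : Y q₁ ≈ᴹ q₂
    Yq₁≈q₂ = Y-partialSum (g ∘ suc) n λ k n≤k → proj₂ (h≈0 (suc k) (ℕ.m≤n⇒m≤1+n n≤k))

    YSq≈ : Y (S · q) ≈ᴹ (S · q -ᴹ S · q₁) -ᴹ q₂ +ᴹ q₁
    YSq≈ = ≈ᴹ-trans (YS≈ q) (+ᴹ-cong (sub-cong
      (≈ᴹ-trans (S·.f-sub q (Y q)) (sub-cong ≈ᴹ-refl (S·.f-cong Yq≈q₁)))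
      (≈ᴹ-trans (Y′.f-cong Yq≈q₁) Yq₁≈q₂)) Yq≈q₁)

    first : partialSum (proj₁ ∘ υ h) n ≈ᴹ -ᴹ q +ᴹ (p₁ +ᴹ q₁ -ᴹ q₂)
    first = ≈ᴹ-trans (partialSum-+ (λ k → - g k) _ n) (+ᴹ-cong (partialSum-neg g n)
      (≈ᴹ-trans (partialSum-+ (λ k → f (suc k) + g (suc k)) (λ k → - g (suc (suc k))) n)
        (+ᴹ-cong (partialSum-+ (f ∘ suc) (g ∘ suc) n) (partialSum-neg (λ k → g (suc (suc k))) n))))

    second : partialSum (proj₂ ∘ υ h) n ≈ᴹ p +ᴹ q -ᴹ q₁
    second = ≈ᴹ-trans (partialSum-+ (λ k → f k + g k) (λ k → - g (suc k)) n)
      (+ᴹ-cong (partialSum-+ f g n) (partialSum-neg (g ∘ suc) n))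

  partialSum∈ : ∀ f n → partialSum f n ∈ₛ layer n
  partialSum∈ f zero    = L.0-closed 0
  partialSum∈ f (suc n) = L.+-closed (suc n) (ascending n (partialSum∈ f n))
    (L.*-closed (suc n) (f n) (Symbol.in-layer (x-symbol n)))

  combine-symbol : ∀ h n → Symbol n (combine (suc n) h) (proj₁ (h n) * lead n , proj₂ (h n) * lead n)
  combine-symbol h n = symbol-resp ≈ᴹ-refl
    ( ℂL.linear (b ∷ []) (a * lead n ∷ []) (λ b y → (𝟎 ⊕ y) ⊕ ⊝ (𝟎 ⊕ b ⊛ 𝟎) ⊜ y) refl
    , ℂL.linear (a ∷ []) (b * lead n ∷ []) (λ a y → (𝟎 ⊕ a ⊛ 𝟎) ⊕ (𝟎 ⊕ y) ⊜ y) refl )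
    (symbol-+ (sum-symbol (proj₁ ∘ h)) (symbol-S (sum-symbol (proj₂ ∘ h))))
    where
    a = proj₁ (h n)
    b = proj₂ (h n)
    sum-symbol : ∀ f → Symbol n (partialSum f (suc n)) (ℂV.0ᴹ ℂV.+ᴹ f n ℂV.*ₗ (lead n , 0#))
    sum-symbol f = symbol-+ (∈⇒symbol-0 (partialSum∈ f n)) (symbol-* (f n) (x-symbol n))

  *-lead-cancel : ∀ n {k} → k * lead n ≈ 0# → k ≈ 0#
  *-lead-cancel n {k} eq = ℂ-Ring.trans (ℂ-Ring.sym (ℂ-Ring.*-identityʳ k))
    (ℂ-Ring.trans (ℂ-Ring.*-congˡ (ℂ-Ring.sym (proj₂ (inverse (lead n) (lead≉0 n)))))
      (ℂ-Ring.trans (ℂ-Ring.sym (ℂ-Ring.*-assoc k (lead n) _))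
        (ℂ-Ring.trans (ℂ-Ring.*-congʳ eq) (ℂ-Ring.zeroˡ _))))

  -- Coefficients are read off from the top down: in the last factor the class of the combination is
  -- the top entry times the nonzero leading coefficient.
  combine-injective : ∀ n h → VanishesFrom n h → combine n h ≈ᴹ 0ᴹ → ∀ k → h k ℂV.≈ᴹ ℂV.0ᴹ
  combine-injective zero    h h≈0 _  k = h≈0 k ℕ.z≤n
  combine-injective (suc n) h h≈0 eq   =
    combine-injective n h vanishes (≈ᴹ-trans (≈ᴹ-sym (combine-stable (ℕ.n≤1+n n) vanishes)) eq)
    where
    zero-symbol : (proj₁ (h n) * lead n , proj₂ (h n) * lead n) ℂV.≈ᴹ ℂV.0ᴹ
    zero-symbol = symbol-unique (combine-symbol h n)
      (∈⇒symbol-0 (L.≈-closed n (≈ᴹ-sym eq) (L.0-closed n)))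
    vanishes : VanishesFrom n h
    vanishes k n≤k = [ h≈0 k , (λ { refl → *-lead-cancel n (proj₁ zero-symbol) , *-lead-cancel n (proj₂ zero-symbol) }) ]
      (ℕ.m≤n⇒m<n∨m≡n n≤k)

  Image : ℕ → Carrierᴹ → Set
  Image n y = ∃ λ h → VanishesFrom n h × combine n h ≈ᴹ y

  -- The class of y, divided by the leading coefficient, prescribes the top entry; the difference
  -- lies one layer lower.
  combine-surjective : ∀ n y → y ∈ₛ layer n → Image n y
  combine-surjective zero    y y∈ = (λ _ → ℂV.0ᴹ) , (λ _ _ → ℂV.≈ᴹ-refl) ,
    ≈ᴹ-trans (≈ᴹ-trans (+ᴹ-identityˡ _) S·.f-0) (≈ᴹ-sym (zeroth y y∈))
  combine-surjective (suc n) y y∈ = fromSymbol (symbolOf y∈)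
    where
    lead⁻¹ = proj₁ (inverse (lead n) (lead≉0 n))

    cancel : ∀ k → k * lead⁻¹ * lead n ≈ k
    cancel k = ℂ-Ring.trans (ℂ-Ring.*-assoc k lead⁻¹ (lead n)) (ℂ-Ring.trans
      (ℂ-Ring.*-congˡ (ℂ-Ring.trans (ℂ-Ring.*-comm lead⁻¹ (lead n)) (proj₂ (inverse (lead n) (lead≉0 n)))))
      (ℂ-Ring.*-identityʳ k))

    top : ℂ × ℂ → ℕ → ℂ × ℂ
    top (α , β) = single n (α * lead⁻¹ , β * lead⁻¹)

    top-symbol : ∀ v → Symbol n (combine (suc n) (top v)) v
    top-symbol v = symbol-resp ≈ᴹ-refl
      (subst (λ w → (proj₁ w * lead n , proj₂ w * lead n) ℂV.≈ᴹ v) (≡.sym (single-diagonal n _))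
        (cancel (proj₁ v) , cancel (proj₂ v)))
      (combine-symbol (top v) n)

    extend : ∀ v → Image n (y -ᴹ combine (suc n) (top v)) → Image (suc n) y
    extend v (h , h≈0 , eq) = (λ k → h k ℂV.+ᴹ top v k) ,
      Model.vanishes-+ {h = h} {top v} (vanishes-weaken {h = h} (ℕ.n≤1+n n) h≈0) (single-vanishes n _) , (begin
        combine (suc n) (λ k → h k ℂV.+ᴹ top v k)
          ≈⟨ combine-+ h (top v) (suc n) ⟩
        combine (suc n) h +ᴹ combine (suc n) (top v)
          ≈⟨ +ᴹ-congʳ (≈ᴹ-trans (combine-stable (ℕ.n≤1+n n) h≈0) eq) ⟩
        (y -ᴹ combine (suc n) (top v)) +ᴹ combine (suc n) (top v)
          ≈⟨ linear [] (y ∷ combine (suc n) (top v) ∷ []) (λ a b → (a ⊖ b) ⊕ b ⊜ a) refl ⟩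
        y ∎)

    fromSymbol : (∃ λ v → Symbol n y v) → Image (suc n) y
    fromSymbol (v , y-symbol) = extend v (combine-surjective n _ (symbol-0⇒∈
      (symbol-resp ≈ᴹ-refl (ℂV.-ᴹ‿inverseʳ v) (symbol-sub y-symbol (top-symbol v)))))

  fromM∞ : ℂGModule.Carrierᴹ M∞ → Carrierᴹ
  fromM∞ (h , n , _) = combine n h

  -- Elements of `M∞` carry a support bound that equality ignores; both bounds are raised to their
  -- maximum, where zero entries contribute nothing.
  combine-bound : ∀ {m n h h′} → VanishesFrom m h → VanishesFrom n h′ →
                  (∀ k → h k ℂV.≈ᴹ h′ k) → combine m h ≈ᴹ combine n h′
  combine-bound {m} {n} {h} {h′} h≈0 h′≈0 h≈h′ = begin
    combine m h            ≈⟨ combine-stable (ℕ.m≤m⊔n m n) h≈0 ⟨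
    combine (m ℕ.⊔ n) h    ≈⟨ combine-cong (m ℕ.⊔ n) (λ k _ → h≈h′ k) ⟩
    combine (m ℕ.⊔ n) h′   ≈⟨ combine-stable (ℕ.m≤n⊔m m n) h′≈0 ⟩
    combine n h′           ∎

  combine-sum : ∀ {m n h h′} → VanishesFrom m h → VanishesFrom n h′ →
                combine (m ℕ.⊔ n) (λ k → h k ℂV.+ᴹ h′ k) ≈ᴹ combine m h +ᴹ combine n h′
  combine-sum {m} {n} {h} {h′} h≈0 h′≈0 = ≈ᴹ-trans (combine-+ h h′ (m ℕ.⊔ n))
    (+ᴹ-cong (combine-stable (ℕ.m≤m⊔n m n) h≈0) (combine-stable (ℕ.m≤n⊔m m n) h′≈0))

  fromM∞-surjective : ∀ y → ∃ λ h → fromM∞ h ≈ᴹ y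
  fromM∞-surjective y = preimage (combine-surjective _ y (proj₂ (exhaustive y)))
    where
    preimage : ∀ {n} → Image n y → ∃ λ h → fromM∞ h ≈ᴹ y
    preimage {n} (h , h≈0 , eq) = (h , n , h≈0) , eq

  M∞≅M : M∞ ≅ M
  M∞≅M = mk≅ M∞ M {fromM∞}
    (λ { {_ , _ , p} {_ , _ , q} → combine-bound p q })
    (λ (_ , _ , p) (_ , _ , q) → combine-sum p q)
    (λ k (h , n , _) → combine-* k h n)
    (λ {x} {y} → trivial-kernel⇒injective M∞ M {fromM∞}
      (λ { {_ , _ , p} {_ , _ , q} → combine-bound p q })
      (λ (_ , _ , p) (_ , _ , q) → combine-sum p q)
      (λ k (h , n , _) → combine-* k h n)
      (λ (h , n , p) → combine-injective n h p) {x} {y})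
    fromM∞-surjective
    (λ (h , n , _) → ≈ᴹ-trans (combine-cong n (λ k _ → Model.All.S-· h k)) (combine-σ h n))
    (λ (h , n , p) → ≈ᴹ-trans (combine-cong n (λ k _ → Model.All.U-· h k)) (combine-υ h n p))

uniqueness : ExcludedMiddle 0ℓ → ∀ M → TIndecomposable M → VFiltration M → Model.M∞ ≅ M
uniqueness em M indecomposable F =
  FromLadder.M∞≅M em M F (Chain.ladder em M indecomposable F)

theorem8p1 : ExcludedMiddle 0ℓ →
    (∃ λ M → TIndecomposable M × VFiltration M)
    × (∀ M M′ → TIndecomposable M → VFiltration M →
    TIndecomposable M′ → VFiltration M′ → M ≅ M′)
theorem8p1 em =
    (Model.M∞ , ModelIndecomposable.tIndecomposable em , Model.filtration)
  , λ M M′ t f t′ f′ → ≅-cospan (uniqueness em M t f) (uniqueness em M′ t′ f′)
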